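{- There is an absolute constant $K>0$ such that the following holds. Let $\mathcal H$ be an $r_1$-uniform $(1/\kappa;r_1,\ldots,r_\lambda)$-spread (multi-)hypergraph with $r_\lambda=1$. Let $X=V(\mathcal H)$ and let the elements of $X$ be colored independently and uniformly at random from $[k]=\{1,\dots,k\}$, where $k\ge r_1$. If \[ p\ge \frac{C\lambda}{\kappa} \] with $C\ge K$, then with probability at least $1-\frac{K}{C\lambda}$, $X_p$ contains a rainbow edge of $\mathcal H$.
   Context: A (multi-)hypergraph on a finite set $X$ is a collection of subsets of $X$ (edges), with repetitions allowed; all counts of edges are with multiplicity. It is $r$-uniform (resp. $r$-bounded) if every edge has size exactly (resp. at most) $r$. For $A\subseteq X$, $d(A)$ is the number of edges containing $A$. For a real number $0<q\le 1$ and positive integers $r_1>\cdots>r_\lambda$, a hypergraph $\mathcal H$ on $X$ is $(q;r_1,\ldots,r_\lambda)$-spread if $\mathcal H$ is non-empty, $r_1$-bounded, and for all $A\subseteq X$ with $d(A)>0$ and $r_i\ge|A|\ge r_{i+1}$ for some $1\le i<\lambda$, we have for all $j\ge r_{i+1}$ that $|\{S\in\mathcal H:|A\cap S|=j\}|\le q^j|\mathcal H|$. $X_p$ denotes the random subset of $X$ containing each $x\in X$ independently with probability $p$, chosen independently of the coloring. An edge is rainbow if its vertices have pairwise distinct colors; $X_p$ contains an edge $e$ if $e\subseteq X_p$.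
   Formalization: The formal theorem assumes λ ≥ 2; for λ = 1 the spread condition is empty and the claim fails (one edge {x}, r_1 = 1, C = 2K, κ = max(8K,1), p = C/κ ≤ 1/4 gives success probability p < 1/2 = 1 − K/C). -}

module Defs where

open import Data.Fin using (Fin; zero; suc; inject₁)
open import Data.Fin.Properties using (all?) renaming (_≟_ to _≟ᶠ_)
open import Data.Fin.Subset using (Side; Subset; inside; outside; _∈_; _⊆_; _∩_; ∣_∣)
open import Data.Fin.Subset.Properties using (_∈?_; _⊆?_)
import Data.Integer as ℤ
open import Data.List as List using (List; []; _∷_; length; filter; cartesianProduct; cartesianProductWith; allFin)
open import Data.List.Relation.Unary.All using (All)
open import Data.List.Relation.Unary.Any using (Any; any?)
open import Data.Nat as ℕ using (ℕ; zero; suc; _≤_; _<_; NonZero)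
import Data.Nat.Properties as ℕₚ
open import Data.Product using (Σ; ∃; _×_; _,_)
open import Data.Rational as ℚ using (ℚ; 0ℚ; 1ℚ; ½)
import Data.Rational.Properties as ℚₚ
open import Data.Rational.Solver using (module +-*-Solver)
open import Data.Vec as Vec using (Vec; lookup)
open import Relation.Binary.PropositionalEquality using (_≡_; _≢_; refl; sym; trans; cong; cong₂; subst; subst₂)
open import Relation.Nullary using (¬?)
open import Relation.Nullary.Decidable using (_×-dec_; _→-dec_)
open import Relation.Unary using (Decidable)

open +-*-Solver using (solve; _:+_; _:*_; _:-_; :-_; _:=_; con)

half-pos : ∀ {ε} → 0ℚ ℚ.< ε → 0ℚ ℚ.< ½ ℚ.* ε
half-pos {ε} ε>0 = subst (ℚ._< ½ ℚ.* ε) (ℚₚ.*-zeroʳ ½) (ℚₚ.*-monoʳ-<-pos ½ ε>0)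

half+half : ∀ ε → ½ ℚ.* ε ℚ.+ ½ ℚ.* ε ≡ ε
half+half = solve 1 (λ e → con ½ :* e :+ con ½ :* e := e) refl

*-pos : ∀ {a b} → 0ℚ ℚ.< a → 0ℚ ℚ.< b → 0ℚ ℚ.< a ℚ.* b
*-pos {a} {b} a>0 b>0 =
  subst (ℚ._< a ℚ.* b) (ℚₚ.*-zeroʳ a) (ℚₚ.*-monoʳ-<-pos a {{ℚ.positive a>0}} b>0)

*-mono-≤-nonNeg : ∀ {a b c d} → 0ℚ ℚ.≤ b → 0ℚ ℚ.≤ c → a ℚ.≤ b → c ℚ.≤ d → a ℚ.* c ℚ.≤ b ℚ.* d
*-mono-≤-nonNeg {a} {b} {c} {d} b≥0 c≥0 a≤b c≤d =
  ℚₚ.≤-trans (ℚₚ.*-monoʳ-≤-nonNeg c {{ℚ.nonNegative c≥0}} a≤b)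
             (ℚₚ.*-monoˡ-≤-nonNeg b {{ℚ.nonNegative b≥0}} c≤d)

abs-nonNeg : ∀ a → 0ℚ ℚ.≤ ℚ.∣ a ∣
abs-nonNeg a = ℚₚ.nonNegative⁻¹ ℚ.∣ a ∣ {{ℚₚ.∣-∣-nonNeg a}}

recip : ∀ a → 0ℚ ℚ.< a → ℚ
recip a a>0 = (ℚ.1/ a) {{ℚₚ.pos⇒nonZero a {{ℚ.positive a>0}}}}

recip-pos : ∀ a (a>0 : 0ℚ ℚ.< a) → 0ℚ ℚ.< recip a a>0
recip-pos a a>0 = ℚₚ.positive⁻¹ _ {{ℚₚ.1/pos⇒pos a {{ℚ.positive a>0}}}}

recip-inverse : ∀ a (a>0 : 0ℚ ℚ.< a) → a ℚ.* recip a a>0 ≡ 1ℚ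
recip-inverse a a>0 = ℚₚ.*-inverseʳ a {{ℚₚ.pos⇒nonZero a {{ℚ.positive a>0}}}}

<-⊔ : ∀ {c} a → 0ℚ ℚ.< c → 0ℚ ℚ.< c ℚ.⊔ a
<-⊔ {c} a c>0 = ℚₚ.<-≤-trans c>0 (ℚₚ.p≤p⊔q c a)

-- Real numbers: Cauchy sequences of rationals, compared by _≤ℝ_ and _<ℝ_
-- (two sequences represent the same real number when each is ≤ℝ the other)

record ℝ : Set where
  no-eta-equality
  constructor mkℝ
  field
    seq    : ℕ → ℚ
    cauchy : ∀ ε → 0ℚ ℚ.< ε → ∃ λ N → ∀ m n → N ≤ m → N ≤ n → ℚ.∣ seq m ℚ.- seq n ∣ ℚ.≤ ε

open ℝ public

infix  4 _≤ℝ_ _<ℝ_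
infixl 6 _+ℝ_ _-ℝ_
infixl 7 _*ℝ_
infixr 8 _^ℝ_

record _≤ℝ_ (x y : ℝ) : Set where
  constructor mk≤
  field
    eventually-≤ : ∀ ε → 0ℚ ℚ.< ε → ∃ λ N → ∀ n → N ≤ n → seq x n ℚ.≤ seq y n ℚ.+ ε

open _≤ℝ_ public

record _<ℝ_ (x y : ℝ) : Set where
  constructor mk<
  field
    gap          : ℚ
    gap-positive : 0ℚ ℚ.< gap
    eventually-< : ∃ λ N → ∀ n → N ≤ n → seq x n ℚ.+ gap ℚ.≤ seq y n

open _<ℝ_ public

fromℚ : ℚ → ℝ
seq    (fromℚ a) _ = a
cauchy (fromℚ a) ε ε>0 = 0 , λ _ _ _ _ →
  subst (ℚ._≤ ε) (sym (cong ℚ.∣_∣ (ℚₚ.+-inverseʳ a))) (ℚₚ.<⇒≤ ε>0)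

fromℕ : ℕ → ℝ
fromℕ n = fromℚ (ℤ.+ n ℚ./ 1)

0ℝ 1ℝ : ℝ
0ℝ = fromℚ 0ℚ
1ℝ = fromℚ 1ℚ

_+ℝ_ : ℝ → ℝ → ℝ
seq    (x +ℝ y) n = seq x n ℚ.+ seq y n
cauchy (x +ℝ y) ε ε>0 =
  let (N , p) = cauchy x (½ ℚ.* ε) (half-pos ε>0)
      (M , q) = cauchy y (½ ℚ.* ε) (half-pos ε>0)
  in N ℕ.⊔ M , λ m n m≥ n≥ →
    subst₂ ℚ._≤_
      (cong ℚ.∣_∣ (solve 4 (λ a b c d → (a :- c) :+ (b :- d) := (a :+ b) :- (c :+ d)) refl
        (seq x m) (seq y m) (seq x n) (seq y n)))
      (half+half ε)
      (ℚₚ.≤-trans (ℚₚ.∣p+q∣≤∣p∣+∣q∣ (seq x m ℚ.- seq x n) (seq y m ℚ.- seq y n))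
        (ℚₚ.+-mono-≤ (p m n (ℕₚ.m⊔n≤o⇒m≤o N M m≥) (ℕₚ.m⊔n≤o⇒m≤o N M n≥))
                     (q m n (ℕₚ.m⊔n≤o⇒n≤o N M m≥) (ℕₚ.m⊔n≤o⇒n≤o N M n≥))))

-ℝ_ : ℝ → ℝ
seq    (-ℝ x) n = ℚ.- seq x n
cauchy (-ℝ x) ε ε>0 =
  let (N , p) = cauchy x ε ε>0
  in N , λ m n m≥ n≥ →
    subst (ℚ._≤ ε)
      (cong ℚ.∣_∣ (solve 2 (λ a b → b :- a := (:- a) :- (:- b)) refl (seq x m) (seq x n)))
      (p n m n≥ m≥)

_-ℝ_ : ℝ → ℝ → ℝ
x -ℝ y = x +ℝ (-ℝ y)

eventually-bounded : ∀ x → Σ ℚ λ B → 0ℚ ℚ.< B × ∃ λ N → ∀ n → N ≤ n → ℚ.∣ seq x n ∣ ℚ.≤ B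
eventually-bounded x =
  let (N , p) = cauchy x 1ℚ (ℚₚ.positive⁻¹ 1ℚ)
      a = seq x N
  in 1ℚ ℚ.+ ℚ.∣ a ∣
   , ℚₚ.+-mono-<-≤ (ℚₚ.positive⁻¹ 1ℚ) (abs-nonNeg a)
   , N
   , λ n n≥ → subst (ℚ._≤ 1ℚ ℚ.+ ℚ.∣ a ∣)
       (cong ℚ.∣_∣ (solve 2 (λ u v → (u :- v) :+ v := u) refl (seq x n) a))
       (ℚₚ.≤-trans (ℚₚ.∣p+q∣≤∣p∣+∣q∣ (seq x n ℚ.- a) a)
         (ℚₚ.+-monoˡ-≤ ℚ.∣ a ∣ (p n N n≥ ℕₚ.≤-refl)))

_*ℝ_ : ℝ → ℝ → ℝ
seq    (x *ℝ y) n = seq x n ℚ.* seq y n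
cauchy (x *ℝ y) ε ε>0 =
  let (B , B>0 , N₁ , xB) = eventually-bounded x
      (D , D>0 , N₂ , yD) = eventually-bounded y
      B+D>0 = ℚₚ.+-mono-< B>0 D>0
      δ   = ε ℚ.* recip (B ℚ.+ D) B+D>0
      δ>0 = *-pos ε>0 (recip-pos (B ℚ.+ D) B+D>0)
      (N₃ , p) = cauchy x δ δ>0
      (N₄ , q) = cauchy y δ δ>0
      N₁₂ = N₁ ℕ.⊔ N₂
      N₃₄ = N₃ ℕ.⊔ N₄
  in N₁₂ ℕ.⊔ N₃₄ , λ m n m≥ n≥ →
    let a = seq x m
        b = seq y m
        c = seq x n
        d = seq y n
        m≥₁₂ = ℕₚ.m⊔n≤o⇒m≤o N₁₂ N₃₄ m≥
        n≥₁₂ = ℕₚ.m⊔n≤o⇒m≤o N₁₂ N₃₄ n≥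
        m≥₃₄ = ℕₚ.m⊔n≤o⇒n≤o N₁₂ N₃₄ m≥
        n≥₃₄ = ℕₚ.m⊔n≤o⇒n≤o N₁₂ N₃₄ n≥
        bound₁ = subst (ℚ._≤ B ℚ.* δ) (sym (ℚₚ.∣p*q∣≡∣p∣*∣q∣ a (b ℚ.- d)))
          (*-mono-≤-nonNeg (ℚₚ.<⇒≤ B>0) (abs-nonNeg (b ℚ.- d))
            (xB m (ℕₚ.m⊔n≤o⇒m≤o N₁ N₂ m≥₁₂))
            (q m n (ℕₚ.m⊔n≤o⇒n≤o N₃ N₄ m≥₃₄) (ℕₚ.m⊔n≤o⇒n≤o N₃ N₄ n≥₃₄)))
        bound₂ = subst (ℚ._≤ D ℚ.* δ) (sym (ℚₚ.∣p*q∣≡∣p∣*∣q∣ d (a ℚ.- c)))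
          (*-mono-≤-nonNeg (ℚₚ.<⇒≤ D>0) (abs-nonNeg (a ℚ.- c))
            (yD n (ℕₚ.m⊔n≤o⇒n≤o N₁ N₂ n≥₁₂))
            (p m n (ℕₚ.m⊔n≤o⇒m≤o N₃ N₄ m≥₃₄) (ℕₚ.m⊔n≤o⇒m≤o N₃ N₄ n≥₃₄)))
    in subst₂ ℚ._≤_
         (cong ℚ.∣_∣ (solve 4 (λ a b c d → a :* (b :- d) :+ d :* (a :- c) := a :* b :- c :* d) refl a b c d))
         (trans (solve 4 (λ B D e r → B :* (e :* r) :+ D :* (e :* r) := e :* ((B :+ D) :* r)) refl
                  B D ε (recip (B ℚ.+ D) B+D>0))
           (trans (cong (ε ℚ.*_) (recip-inverse (B ℚ.+ D) B+D>0)) (ℚₚ.*-identityʳ ε)))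
         (ℚₚ.≤-trans (ℚₚ.∣p+q∣≤∣p∣+∣q∣ (a ℚ.* (b ℚ.- d)) (d ℚ.* (a ℚ.- c)))
           (ℚₚ.+-mono-≤ bound₁ bound₂))

recip-lower : ∀ {c a} (c>0 : 0ℚ ℚ.< c) (a>0 : 0ℚ ℚ.< a) → c ℚ.≤ a → recip a a>0 ℚ.≤ recip c c>0
recip-lower {c} {a} c>0 a>0 c≤a =
  subst₂ ℚ._≤_
    (trans (solve 3 (λ c r s → c :* (r :* s) := s :* (c :* r)) refl c (recip c c>0) (recip a a>0))
      (trans (cong (recip a a>0 ℚ.*_) (recip-inverse c c>0)) (ℚₚ.*-identityʳ _)))
    (trans (solve 3 (λ a r s → a :* (r :* s) := r :* (a :* s)) refl a (recip c c>0) (recip a a>0))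
      (trans (cong (recip c c>0 ℚ.*_) (recip-inverse a a>0)) (ℚₚ.*-identityʳ _)))
    (ℚₚ.*-monoʳ-≤-nonNeg (recip c c>0 ℚ.* recip a a>0)
      {{ℚ.nonNegative (ℚₚ.<⇒≤ (*-pos (recip-pos c c>0) (recip-pos a a>0)))}} c≤a)

-- The reciprocal of a positive real. The witness c of positivity satisfies
-- c ≤ seq x n eventually, so c ⊔ seq x n is eventually seq x n and never 0.

inv : ∀ x → 0ℝ <ℝ x → ℝ
seq    (inv x (mk< c c>0 _)) n = recip (c ℚ.⊔ seq x n) (<-⊔ (seq x n) c>0)
cauchy (inv x (mk< c c>0 (N , c≤x))) ε ε>0 =
  let δ>0 = *-pos ε>0 (*-pos c>0 c>0)
      (M , p) = cauchy x (ε ℚ.* (c ℚ.* c)) δ>0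
      r = recip c c>0
      eq : ∀ n → N ≤ n → c ℚ.⊔ seq x n ≡ seq x n
      eq n n≥ = ℚₚ.p≤q⇒p⊔q≡q (subst (ℚ._≤ seq x n) (ℚₚ.+-identityˡ c) (c≤x n n≥))
  in N ℕ.⊔ M , λ m n m≥ n≥ →
    let a = c ℚ.⊔ seq x m
        b = c ℚ.⊔ seq x n
        a>0 = <-⊔ (seq x m) c>0
        b>0 = <-⊔ (seq x n) c>0
        u = recip a a>0
        v = recip b b>0
        u≥0 = ℚₚ.<⇒≤ (recip-pos a a>0)
        v≥0 = ℚₚ.<⇒≤ (recip-pos b b>0)
        r≥0 = ℚₚ.<⇒≤ (recip-pos c c>0)
        b-a≤δ = subst₂ (λ s t → ℚ.∣ s ℚ.- t ∣ ℚ.≤ ε ℚ.* (c ℚ.* c))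
          (sym (eq n (ℕₚ.m⊔n≤o⇒m≤o N M n≥))) (sym (eq m (ℕₚ.m⊔n≤o⇒m≤o N M m≥)))
          (p n m (ℕₚ.m⊔n≤o⇒n≤o N M n≥) (ℕₚ.m⊔n≤o⇒n≤o N M m≥))
        uv≤rr = *-mono-≤-nonNeg r≥0 v≥0
          (recip-lower c>0 a>0 (ℚₚ.p≤p⊔q c (seq x m)))
          (recip-lower c>0 b>0 (ℚₚ.p≤p⊔q c (seq x n)))
        uv≥0 = ℚₚ.<⇒≤ (*-pos (recip-pos a a>0) (recip-pos b b>0))
    in subst₂ ℚ._≤_
         (trans (cong (ℚ.∣ b ℚ.- a ∣ ℚ.*_) (sym (ℚₚ.0≤p⇒∣p∣≡p uv≥0)))
           (trans (sym (ℚₚ.∣p*q∣≡∣p∣*∣q∣ (b ℚ.- a) (u ℚ.* v)))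
             (cong ℚ.∣_∣
               (trans (solve 4 (λ a b u v → (b :- a) :* (u :* v) := u :* (b :* v) :- v :* (a :* u)) refl a b u v)
                 (cong₂ ℚ._-_
                   (trans (cong (u ℚ.*_) (recip-inverse b b>0)) (ℚₚ.*-identityʳ u))
                   (trans (cong (v ℚ.*_) (recip-inverse a a>0)) (ℚₚ.*-identityʳ v)))))))
         (trans (solve 3 (λ e c r → (e :* (c :* c)) :* (r :* r) := e :* ((c :* r) :* (c :* r))) refl ε c r)
           (trans (cong (λ t → ε ℚ.* (t ℚ.* t)) (recip-inverse c c>0)) (ℚₚ.*-identityʳ ε)))
         (*-mono-≤-nonNeg (ℚₚ.<⇒≤ δ>0) uv≥0 b-a≤δ uv≤rr)

_^ℝ_ : ℝ → ℕ → ℝ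
x ^ℝ zero  = 1ℝ
x ^ℝ suc n = x *ℝ (x ^ℝ n)

sumℝ : List ℝ → ℝ
sumℝ = List.foldr _+ℝ_ 0ℝ

<-≤ℝ-trans : ∀ {x y z} → x <ℝ y → y ≤ℝ z → x <ℝ z
<-≤ℝ-trans {x} {y} {z} (mk< ε ε>0 (N , p)) y≤z =
  let η = ½ ℚ.* ε
      (M , q) = eventually-≤ y≤z η (half-pos ε>0)
  in mk< η (half-pos ε>0) (N ℕ.⊔ M , λ n n≥ →
    subst₂ ℚ._≤_
      (trans (cong (λ e → seq x n ℚ.+ e ℚ.- η) (sym (half+half ε)))
        (solve 2 (λ a h → a :+ (h :+ h) :- h := a :+ h) refl (seq x n) η))
      (solve 2 (λ b h → b :+ h :- h := b) refl (seq z n) η)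
      (ℚₚ.+-monoˡ-≤ (ℚ.- η)
        (ℚₚ.≤-trans (p n (ℕₚ.m⊔n≤o⇒m≤o N M n≥)) (q n (ℕₚ.m⊔n≤o⇒n≤o N M n≥)))))

*ℝ-pos : ∀ {x y} → 0ℝ <ℝ x → 0ℝ <ℝ y → 0ℝ <ℝ x *ℝ y
*ℝ-pos {x} {y} (mk< a a>0 (N , p)) (mk< b b>0 (M , q)) =
  mk< (a ℚ.* b) (*-pos a>0 b>0) (N ℕ.⊔ M , λ n n≥ →
    let a≤x = subst (ℚ._≤ seq x n) (ℚₚ.+-identityˡ a) (p n (ℕₚ.m⊔n≤o⇒m≤o N M n≥))
        b≤y = subst (ℚ._≤ seq y n) (ℚₚ.+-identityˡ b) (q n (ℕₚ.m⊔n≤o⇒n≤o N M n≥))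
    in subst (ℚ._≤ seq x n ℚ.* seq y n) (sym (ℚₚ.+-identityˡ (a ℚ.* b)))
         (*-mono-≤-nonNeg (ℚₚ.≤-trans (ℚₚ.<⇒≤ a>0) a≤x) (ℚₚ.<⇒≤ b>0) a≤x b≤y))

fromℕ-pos : ∀ n .{{_ : NonZero n}} → 0ℝ <ℝ fromℕ n
fromℕ-pos n@(suc _) = mk< (ℤ.+ n ℚ./ 1) (ℚₚ.positive⁻¹ _ {{ℚₚ.normalize-pos n 1}})
  (0 , λ _ _ → ℚₚ.≤-reflexive (ℚₚ.+-identityˡ _))

-- Multi-hypergraphs on X = Fin n

Hypergraph : ℕ → Set
Hypergraph n = List (Subset n)

Uniform Bounded : ∀ {n} → ℕ → Hypergraph n → Set
Uniform r H = All (λ S → ∣ S ∣ ≡ r) H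
Bounded r H = All (λ S → ∣ S ∣ ≤ r) H

degree : ∀ {n} → Hypergraph n → Subset n → ℕ
degree H A = length (filter (A ⊆?_) H)

meetingIn : ∀ {n} → Hypergraph n → Subset n → ℕ → ℕ
meetingIn H A j = length (filter (λ S → ∣ A ∩ S ∣ ℕ.≟ j) H)

-- The sequence r₁ > ⋯ > r_λ is r : Fin (suc ℓ) → ℕ with λ = suc ℓ, so that for
-- i : Fin ℓ the consecutive terms rᵢ, rᵢ₊₁ are r (inject₁ i) and r (suc i).

record Spread {n ℓ : ℕ} (q : ℝ) (r : Fin (suc ℓ) → ℕ) (H : Hypergraph n) : Set where
  field
    q-positive   : 0ℝ <ℝ q
    q≤1          : q ≤ℝ 1ℝ
    r-positive   : ∀ i → 0 < r i
    r-decreasing : ∀ (i : Fin ℓ) → r (suc i) < r (inject₁ i)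
    nonEmpty     : 0 < length H
    bounded      : Bounded (r zero) H
    spread       : ∀ (i : Fin ℓ) (A : Subset n) → 0 < degree H A →
                   ∣ A ∣ ≤ r (inject₁ i) → r (suc i) ≤ ∣ A ∣ →
                   ∀ j → r (suc i) ≤ j →
                   fromℕ (meetingIn H A j) ≤ℝ (q ^ℝ j) *ℝ fromℕ (length H)

Coloring : ℕ → ℕ → Set
Coloring k n = Vec (Fin k) n

Rainbow : ∀ {k n} → Coloring k n → Subset n → Set
Rainbow c e = ∀ x y → x ∈ e → y ∈ e → x ≢ y → lookup c x ≢ lookup c y

rainbow? : ∀ {k n} (c : Coloring k n) → Decidable (Rainbow c)
rainbow? c e = all? λ x → all? λ y →
  (x ∈? e) →-dec ((y ∈? e) →-dec (¬? (x ≟ᶠ y) →-dec ¬? (lookup c x ≟ᶠ lookup c y)))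

-- An outcome is a pair of a set W (the value of X_p) and a coloring of X.

Outcome : ℕ → ℕ → Set
Outcome k n = Subset n × Coloring k n

ContainsRainbowEdge : ∀ {k n} → Hypergraph n → Outcome k n → Set
ContainsRainbowEdge H (W , c) = Any (λ e → e ⊆ W × Rainbow c e) H

containsRainbowEdge? : ∀ {k n} (H : Hypergraph n) → Decidable (ContainsRainbowEdge {k} H)
containsRainbowEdge? H (W , c) = any? (λ e → (e ⊆? W) ×-dec rainbow? c e) H

allVecs : {A : Set} → List A → ∀ n → List (Vec A n)
allVecs as zero    = Vec.[] ∷ []
allVecs as (suc n) = cartesianProductWith Vec._∷_ as (allVecs as n)

outcomes : ∀ k n → List (Outcome k n)
outcomes k n = cartesianProduct (allVecs (outside ∷ inside ∷ []) n) (allVecs (allFin k) n)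

-- Mass function of a vector of independent entries, each with mass function w
productMass : {A : Set} {n : ℕ} → (A → ℝ) → Vec A n → ℝ
productMass w v = Vec.foldr _ (λ a m → w a *ℝ m) 1ℝ v

bernoulliMass : ℝ → Side → ℝ
bernoulliMass p inside  = p
bernoulliMass p outside = 1ℝ -ℝ p

uniformMass : ∀ k .{{_ : NonZero k}} → Fin k → ℝ
uniformMass k _ = inv (fromℕ k) (fromℕ-pos k)

mass : ∀ {k n} .{{_ : NonZero k}} → ℝ → Outcome k n → ℝ
mass {k} p (W , c) = productMass (bernoulliMass p) W *ℝ productMass (uniformMass k) c

Pr : ∀ {k n} .{{_ : NonZero k}} → ℝ → {P : Outcome k n → Set} → Decidable P → ℝ
Pr {k} {n} p P? = sumℝ (List.map (mass p) (filter P? (outcomes k n)))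

{-# OPTIONS --safe #-}

-- Replace H by the multi-hypergraph E on X × [k] whose edges are the graphs of the rainbow
-- colourings of the edges of H. A random rainbow colouring of an edge agrees with a given one on j
-- prescribed vertices with probability 1 / (k)_j ≤ (4 / k) ^ j, so E is spread with 1 / κ replaced
-- by O(1 / (κ k)). Random subsets of X × [k] of density p / k compare with the random colouring of
-- X_p row by row, because an edge of E meets every row {x} × [k] at most once.
--
-- It remains to find an edge of E in a random set W of density p / k. This set is exposed in λ - 1
-- rounds. In a round, an edge fragment A with A ∪ W = Z is blocked if every fragment inside Z meets
-- A in at least t = r (i + 1) points; otherwise some fragment B ⊆ A ∪ W has B ∖ W ⊆ A of size less
-- than t, and B ∖ W replaces A. Given Z, the posterior of A is the measure on fragments inside Z
-- with weights (1 / ρ) ^ |A|, so the square of the blocked mass is at most the mass of the pairs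
-- sharing at least t points, which the spread condition bounds. In the last round t = 1 and
-- Chebyshev's inequality applies.

module Submission where

open import Defs
open import Data.Bool using (if_then_else_)
open import Data.Empty using (⊥-elim)
open import Data.Fin using (Fin; zero; suc; inject₁) renaming (fromℕ to lastFin)
open import Data.Fin.Properties using (suc-injective) renaming (_≟_ to _≟ᶠ_)
open import Data.Fin.Subset using (Side; Subset; inside; outside; _∪_; _∩_; _⊆_; ∣_∣; _∈_; _∉_; ∁; ⊥; ⁅_⁆)
open import Data.Fin.Subset.Properties using (_⊆?_; _∈?_; p⊆q⇒∣p∣≤∣q∣; ∣p∣≤n; ∣p∩q∣≤∣p∣; ∣∁p∣≡n∸∣p∣; ∣⊥∣≡0; ∣⁅x⁆∣≡1; x∈p∪q⁻; x∈p∪q⁺; x∈p∩q⁺; x∈p∩q⁻; x∈∁p⇒x∉p; x∉p⇒x∈∁p; ∉⊥; ⊥⊆; x∈⁅x⁆; x∈⁅y⁆⇒x≡y; p∩q⊆p; p∩q⊆q; ⊆-refl; ⊆-trans; ⊆-antisym; s⊆s; out⊆; drop-∷-⊆; ∪-identityʳ; ∩-zeroˡ; ∩-zeroʳ; ∩-idem)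
import Data.Integer as ℤ
import Data.Integer.Properties as ℤₚ
open import Data.List as List using (List; []; _∷_; length; filter; _++_; concatMap; allFin; cartesianProductWith)
open import Data.List.Membership.Propositional using (find; lose) renaming (_∈_ to _∈ᴸ_)
open import Data.List.Membership.Propositional.Properties using (∈-allFin; ∈-concatMap⁻; ∈-map⁻; ∈-filter⁻)
import Data.List.Properties as Listₚ
open import Data.List.Relation.Unary.All as All using (All; []; _∷_)
import Data.List.Relation.Unary.All.Properties as Allₚ
open import Data.List.Relation.Unary.Any as Any using (Any; any?)
open import Data.Nat as ℕ using (ℕ; zero; suc; _≤_; NonZero)
import Data.Nat.Properties as ℕₚ
open import Data.Nat.Solver using () renaming (module +-*-Solver to ℕ-Solver)
open import Data.Product using (Σ; ∃; _×_; _,_; proj₁; proj₂)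
open import Data.Rational as ℚ using (ℚ; 0ℚ; 1ℚ; ½; _+_; _*_; _-_; -_) renaming (_≤_ to _≤ᵠ_; _<_ to _<ᵠ_)
import Data.Rational.Properties as ℚₚ
open import Data.Rational.Solver using (module +-*-Solver)
open import Data.Rational.Unnormalised as ℚᵘ using (mkℚᵘ; *≡*)
import Data.Rational.Unnormalised.Properties as ℚᵘₚ
open import Data.Sum as Sum using (inj₁; inj₂; _⊎_)
open import Data.Unit using (⊤; tt)
open import Data.Vec as Vec using (Vec; []; _∷_; here; there; lookup) renaming (_++_ to _⧺_)
open import Function using (id; _∘_)
open import Relation.Binary.Definitions using (tri<; tri≈; tri>)
open import Relation.Binary.PropositionalEquality using (_≡_; _≢_; refl; sym; trans; cong; cong₂; subst; subst₂)
open import Relation.Nullary using (Dec; yes; no; does; ¬_)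
open import Relation.Nullary.Decidable using (_→-dec_; _×-dec_; ¬?; decidable-stable)
open import Relation.Unary using (Decidable)

open +-*-Solver using (solve; _:+_; _:*_; _:-_; :-_; _:=_; con)
open ℕ-Solver using () renaming (solve to solveⁿ; _:+_ to infixl 6 _⊕_; _:*_ to infixl 7 _⊗_; _:=_ to infix 4 _⊜_; con to conⁿ)

-- The spread condition says nothing about overlaps smaller than `r (i + 1)`, nor about sets whose
-- size lies outside the window from `r (i + 1)` to `r i`. A round can therefore rule out only large
-- overlaps, and it must cut the fragments down to the next level before the next inequality becomes
-- usable. The colours of a vertex exclude one another, so the random coloured set is not a product
-- measure. Independent points of X × [k] make the second moment exact, with one factor `a = 1 / ρ`
-- for each common point. Exclusivity is then paid for only once, in the comparison of rows. All
-- estimates are made over ℚ, on single terms of the Cauchy sequences. In the rational statements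
-- about coloured edges, `κ` stands for 1 / k, and `q` for an upper bound on the spread parameter 1
-- / κ of the theorem. To avoid square roots, the loss `ε` of a round is chosen first and compared
-- with its second moment `δ` through `δ ≤ ε * ε`.

private variable
  A B : Set
  k n m : ℕ
  xs ys zs : List (Subset m)

-- Rational arithmetic

≤-by : ∀ {x y} d → 0ℚ ≤ᵠ d → x + d ≡ y → x ≤ᵠ y
≤-by {x} d d≥0 eq = subst₂ _≤ᵠ_ (ℚₚ.+-identityʳ x) eq (ℚₚ.+-monoʳ-≤ x d≥0)

diff≥0 : ∀ {x y} → x ≤ᵠ y → 0ℚ ≤ᵠ y - x
diff≥0 {x} {y} x≤y = subst (_≤ᵠ y - x) (ℚₚ.+-inverseʳ x) (ℚₚ.+-monoˡ-≤ (- x) x≤y)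

0≤1 : 0ℚ ≤ᵠ 1ℚ
0≤1 = ℚₚ.nonNegative⁻¹ 1ℚ

+-nonNeg : ∀ {a b} → 0ℚ ≤ᵠ a → 0ℚ ≤ᵠ b → 0ℚ ≤ᵠ a + b
+-nonNeg = ℚₚ.+-mono-≤

*-nonNeg : ∀ {a b} → 0ℚ ≤ᵠ a → 0ℚ ≤ᵠ b → 0ℚ ≤ᵠ a * b
*-nonNeg {a} {b} a≥0 b≥0 =
  subst (_≤ᵠ a * b) (ℚₚ.*-zeroʳ a) (ℚₚ.*-monoˡ-≤-nonNeg a {{ℚ.nonNegative a≥0}} b≥0)

*-monoˡ : ∀ {a b} c → 0ℚ ≤ᵠ c → a ≤ᵠ b → c * a ≤ᵠ c * b
*-monoˡ c c≥0 = ℚₚ.*-monoˡ-≤-nonNeg c {{ℚ.nonNegative c≥0}}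

*-monoʳ : ∀ {a b} c → 0ℚ ≤ᵠ c → a ≤ᵠ b → a * c ≤ᵠ b * c
*-monoʳ c c≥0 = ℚₚ.*-monoʳ-≤-nonNeg c {{ℚ.nonNegative c≥0}}

*-cancelˡ : ∀ {a b} c → 0ℚ <ᵠ c → c * a ≤ᵠ c * b → a ≤ᵠ b
*-cancelˡ c c>0 = ℚₚ.*-cancelˡ-≤-pos c {{ℚ.positive c>0}}

square-nonNeg : ∀ a → 0ℚ ≤ᵠ a * a
square-nonNeg a with ℚₚ.≤-total 0ℚ a
... | inj₁ a≥0 = *-nonNeg a≥0 a≥0
... | inj₂ a≤0 = subst (0ℚ ≤ᵠ_) (solve 1 (λ a → (:- a) :* (:- a) := a :* a) refl a)
    (*-nonNeg (ℚₚ.neg-antimono-≤ a≤0) (ℚₚ.neg-antimono-≤ a≤0))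

infixr 8 _^_
_^_ : ℚ → ℕ → ℚ
a ^ zero  = 1ℚ
a ^ suc n = a * a ^ n

^-nonNeg : ∀ {a} → 0ℚ ≤ᵠ a → ∀ n → 0ℚ ≤ᵠ a ^ n
^-nonNeg a≥0 zero    = 0≤1
^-nonNeg a≥0 (suc n) = *-nonNeg a≥0 (^-nonNeg a≥0 n)

^-monoˡ : ∀ {a b} → 0ℚ ≤ᵠ a → a ≤ᵠ b → ∀ n → a ^ n ≤ᵠ b ^ n
^-monoˡ a≥0 a≤b zero    = ℚₚ.≤-refl
^-monoˡ a≥0 a≤b (suc n) =
  *-mono-≤-nonNeg (ℚₚ.≤-trans a≥0 a≤b) (^-nonNeg a≥0 n) a≤b (^-monoˡ a≥0 a≤b n)

^-monoʳ : ∀ {a} → 1ℚ ≤ᵠ a → ∀ {m n} → m ≤ n → a ^ m ≤ᵠ a ^ n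
^-monoʳ a≥1 {n = zero}  ℕ.z≤n = ℚₚ.≤-refl
^-monoʳ {a} a≥1 {n = suc n} ℕ.z≤n = ℚₚ.≤-trans (^-monoʳ a≥1 {n = n} ℕ.z≤n)
  (subst (_≤ᵠ a * a ^ n) (ℚₚ.*-identityˡ (a ^ n))
    (*-monoʳ (a ^ n) (^-nonNeg (ℚₚ.≤-trans 0≤1 a≥1) n) a≥1))
^-monoʳ {a} a≥1 (ℕ.s≤s m≤n) = *-monoˡ a (ℚₚ.≤-trans 0≤1 a≥1) (^-monoʳ a≥1 m≤n)

^-antitoneʳ : ∀ {a} → 0ℚ ≤ᵠ a → a ≤ᵠ 1ℚ → ∀ {m n} → m ≤ n → a ^ n ≤ᵠ a ^ m
^-antitoneʳ a≥0 a≤1 {n = zero}  ℕ.z≤n = ℚₚ.≤-refl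
^-antitoneʳ {a} a≥0 a≤1 {n = suc n} ℕ.z≤n = ℚₚ.≤-trans
  (subst (a * a ^ n ≤ᵠ_) (ℚₚ.*-identityˡ (a ^ n)) (*-monoʳ (a ^ n) (^-nonNeg a≥0 n) a≤1))
  (^-antitoneʳ a≥0 a≤1 {n = n} ℕ.z≤n)
^-antitoneʳ {a} a≥0 a≤1 (ℕ.s≤s m≤n) = *-monoˡ a a≥0 (^-antitoneʳ a≥0 a≤1 m≤n)

^-distrib-* : ∀ a b n → (a * b) ^ n ≡ a ^ n * b ^ n
^-distrib-* a b zero    = refl
^-distrib-* a b (suc n) = trans (cong ((a * b) *_) (^-distrib-* a b n))
  (solve 4 (λ a b c d → (a :* b) :* (c :* d) := (a :* c) :* (b :* d)) refl a b (a ^ n) (b ^ n))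

-- Defined by recursion, unlike `ℤ.+ n ℚ./ 1`, so that `ι (suc n)` unfolds to `1ℚ + ι n` inside the
-- ring solver; `ι≡/1` links the two.
ι : ℕ → ℚ
ι zero    = 0ℚ
ι (suc n) = 1ℚ + ι n

ι-+ : ∀ m n → ι (m ℕ.+ n) ≡ ι m + ι n
ι-+ zero    n = sym (ℚₚ.+-identityˡ (ι n))
ι-+ (suc m) n = trans (cong (1ℚ +_) (ι-+ m n)) (sym (ℚₚ.+-assoc 1ℚ (ι m) (ι n)))

ι≡/1 : ∀ n → ι n ≡ ℤ.+ n ℚ./ 1
ι≡/1 zero    = refl
ι≡/1 (suc n) = trans (cong (1ℚ +_) (ι≡/1 n)) (ℚₚ.toℚᵘ-injective (begin
  ℚ.toℚᵘ (1ℚ + ℤ.+ n ℚ./ 1)                 ≈⟨ ℚₚ.toℚᵘ-homo-+ 1ℚ (ℤ.+ n ℚ./ 1) ⟩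
  ℚ.toℚᵘ 1ℚ ℚᵘ.+ ℚ.toℚᵘ (ℤ.+ n ℚ./ 1)       ≈⟨ ℚᵘₚ.+-congʳ (ℚ.toℚᵘ 1ℚ) (ℚₚ.toℚᵘ-fromℚᵘ (mkℚᵘ (ℤ.+ n) 0)) ⟩
  ℚ.toℚᵘ 1ℚ ℚᵘ.+ mkℚᵘ (ℤ.+ n) 0             ≈⟨ *≡* (cong (λ x → (ℤ.+ 1 ℤ.+ x) ℤ.* ℤ.+ 1) (ℤₚ.*-identityʳ (ℤ.+ n))) ⟩
  mkℚᵘ (ℤ.+ suc n) 0                        ≈⟨ ℚₚ.toℚᵘ-fromℚᵘ (mkℚᵘ (ℤ.+ suc n) 0) ⟨
  ℚ.toℚᵘ (ℤ.+ suc n ℚ./ 1)                  ∎))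
  where open ℚᵘₚ.≃-Reasoning

ι-* : ∀ m n → ι (m ℕ.* n) ≡ ι m * ι n
ι-* zero    n = sym (ℚₚ.*-zeroˡ (ι n))
ι-* (suc m) n = trans (ι-+ n (m ℕ.* n)) (trans (cong (ι n +_) (ι-* m n))
  (solve 2 (λ x y → y :+ x :* y := (con 1ℚ :+ x) :* y) refl (ι m) (ι n)))

ι-^ : ∀ m n → ι (m ℕ.^ n) ≡ ι m ^ n
ι-^ m zero    = refl
ι-^ m (suc n) = trans (ι-* m (m ℕ.^ n)) (cong (ι m *_) (ι-^ m n))

ι-nonNeg : ∀ n → 0ℚ ≤ᵠ ι n
ι-nonNeg zero    = ℚₚ.≤-refl
ι-nonNeg (suc n) = +-nonNeg 0≤1 (ι-nonNeg n)

ι-pos : ∀ {n} → 0 ℕ.< n → 0ℚ <ᵠ ι n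
ι-pos {suc n} _ = ℚₚ.+-mono-<-≤ (ℚₚ.positive⁻¹ 1ℚ) (ι-nonNeg n)

ι-mono : ∀ {m n} → m ≤ n → ι m ≤ᵠ ι n
ι-mono {m} {n} m≤n = ≤-by (ι (n ℕ.∸ m)) (ι-nonNeg (n ℕ.∸ m))
  (trans (sym (ι-+ m (n ℕ.∸ m))) (cong ι (ℕₚ.m+[n∸m]≡n m≤n)))

𝟙 : ∀ {P : Set} → Dec P → ℚ
𝟙 P? = if does P? then 1ℚ else 0ℚ

𝟙-yes : ∀ {P : Set} (P? : Dec P) → P → 𝟙 P? ≡ 1ℚ
𝟙-yes (yes _) _ = refl
𝟙-yes (no ¬p) p = ⊥-elim (¬p p)

𝟙-no : ∀ {P : Set} (P? : Dec P) → ¬ P → 𝟙 P? ≡ 0ℚ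
𝟙-no (yes p) ¬p = ⊥-elim (¬p p)
𝟙-no (no _) _   = refl

𝟙-nonNeg : ∀ {P : Set} (P? : Dec P) → 0ℚ ≤ᵠ 𝟙 P?
𝟙-nonNeg (yes _) = 0≤1
𝟙-nonNeg (no _)  = ℚₚ.≤-refl

𝟙≤1 : ∀ {P : Set} (P? : Dec P) → 𝟙 P? ≤ᵠ 1ℚ
𝟙≤1 (yes _) = ℚₚ.≤-refl
𝟙≤1 (no _)  = 0≤1

𝟙-mono : ∀ {P Q : Set} (P? : Dec P) (Q? : Dec Q) → (P → Q) → 𝟙 P? ≤ᵠ 𝟙 Q?
𝟙-mono (yes p) Q? P→Q = ℚₚ.≤-reflexive (sym (𝟙-yes Q? (P→Q p)))
𝟙-mono (no _)  Q? P→Q = 𝟙-nonNeg Q?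

𝟙-cong : ∀ {P Q : Set} (P? : Dec P) (Q? : Dec Q) → (P → Q) → (Q → P) → 𝟙 P? ≡ 𝟙 Q?
𝟙-cong P? Q? f g = ℚₚ.≤-antisym (𝟙-mono P? Q? f) (𝟙-mono Q? P? g)

-- Finite sums

∑ : List A → (A → ℚ) → ℚ
∑ []       f = 0ℚ
∑ (x ∷ xs) f = f x + ∑ xs f

∑-cong : ∀ (xs : List A) {f g : A → ℚ} → (∀ x → f x ≡ g x) → ∑ xs f ≡ ∑ xs g
∑-cong []       eq = refl
∑-cong (x ∷ xs) eq = cong₂ _+_ (eq x) (∑-cong xs eq)

∑-mono-All : ∀ {P : A → Set} {xs : List A} {f g : A → ℚ} → All P xs →
             (∀ x → P x → f x ≤ᵠ g x) → ∑ xs f ≤ᵠ ∑ xs g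
∑-mono-All []         le = ℚₚ.≤-refl
∑-mono-All (px ∷ pxs) le = ℚₚ.+-mono-≤ (le _ px) (∑-mono-All pxs le)

∑-mono : ∀ (xs : List A) {f g : A → ℚ} → (∀ x → f x ≤ᵠ g x) → ∑ xs f ≤ᵠ ∑ xs g
∑-mono []       le = ℚₚ.≤-refl
∑-mono (x ∷ xs) le = ℚₚ.+-mono-≤ (le x) (∑-mono xs le)

∑-nonNeg : ∀ (xs : List A) {f : A → ℚ} → (∀ x → 0ℚ ≤ᵠ f x) → 0ℚ ≤ᵠ ∑ xs f
∑-nonNeg []       nn = ℚₚ.≤-refl
∑-nonNeg (x ∷ xs) nn = +-nonNeg (nn x) (∑-nonNeg xs nn)

∑-+ : ∀ (xs : List A) (f g : A → ℚ) → ∑ xs (λ x → f x + g x) ≡ ∑ xs f + ∑ xs g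
∑-+ []       f g = refl
∑-+ (x ∷ xs) f g = trans (cong (f x + g x +_) (∑-+ xs f g))
  (solve 4 (λ a b c d → (a :+ b) :+ (c :+ d) := (a :+ c) :+ (b :+ d)) refl (f x) (g x) (∑ xs f) (∑ xs g))

∑-*ˡ : ∀ (xs : List A) c (f : A → ℚ) → ∑ xs (λ x → c * f x) ≡ c * ∑ xs f
∑-*ˡ []       c f = sym (ℚₚ.*-zeroʳ c)
∑-*ˡ (x ∷ xs) c f = trans (cong (c * f x +_) (∑-*ˡ xs c f)) (sym (ℚₚ.*-distribˡ-+ c (f x) (∑ xs f)))

∑-*ʳ : ∀ (xs : List A) c (f : A → ℚ) → ∑ xs (λ x → f x * c) ≡ ∑ xs f * c
∑-*ʳ xs c f = trans (∑-cong xs (λ x → ℚₚ.*-comm (f x) c)) (trans (∑-*ˡ xs c f) (ℚₚ.*-comm c (∑ xs f)))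

∑-const : ∀ (xs : List A) c → ∑ xs (λ _ → c) ≡ ι (length xs) * c
∑-const []       c = sym (ℚₚ.*-zeroˡ c)
∑-const (x ∷ xs) c = trans (cong (c +_) (∑-const xs c))
  (solve 2 (λ l c → c :+ l :* c := (con 1ℚ :+ l) :* c) refl (ι (length xs)) c)

∑-swap : ∀ (xs : List A) (ys : List B) (f : A → B → ℚ) →
         ∑ xs (λ x → ∑ ys (f x)) ≡ ∑ ys (λ y → ∑ xs (λ x → f x y))
∑-swap []       ys f = sym (trans (∑-const ys 0ℚ) (ℚₚ.*-zeroʳ (ι (length ys))))
∑-swap (x ∷ xs) ys f = trans (cong (∑ ys (f x) +_) (∑-swap xs ys f))
  (sym (∑-+ ys (f x) (λ y → ∑ xs (λ x → f x y))))

∑-map : ∀ (g : A → B) (xs : List A) (f : B → ℚ) → ∑ (List.map g xs) f ≡ ∑ xs (λ x → f (g x))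
∑-map g []       f = refl
∑-map g (x ∷ xs) f = cong (f (g x) +_) (∑-map g xs f)

∑-++ : ∀ (xs ys : List A) (f : A → ℚ) → ∑ (xs ++ ys) f ≡ ∑ xs f + ∑ ys f
∑-++ []       ys f = sym (ℚₚ.+-identityˡ (∑ ys f))
∑-++ (x ∷ xs) ys f = trans (cong (f x +_) (∑-++ xs ys f)) (sym (ℚₚ.+-assoc (f x) (∑ xs f) (∑ ys f)))

∑-concatMap : ∀ (g : A → List B) (xs : List A) (f : B → ℚ) →
              ∑ (concatMap g xs) f ≡ ∑ xs (λ x → ∑ (g x) f)
∑-concatMap g []       f = refl
∑-concatMap g (x ∷ xs) f =
  trans (∑-++ (g x) (concatMap g xs) f) (cong (∑ (g x) f +_) (∑-concatMap g xs f))

∑-filter : ∀ {P : A → Set} (P? : Decidable P) (xs : List A) (f : A → ℚ) →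
           ∑ (filter P? xs) f ≡ ∑ xs (λ x → 𝟙 (P? x) * f x)
∑-filter P? []       f = refl
∑-filter P? (x ∷ xs) f with P? x
... | yes _ = cong₂ _+_ (sym (ℚₚ.*-identityˡ (f x))) (∑-filter P? xs f)
... | no  _ = trans (∑-filter P? xs f)
  (sym (trans (cong (_+ ∑ xs (λ x → 𝟙 (P? x) * f x)) (ℚₚ.*-zeroˡ (f x))) (ℚₚ.+-identityˡ _)))

∑-length : ∀ (xs : List A) → ∑ xs (λ _ → 1ℚ) ≡ ι (length xs)
∑-length xs = trans (∑-const xs 1ℚ) (ℚₚ.*-identityʳ _)

∑-product : ∀ (xs : List A) (ys : List B) (f : A → ℚ) (g : B → ℚ) →
            ∑ xs f * ∑ ys g ≡ ∑ xs (λ x → ∑ ys (λ y → f x * g y))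
∑-product xs ys f g = trans (sym (∑-*ʳ xs (∑ ys g) f)) (∑-cong xs (λ x → sym (∑-*ˡ ys (f x) g)))

-- Product Bernoulli measures

𝔼 : ℚ → (Subset m → ℚ) → ℚ
𝔼 {zero}  ρ f = f []
𝔼 {suc m} ρ f = (1ℚ - ρ) * 𝔼 ρ (λ Z → f (outside ∷ Z)) + ρ * 𝔼 ρ (λ Z → f (inside ∷ Z))

𝔼-cong : ∀ ρ {f g : Subset m → ℚ} → (∀ Z → f Z ≡ g Z) → 𝔼 ρ f ≡ 𝔼 ρ g
𝔼-cong {zero}  ρ eq = eq []
𝔼-cong {suc m} ρ eq = cong₂ (λ x y → (1ℚ - ρ) * x + ρ * y)
  (𝔼-cong ρ (λ Z → eq (outside ∷ Z))) (𝔼-cong ρ (λ Z → eq (inside ∷ Z)))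

𝔼-mono : ∀ {ρ} → 0ℚ ≤ᵠ ρ → ρ ≤ᵠ 1ℚ → {f g : Subset m → ℚ} → (∀ Z → f Z ≤ᵠ g Z) → 𝔼 ρ f ≤ᵠ 𝔼 ρ g
𝔼-mono {zero}  ρ≥0 ρ≤1 le = le []
𝔼-mono {suc m} {ρ} ρ≥0 ρ≤1 le = ℚₚ.+-mono-≤
  (*-monoˡ (1ℚ - ρ) (diff≥0 ρ≤1) (𝔼-mono ρ≥0 ρ≤1 (λ Z → le (outside ∷ Z))))
  (*-monoˡ ρ ρ≥0 (𝔼-mono ρ≥0 ρ≤1 (λ Z → le (inside ∷ Z))))

𝔼-+ : ∀ ρ (f g : Subset m → ℚ) → 𝔼 ρ (λ Z → f Z + g Z) ≡ 𝔼 ρ f + 𝔼 ρ g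
𝔼-+ {zero}  ρ f g = refl
𝔼-+ {suc m} ρ f g = trans
  (cong₂ (λ x y → (1ℚ - ρ) * x + ρ * y)
    (𝔼-+ ρ (λ Z → f (outside ∷ Z)) (λ Z → g (outside ∷ Z)))
    (𝔼-+ ρ (λ Z → f (inside ∷ Z)) (λ Z → g (inside ∷ Z))))
  (solve 5 (λ r a b c d → (con 1ℚ :- r) :* (a :+ b) :+ r :* (c :+ d)
      := ((con 1ℚ :- r) :* a :+ r :* c) :+ ((con 1ℚ :- r) :* b :+ r :* d)) refl
    ρ _ _ _ _)

𝔼-* : ∀ ρ c (f : Subset m → ℚ) → 𝔼 ρ (λ Z → c * f Z) ≡ c * 𝔼 ρ f
𝔼-* {zero}  ρ c f = refl
𝔼-* {suc m} ρ c f = trans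
  (cong₂ (λ x y → (1ℚ - ρ) * x + ρ * y)
    (𝔼-* ρ c (λ Z → f (outside ∷ Z))) (𝔼-* ρ c (λ Z → f (inside ∷ Z))))
  (solve 4 (λ r c a b → (con 1ℚ :- r) :* (c :* a) :+ r :* (c :* b)
      := c :* ((con 1ℚ :- r) :* a :+ r :* b)) refl ρ c _ _)

convex-same : ∀ ρ x → (1ℚ - ρ) * x + ρ * x ≡ x
convex-same = solve 2 (λ r x → (con 1ℚ :- r) :* x :+ r :* x := x) refl

𝔼-const : ∀ {m} ρ c → 𝔼 {m} ρ (λ _ → c) ≡ c
𝔼-const {zero}  ρ c = refl
𝔼-const {suc m} ρ c = trans (cong₂ (λ x y → (1ℚ - ρ) * x + ρ * y) (𝔼-const {m} ρ c) (𝔼-const {m} ρ c))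
  (convex-same ρ c)

𝔼-∑ : ∀ {A : Set} ρ (xs : List A) (f : A → Subset m → ℚ) →
      𝔼 ρ (λ Z → ∑ xs (λ x → f x Z)) ≡ ∑ xs (λ x → 𝔼 ρ (f x))
𝔼-∑ {m = m} ρ []       f = 𝔼-const {m} ρ 0ℚ
𝔼-∑ ρ (x ∷ xs) f = trans (𝔼-+ ρ (f x) _) (cong (𝔼 ρ (f x) +_) (𝔼-∑ ρ xs f))

Antitone : (Subset m → ℚ) → Set
Antitone f = ∀ {A B} → A ⊆ B → f B ≤ᵠ f A

-- The union of independent sets of densities ρ and σ has density ρ + σ - ρσ, slightly below ρ + σ,
-- and an antitone function prefers the sparser set. In each coordinate the discrepancy is
-- `ρ * σ * (X₀ - X₁)`.
𝔼-union : ∀ {ρ σ} → 0ℚ ≤ᵠ ρ → 0ℚ ≤ᵠ σ → ρ + σ ≤ᵠ 1ℚ → {f : Subset m → ℚ} → Antitone f →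
          𝔼 (ρ + σ) f ≤ᵠ 𝔼 ρ (λ V → 𝔼 σ (λ W → f (V ∪ W)))
𝔼-union {zero}  ρ≥0 σ≥0 le anti = ℚₚ.≤-refl
𝔼-union {suc m} {ρ} {σ} ρ≥0 σ≥0 le {f} anti = ℚₚ.≤-trans
  (ℚₚ.+-mono-≤
    (*-monoˡ (1ℚ - (ρ + σ)) (diff≥0 le) (𝔼-union ρ≥0 σ≥0 le (λ s → anti (s⊆s s))))
    (*-monoˡ (ρ + σ) (+-nonNeg ρ≥0 σ≥0) (𝔼-union ρ≥0 σ≥0 le (λ s → anti (s⊆s s)))))
  (≤-by (ρ * σ * (X₀ - X₁)) (*-nonNeg (*-nonNeg ρ≥0 σ≥0) (diff≥0 X₁≤X₀))
    (trans
      (solve 4 (λ r s a b → ((con 1ℚ :- (r :+ s)) :* a :+ (r :+ s) :* b) :+ r :* s :* (a :- b)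
          := (con 1ℚ :- r) :* ((con 1ℚ :- s) :* a :+ s :* b) :+ r :* b) refl ρ σ X₀ X₁)
      (sym (cong₂ (λ x y → (1ℚ - ρ) * x + ρ * y)
        (trans (𝔼-+ {m} ρ _ _) (cong₂ _+_ (𝔼-* {m} ρ (1ℚ - σ) _) (𝔼-* {m} ρ σ _)))
        (𝔼-cong {m} ρ (λ V → convex-same σ _))))))
  where
  ρ≤1 = ℚₚ.≤-trans (≤-by σ σ≥0 refl) le
  σ≤1 = ℚₚ.≤-trans (≤-by ρ ρ≥0 (ℚₚ.+-comm σ ρ)) le
  X₀ = 𝔼 ρ (λ V → 𝔼 σ (λ W → f (outside ∷ (V ∪ W))))
  X₁ = 𝔼 ρ (λ V → 𝔼 σ (λ W → f (inside ∷ (V ∪ W))))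
  X₁≤X₀ : X₁ ≤ᵠ X₀
  X₁≤X₀ = 𝔼-mono {m} ρ≥0 ρ≤1 (λ V → 𝔼-mono {m} σ≥0 σ≤1 (λ W → anti {outside ∷ (V ∪ W)} (out⊆ (λ x → x))))

𝔼-antitone-density : ∀ {ρ σ} → 0ℚ ≤ᵠ ρ → ρ ≤ᵠ σ → σ ≤ᵠ 1ℚ → {f : Subset m → ℚ} → Antitone f →
                     𝔼 σ f ≤ᵠ 𝔼 ρ f
𝔼-antitone-density {m} {ρ} {σ} ρ≥0 ρ≤σ σ≤1 {f} anti =
  subst (λ τ → 𝔼 τ f ≤ᵠ 𝔼 ρ f) eq (ℚₚ.≤-trans
    (𝔼-union ρ≥0 (diff≥0 ρ≤σ) (subst (_≤ᵠ 1ℚ) (sym eq) σ≤1) anti)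
    (𝔼-mono ρ≥0 (ℚₚ.≤-trans ρ≤σ σ≤1) (λ V → ℚₚ.≤-trans
      (𝔼-mono (diff≥0 ρ≤σ) (≤-by (1ℚ - σ + ρ) (+-nonNeg (diff≥0 σ≤1) ρ≥0)
          (solve 2 (λ s r → (s :- r) :+ ((con 1ℚ :- s) :+ r) := con 1ℚ) refl σ ρ))
        (λ W → anti {V} {V ∪ W} (λ x → x∈p∪q⁺ (inj₁ x))))
      (ℚₚ.≤-reflexive (𝔼-const {m} (σ - ρ) (f V))))))
  where
  eq : ρ + (σ - ρ) ≡ σ
  eq = solve 2 (λ r s → r :+ (s :- r) := s) refl ρ σ

-- a ^ ∣ A ∣ times the indicator of A ⊆ Z. With a = 1 / ρ this is the density
-- of A ∪ W with respect to W, for W of density ρ.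
planted : ℚ → Subset m → Subset m → ℚ
planted a []            []            = 1ℚ
planted a (outside ∷ A) (_ ∷ Z)       = planted a A Z
planted a (inside ∷ A)  (outside ∷ Z) = 0ℚ
planted a (inside ∷ A)  (inside ∷ Z)  = a * planted a A Z

planted-nonNeg : ∀ {a} → 0ℚ ≤ᵠ a → (A Z : Subset m) → 0ℚ ≤ᵠ planted a A Z
planted-nonNeg a≥0 []            []            = 0≤1
planted-nonNeg a≥0 (outside ∷ A) (_ ∷ Z)       = planted-nonNeg a≥0 A Z
planted-nonNeg a≥0 (inside ∷ A)  (outside ∷ Z) = ℚₚ.≤-refl
planted-nonNeg a≥0 (inside ∷ A)  (inside ∷ Z)  = *-nonNeg a≥0 (planted-nonNeg a≥0 A Z)

planted-⊈ : ∀ a (A Z : Subset m) → ¬ A ⊆ Z → planted a A Z ≡ 0ℚ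
planted-⊈ a []            []            ¬A⊆Z = ⊥-elim (¬A⊆Z (λ x → x))
planted-⊈ a (outside ∷ A) (_ ∷ Z)       ¬A⊆Z = planted-⊈ a A Z (λ s → ¬A⊆Z (out⊆ s))
planted-⊈ a (inside ∷ A)  (outside ∷ Z) ¬A⊆Z = refl
planted-⊈ a (inside ∷ A)  (inside ∷ Z)  ¬A⊆Z =
  trans (cong (a *_) (planted-⊈ a A Z (λ s → ¬A⊆Z (s⊆s s)))) (ℚₚ.*-zeroʳ a)

convex-inside : ∀ {m ρ a} → ρ * a ≡ 1ℚ → {f g : Subset m → ℚ} →
                (1ℚ - ρ) * 𝔼 ρ (λ Z → 0ℚ * f Z) + ρ * 𝔼 ρ (λ Z → a * g Z) ≡ 𝔼 ρ g
convex-inside {m} {ρ} {a} ρa≡1 {f} {g} = trans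
  (cong₂ (λ x y → (1ℚ - ρ) * x + ρ * y) (trans (𝔼-* ρ 0ℚ f) (ℚₚ.*-zeroˡ (𝔼 ρ f))) (𝔼-* ρ a g))
  (trans (solve 3 (λ r a x → (con 1ℚ :- r) :* con 0ℚ :+ r :* (a :* x) := (r :* a) :* x) refl ρ a (𝔼 ρ g))
    (trans (cong (_* 𝔼 ρ g) ρa≡1) (ℚₚ.*-identityˡ _)))

𝔼-planted : ∀ {ρ a} → ρ * a ≡ 1ℚ → (A : Subset m) (f : Subset m → ℚ) →
            𝔼 ρ (λ W → f (A ∪ W)) ≡ 𝔼 ρ (λ Z → planted a A Z * f Z)
𝔼-planted ρa≡1 [] f = sym (ℚₚ.*-identityˡ (f []))
𝔼-planted {ρ = ρ} ρa≡1 (outside ∷ A) f = cong₂ (λ x y → (1ℚ - ρ) * x + ρ * y)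
  (𝔼-planted ρa≡1 A _) (𝔼-planted ρa≡1 A _)
𝔼-planted {suc m} {ρ} {a} ρa≡1 (inside ∷ A) f = trans (convex-same ρ _) (trans (𝔼-planted {m} ρa≡1 A (λ Z → f (inside ∷ Z)))
  (sym (trans
    (cong₂ (λ x y → (1ℚ - ρ) * x + ρ * y) refl (𝔼-cong ρ (λ Z → ℚₚ.*-assoc a (planted a A Z) (f (inside ∷ Z)))))
    (convex-inside {m} {ρ} {a} ρa≡1 {f = λ Z → f (outside ∷ Z)}))))

𝔼-planted-1 : ∀ {ρ a} → ρ * a ≡ 1ℚ → (A : Subset m) → 𝔼 ρ (planted a A) ≡ 1ℚ
𝔼-planted-1 {m} {ρ} {a} ρa≡1 A = trans (𝔼-cong ρ (λ Z → sym (ℚₚ.*-identityʳ (planted a A Z))))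
  (trans (sym (𝔼-planted ρa≡1 A (λ _ → 1ℚ))) (𝔼-const {m} ρ 1ℚ))

-- The expectation factors over coordinates. A coordinate in exactly one of the two sets gives
-- `ρ * a = 1`, and one in both gives `ρ * a * a = a`.
𝔼-planted² : ∀ {ρ a} → ρ * a ≡ 1ℚ → (A B : Subset m) →
             𝔼 ρ (λ Z → planted a A Z * planted a B Z) ≡ a ^ ∣ A ∩ B ∣
𝔼-planted² ρa≡1 [] [] = refl
𝔼-planted² {ρ = ρ} ρa≡1 (outside ∷ A) (outside ∷ B) =
  trans (convex-same ρ _) (𝔼-planted² ρa≡1 A B)
𝔼-planted² {suc m} {ρ} {a} ρa≡1 (outside ∷ A) (inside ∷ B) = trans
  (cong₂ (λ x y → (1ℚ - ρ) * x + ρ * y)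
    (𝔼-cong ρ (λ Z → ℚₚ.*-comm (planted a A Z) 0ℚ))
    (𝔼-cong ρ (λ Z → solve 3 (λ a x y → x :* (a :* y) := a :* (x :* y)) refl a (planted a A Z) (planted a B Z))))
  (trans (convex-inside {m} {ρ} {a} ρa≡1 {f = planted a A}) (𝔼-planted² {m} ρa≡1 A B))
𝔼-planted² {suc m} {ρ} {a} ρa≡1 (inside ∷ A) (outside ∷ B) = trans
  (cong₂ (λ x y → (1ℚ - ρ) * x + ρ * y) refl
    (𝔼-cong ρ (λ Z → ℚₚ.*-assoc a (planted a A Z) (planted a B Z))))
  (trans (convex-inside {m} {ρ} {a} ρa≡1 {f = planted a B}) (𝔼-planted² {m} ρa≡1 A B))
𝔼-planted² {suc m} {ρ} {a} ρa≡1 (inside ∷ A) (inside ∷ B) = trans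
  (cong₂ (λ x y → (1ℚ - ρ) * x + ρ * y) refl
    (𝔼-cong ρ (λ Z → solve 3 (λ a x y → (a :* x) :* (a :* y) := a :* (a :* (x :* y))) refl
      a (planted a A Z) (planted a B Z))))
  (trans (convex-inside {m} {ρ} {a} ρa≡1 {f = λ _ → 0ℚ}) (trans (𝔼-* {m} ρ a _) (cong (a *_) (𝔼-planted² ρa≡1 A B))))

-- Fragments

infix 4 _≼_
-- Entries may be deleted or shrunk, but each survivor keeps its own place. This respects
-- multiplicities: distinct fragments are charged to distinct entries of the larger list, as `∑-≼`
-- requires.
data _≼_ {m : ℕ} : List (Subset m) → List (Subset m) → Set where
  []   : [] ≼ []
  drop : ∀ {y xs ys} → xs ≼ ys → xs ≼ y ∷ ys
  keep : ∀ {x y xs ys} → x ⊆ y → xs ≼ ys → x ∷ xs ≼ y ∷ ys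

≼-refl : (xs : List (Subset m)) → xs ≼ xs
≼-refl []       = []
≼-refl (x ∷ xs) = keep ⊆-refl (≼-refl xs)

≼-trans : xs ≼ ys → ys ≼ zs → xs ≼ zs
≼-trans p          (drop q)   = drop (≼-trans p q)
≼-trans []         []         = []
≼-trans (drop p)   (keep _ q) = drop (≼-trans p q)
≼-trans (keep r p) (keep s q) = keep (⊆-trans r s) (≼-trans p q)

∑-≼ : {f : Subset m → ℚ} → (∀ A → 0ℚ ≤ᵠ f A) → (∀ {A B} → A ⊆ B → f A ≤ᵠ f B) →
      xs ≼ ys → ∑ xs f ≤ᵠ ∑ ys f
∑-≼ nn mono []         = ℚₚ.≤-refl
∑-≼ {f = f} nn mono (drop {y} {ys = ys} p) = ℚₚ.≤-trans (∑-≼ nn mono p) (≤-by (f y) (nn y) (ℚₚ.+-comm (∑ ys f) (f y)))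
∑-≼ nn mono (keep s p) = ℚₚ.+-mono-≤ (mono s) (∑-≼ nn mono p)

≼-All : xs ≼ ys → All (λ A → Any (A ⊆_) ys) xs
≼-All []         = []
≼-All (drop p)   = All.map Any.there (≼-All p)
≼-All (keep s p) = Any.here s ∷ All.map Any.there (≼-All p)

≼-length : xs ≼ ys → ι (length xs) ≤ᵠ ι (length ys)
≼-length {xs = xs} {ys = ys} p = subst₂ _≤ᵠ_ (∑-length xs) (∑-length ys)
  (∑-≼ (λ _ → 0≤1) (λ _ → ℚₚ.≤-refl) p)

avoids? : (xs : List (Subset m)) (W : Subset m) → Dec (¬ Any (_⊆ W) xs)
avoids? xs W = ¬? (any? (_⊆? W) xs)

avoids-antitone : (xs : List (Subset m)) → Antitone (λ W → 𝟙 (avoids? xs W))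
avoids-antitone xs {A} {B} A⊆B = 𝟙-mono (avoids? xs B) (avoids? xs A)
  (λ none any → none (Any.map {P = _⊆ A} {Q = _⊆ B} (λ s x∈ → A⊆B (s x∈)) any))

Blocked : List (Subset m) → ℕ → Subset m → Subset m → Set
Blocked xs t A Z = All (λ B → B ⊆ Z → t ≤ ∣ A ∩ B ∣) xs

blocked? : (xs : List (Subset m)) (t : ℕ) (A Z : Subset m) → Dec (Blocked xs t A Z)
blocked? xs t A Z = All.all? (λ B → (B ⊆? Z) →-dec (t ℕ.≤? ∣ A ∩ B ∣)) xs

p⊆[p∩∁q]∪q : (p q : Subset m) → p ⊆ (p ∩ ∁ q) ∪ q
p⊆[p∩∁q]∪q p q {x} x∈p with x ∈? q
... | yes x∈q = x∈p∪q⁺ (inj₂ x∈q)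
... | no  x∉q = x∈p∪q⁺ (inj₁ (x∈p∩q⁺ (x∈p , x∉p⇒x∈∁p x∉q)))

-- An unblocked A is replaced by B ∖ V ⊆ A ∩ B, where B ⊆ A ∪ V meets A in fewer than t elements.
shrink : ∀ (cur : List (Subset m)) t (V : Subset m) (xs : List (Subset m)) → ∃ λ ys → ys ≼ xs ×
         All (λ Y → ∣ Y ∣ ≤ t × Any (λ B → B ⊆ Y ∪ V) cur) ys ×
         ι (length ys) + ∑ xs (λ A → 𝟙 (blocked? cur t A (A ∪ V))) ≡ ι (length xs)
shrink cur t V [] = [] , [] , [] , refl
shrink cur t V (A ∷ xs) with shrink cur t V xs | blocked? cur t A (A ∪ V)
... | ys , p , good , count | yes _ = ys , drop p , good ,
  trans (solve 2 (λ y s → y :+ (con 1ℚ :+ s) := con 1ℚ :+ (y :+ s)) refl (ι (length ys)) _)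
    (cong (1ℚ +_) count)
... | ys , p , good , count | no ¬blocked =
  let B , B∈cur , ¬imp = find (Allₚ.¬All⇒Any¬ (λ B → (B ⊆? (A ∪ V)) →-dec (t ℕ.≤? ∣ A ∩ B ∣)) cur ¬blocked)
      B⊆A∪V : B ⊆ A ∪ V
      B⊆A∪V = decidable-stable (B ⊆? (A ∪ V)) (λ ¬s → ¬imp (λ s → ⊥-elim (¬s s)))
      Y = B ∩ ∁ V
      Y⊆A : Y ⊆ A
      Y⊆A x∈Y = let x∈B , x∈∁V = x∈p∩q⁻ B (∁ V) x∈Y in
        Sum.[ (λ x∈A → x∈A) , (λ x∈V → ⊥-elim (x∈∁p⇒x∉p x∈∁V x∈V)) ]′ (x∈p∪q⁻ A V (B⊆A∪V x∈B))
      Y⊆A∩B : Y ⊆ A ∩ B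
      Y⊆A∩B x∈Y = x∈p∩q⁺ (Y⊆A x∈Y , proj₁ (x∈p∩q⁻ B (∁ V) x∈Y))
      Y≤t = ℕₚ.≤-trans (p⊆q⇒∣p∣≤∣q∣ Y⊆A∩B) (ℕₚ.<⇒≤ (ℕₚ.≰⇒> (λ t≤ → ¬imp (λ _ → t≤))))
  in Y ∷ ys , keep Y⊆A p , (Y≤t , lose B∈cur (p⊆[p∩∁q]∪q B V)) ∷ good ,
     trans (cong (ι (suc (length ys)) +_) (ℚₚ.+-identityˡ _))
       (trans (ℚₚ.+-assoc 1ℚ (ι (length ys)) _) (cong (1ℚ +_) count))

-- By `𝔼-planted²` this is the expected product of the planted densities of `A` and `B`, kept only
-- when the overlap reaches `t`.
shared : ℚ → ℕ → Subset m → Subset m → ℚ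
shared a t A B = 𝟙 (t ℕ.≤? ∣ A ∩ B ∣) * a ^ ∣ A ∩ B ∣

shared-nonNeg : ∀ {a} → 0ℚ ≤ᵠ a → ∀ t (A B : Subset m) → 0ℚ ≤ᵠ shared a t A B
shared-nonNeg a≥0 t A B = *-nonNeg (𝟙-nonNeg (t ℕ.≤? _)) (^-nonNeg a≥0 ∣ A ∩ B ∣)

shared-mono : ∀ {a} → 1ℚ ≤ᵠ a → ∀ t (A : Subset m) {B C} → B ⊆ C → shared a t A B ≤ᵠ shared a t A C
shared-mono a≥1 t A {B} {C} B⊆C = *-mono-≤-nonNeg (𝟙-nonNeg (t ℕ.≤? ∣ A ∩ C ∣))
  (^-nonNeg (ℚₚ.≤-trans 0≤1 a≥1) ∣ A ∩ B ∣)
  (𝟙-mono (t ℕ.≤? ∣ A ∩ B ∣) (t ℕ.≤? ∣ A ∩ C ∣) (λ t≤ → ℕₚ.≤-trans t≤ le)) (^-monoʳ a≥1 le)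
  where
  le : ∣ A ∩ B ∣ ≤ ∣ A ∩ C ∣
  le = p⊆q⇒∣p∣≤∣q∣ (λ x∈ → let x∈A , x∈B = x∈p∩q⁻ A B x∈ in x∈p∩q⁺ (x∈A , B⊆C x∈B))

-- Exposing a random set in rounds

module Sparsify {m : ℕ} (E : List (Subset m)) where

  L : ℚ
  L = ι (length E)

  -- The only property of E used: the overlaps of a fragment A of size at most r
  -- with the edges, restricted to overlaps of size at least t and weighted by a ^ overlap.
  Overlaps : ℕ → ℚ → ℕ → ℚ → Set
  Overlaps r a t δ = ∀ {A} → Any (A ⊆_) E → ∣ A ∣ ≤ r → ∑ E (shared a t A) ≤ᵠ δ * L

  -- A way to expose density ρ in rounds, with total failure probability η.
  data Rounds : ℕ → ℚ → ℚ → Set where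
    last : ∀ {r ρ a δ} → 0ℚ ≤ᵠ ρ → 1ℚ ≤ᵠ a → ρ * a ≡ 1ℚ → 0ℚ ≤ᵠ δ → Overlaps r a 1 δ → Rounds r ρ δ
    step : ∀ {r t ρ σ a δ ε η} → 0ℚ ≤ᵠ ρ → 1ℚ ≤ᵠ a → ρ * a ≡ 1ℚ → 0ℚ ≤ᵠ σ →
           0ℚ ≤ᵠ δ → 0ℚ <ᵠ ε → δ ≤ᵠ ε * ε → Overlaps r a t δ →
           Rounds t σ η → Rounds r (ρ + σ) (ε + η)

  module _ (L>0 : 0ℚ <ᵠ L) where

    L≥0 : 0ℚ ≤ᵠ L
    L≥0 = ℚₚ.<⇒≤ L>0

    module _ {r t : ℕ} {a δ : ℚ} (a≥1 : 1ℚ ≤ᵠ a) (δ≥0 : 0ℚ ≤ᵠ δ) (ov : Overlaps r a t δ)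
             {cur : List (Subset m)} (cur≼E : cur ≼ E) (small : All (λ A → ∣ A ∣ ≤ r) cur) where

      a≥0 : 0ℚ ≤ᵠ a
      a≥0 = ℚₚ.≤-trans 0≤1 a≥1

      -- The hypothesis compares one small fragment with whole edges. Enlarging the second fragment
      -- to its edge only increases `shared`, because `a ≥ 1`; the first one keeps its size bound
      -- `r`.
      overlaps-fragments : ∑ cur (λ A → ∑ cur (shared a t A)) ≤ᵠ δ * (L * L)
      overlaps-fragments = ℚₚ.≤-trans
        (∑-mono-All (All.zip (≼-All cur≼E , small)) (λ A (A⊆E , A≤r) → ℚₚ.≤-trans
          (∑-≼ (shared-nonNeg a≥0 t A) (shared-mono a≥1 t A) cur≼E)
          (ov A⊆E A≤r)))
        (ℚₚ.≤-trans (ℚₚ.≤-reflexive (∑-const cur (δ * L)))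
          (ℚₚ.≤-trans (*-monoʳ (δ * L) (*-nonNeg δ≥0 L≥0) (≼-length cur≼E))
            (ℚₚ.≤-reflexive (solve 2 (λ l d → l :* (d :* l) := d :* (l :* l)) refl L δ))))

      blockedMass : Subset m → ℚ
      blockedMass Z = ∑ cur (λ A → planted a A Z * 𝟙 (blocked? cur t A Z))

      -- Take a pair with `A` blocked. If `B ⊆ Z`, blockedness forces an overlap of at least `t`;
      -- otherwise `planted a B Z` vanishes. The indicator that `B` is blocked as well is bounded by
      -- 1.
      blockedMass² : ∀ Z → blockedMass Z * blockedMass Z ≤ᵠ
        ∑ cur (λ A → ∑ cur (λ B → 𝟙 (t ℕ.≤? ∣ A ∩ B ∣) * (planted a A Z * planted a B Z)))
      blockedMass² Z = ℚₚ.≤-trans (ℚₚ.≤-reflexive (∑-product cur cur _ _))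
        (∑-mono cur (λ A → rows A (blocked? cur t A Z)))
        where
        u≥0 : ∀ A → 0ℚ ≤ᵠ planted a A Z
        u≥0 A = planted-nonNeg a≥0 A Z

        rhs≥0 : ∀ A B → 0ℚ ≤ᵠ 𝟙 (t ℕ.≤? ∣ A ∩ B ∣) * (planted a A Z * planted a B Z)
        rhs≥0 A B = *-nonNeg (𝟙-nonNeg (t ℕ.≤? ∣ A ∩ B ∣)) (*-nonNeg (u≥0 A) (u≥0 B))

        entry : ∀ A B → (B ⊆ Z → t ≤ ∣ A ∩ B ∣) →
                planted a A Z * planted a B Z ≤ᵠ 𝟙 (t ℕ.≤? ∣ A ∩ B ∣) * (planted a A Z * planted a B Z)
        entry A B imp with B ⊆? Z
        ... | yes s = ℚₚ.≤-reflexive (sym (trans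
          (cong (_* (planted a A Z * planted a B Z)) (𝟙-yes (t ℕ.≤? ∣ A ∩ B ∣) (imp s))) (ℚₚ.*-identityˡ _)))
        ... | no ¬s = subst (_≤ᵠ 𝟙 (t ℕ.≤? ∣ A ∩ B ∣) * (planted a A Z * planted a B Z))
          (sym (trans (cong (planted a A Z *_) (planted-⊈ a B Z ¬s)) (ℚₚ.*-zeroʳ (planted a A Z)))) (rhs≥0 A B)

        rows : ∀ A (d : Dec (Blocked cur t A Z)) →
          ∑ cur (λ B → (planted a A Z * 𝟙 d) * (planted a B Z * 𝟙 (blocked? cur t B Z))) ≤ᵠ
          ∑ cur (λ B → 𝟙 (t ℕ.≤? ∣ A ∩ B ∣) * (planted a A Z * planted a B Z))
        rows A (yes bl) = ∑-mono-All bl (λ B imp → ℚₚ.≤-trans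
          (*-mono-≤-nonNeg (u≥0 A) (*-nonNeg (u≥0 B) (𝟙-nonNeg (blocked? cur t B Z)))
            (ℚₚ.≤-reflexive (ℚₚ.*-identityʳ (planted a A Z)))
            (subst (planted a B Z * 𝟙 (blocked? cur t B Z) ≤ᵠ_) (ℚₚ.*-identityʳ (planted a B Z))
              (*-monoˡ (planted a B Z) (u≥0 B) (𝟙≤1 (blocked? cur t B Z)))))
          (entry A B imp))
        rows A (no _) = ∑-mono cur (λ B → subst (_≤ᵠ _)
          (sym (trans (cong (_* (planted a B Z * 𝟙 (blocked? cur t B Z))) (ℚₚ.*-zeroʳ (planted a A Z)))
            (ℚₚ.*-zeroˡ (planted a B Z * 𝟙 (blocked? cur t B Z)))))
          (rhs≥0 A B))

      module _ {ρ : ℚ} (ρ≥0 : 0ℚ ≤ᵠ ρ) (ρ≤1 : ρ ≤ᵠ 1ℚ) (ρa≡1 : ρ * a ≡ 1ℚ) where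

        𝔼-shared : 𝔼 ρ (λ Z → ∑ cur (λ A → ∑ cur (λ B →
                       𝟙 (t ℕ.≤? ∣ A ∩ B ∣) * (planted a A Z * planted a B Z))))
                     ≡ ∑ cur (λ A → ∑ cur (shared a t A))
        𝔼-shared = trans (𝔼-∑ {m} ρ cur _) (∑-cong cur (λ A → trans (𝔼-∑ {m} ρ cur _) (∑-cong cur (λ B →
          trans (𝔼-* ρ (𝟙 (t ℕ.≤? ∣ A ∩ B ∣)) (λ Z → planted a A Z * planted a B Z))
            (cong (𝟙 (t ℕ.≤? ∣ A ∩ B ∣) *_) (𝔼-planted² ρa≡1 A B))))))

        -- A first moment is extracted from a second one by 2 e b ≤ b² + e² with e = ε L, which
        -- replaces Cauchy-Schwarz and its square root. The final division by 2 ε L is where ε must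
        -- be positive.
        𝔼-blocked : ∀ {ε} → 0ℚ <ᵠ ε → δ ≤ᵠ ε * ε →
                    𝔼 ρ (λ V → ∑ cur (λ A → 𝟙 (blocked? cur t A (A ∪ V)))) ≤ᵠ ε * L
        𝔼-blocked {ε} ε>0 δ≤ε² = ℚₚ.≤-trans (ℚₚ.≤-reflexive to-mass) mass≤
          where
          -- Being blocked depends on `V` only through `Z = A ∪ V`, so the change of measure puts
          -- all fragments on a common random `Z`, where their masses can be multiplied.
          to-mass : 𝔼 ρ (λ V → ∑ cur (λ A → 𝟙 (blocked? cur t A (A ∪ V)))) ≡ 𝔼 ρ blockedMass
          to-mass = trans (𝔼-∑ {m} ρ cur _) (trans
            (∑-cong cur (λ A → 𝔼-planted {m} {ρ} {a} ρa≡1 A (λ Z → 𝟙 (blocked? cur t A Z))))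
            (sym (𝔼-∑ {m} ρ cur _)))

          εL = ε * L

          amgm : ∀ Z → (εL + εL) * blockedMass Z ≤ᵠ blockedMass Z * blockedMass Z + εL * εL
          amgm Z = ≤-by ((blockedMass Z - εL) * (blockedMass Z - εL)) (square-nonNeg (blockedMass Z - εL))
            (solve 2 (λ e b → (e :+ e) :* b :+ (b :- e) :* (b :- e) := b :* b :+ e :* e) refl εL (blockedMass Z))

          second-moment : 𝔼 ρ (λ Z → blockedMass Z * blockedMass Z) ≤ᵠ εL * εL
          second-moment = ℚₚ.≤-trans (𝔼-mono ρ≥0 ρ≤1 blockedMass²)
            (ℚₚ.≤-trans (ℚₚ.≤-reflexive 𝔼-shared) (ℚₚ.≤-trans overlaps-fragments
              (ℚₚ.≤-trans (*-monoʳ (L * L) (*-nonNeg L≥0 L≥0) δ≤ε²)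
                (ℚₚ.≤-reflexive (solve 2 (λ e l → (e :* e) :* (l :* l) := (e :* l) :* (e :* l)) refl ε L)))))

          mass≤ : 𝔼 ρ blockedMass ≤ᵠ εL
          mass≤ = *-cancelˡ (εL + εL) (ℚₚ.+-mono-< (*-pos ε>0 L>0) (*-pos ε>0 L>0))
            (ℚₚ.≤-trans (ℚₚ.≤-reflexive (sym (𝔼-* ρ (εL + εL) blockedMass)))
              (ℚₚ.≤-trans (𝔼-mono ρ≥0 ρ≤1 amgm)
                (ℚₚ.≤-trans (ℚₚ.≤-reflexive (trans (𝔼-+ {m} ρ _ _)
                    (cong (𝔼 ρ (λ Z → blockedMass Z * blockedMass Z) +_) (𝔼-const {m} ρ (εL * εL)))))
                  (ℚₚ.≤-trans (ℚₚ.+-monoˡ-≤ (εL * εL) second-moment)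
                    (ℚₚ.≤-reflexive (sym (ℚₚ.*-distribʳ-+ εL εL εL)))))))

    -- Edges already lost, `L - ι (length cur)` in number, are counted as failure. With the deficit
    -- built into the bound, the losses of successive rounds simply add up.
    Claim : ℕ → ℚ → ℚ → Set
    Claim r ρ η = ∀ {cur} → cur ≼ E → All (λ A → ∣ A ∣ ≤ r) cur →
                  L * 𝔼 ρ (λ W → 𝟙 (avoids? cur W)) ≤ᵠ (L - ι (length cur)) + η * L

    -- Chebyshev's inequality for the planted mass N of the fragments inside W, around L
    -- rather than around its mean.
    claim-last : ∀ {r ρ a δ} → 0ℚ ≤ᵠ ρ → ρ ≤ᵠ 1ℚ → 1ℚ ≤ᵠ a → ρ * a ≡ 1ℚ → 0ℚ ≤ᵠ δ → Overlaps r a 1 δ → Claim r ρ δ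
    claim-last {r} {ρ} {a} {δ} ρ≥0 ρ≤1 a≥1 ρa≡1 δ≥0 ov {cur} cur≼E small =
      *-cancelˡ L L>0 (ℚₚ.≤-trans (ℚₚ.≤-reflexive (sym (trans (𝔼-* {m} ρ (L * L) _) (ℚₚ.*-assoc L L _))))
        (ℚₚ.≤-trans (𝔼-mono {m} ρ≥0 ρ≤1 pointwise) (ℚₚ.≤-trans (ℚₚ.≤-reflexive expand)
          (ℚₚ.≤-trans (ℚₚ.+-monoʳ-≤ (L * L - (L + L) * c) 𝔼N²)
            -- The estimate reached so far is (L - c)² + δ L². From 0 ≤ c ≤ L it follows that (L -
            -- c)² ≤ L (L - c), and the difference is the term supplied here.
            (≤-by ((L - c) * c) (*-nonNeg (diff≥0 c≤L) (ι-nonNeg (length cur)))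
              (solve 3 (λ l c d → (l :* l :- (l :+ l) :* c :+ (c :* c :+ d :* (l :* l))) :+ (l :- c) :* c
                := l :* ((l :- c) :+ d :* l)) refl L c δ))))))
      where
      c = ι (length cur)
      c≤L = ≼-length cur≼E
      N : Subset m → ℚ
      N W = ∑ cur (λ A → planted a A W)

      N-avoids : ∀ W → ¬ Any (_⊆ W) cur → N W ≡ 0ℚ
      N-avoids W none = go cur none
        where
        go : ∀ xs → ¬ Any (_⊆ W) xs → ∑ xs (λ A → planted a A W) ≡ 0ℚ
        go []       none = refl
        go (A ∷ xs) none = cong₂ _+_ (planted-⊈ a A W (λ s → none (Any.here s))) (go xs (λ x → none (Any.there x)))

      pointwise : ∀ W → (L * L) * 𝟙 (avoids? cur W) ≤ᵠ (L - N W) * (L - N W)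
      pointwise W = by (avoids? cur W)
        where
        by : (d : Dec (¬ Any (_⊆ W) cur)) → (L * L) * 𝟙 d ≤ᵠ (L - N W) * (L - N W)
        by (yes none) = ℚₚ.≤-reflexive (sym (trans (cong (λ x → (L - x) * (L - x)) (N-avoids W none))
          (solve 1 (λ l → (l :- con 0ℚ) :* (l :- con 0ℚ) := (l :* l) :* con 1ℚ) refl L)))
        by (no _) = subst (_≤ᵠ (L - N W) * (L - N W)) (sym (ℚₚ.*-zeroʳ (L * L))) (square-nonNeg (L - N W))

      𝔼N : 𝔼 ρ N ≡ c
      𝔼N = trans (𝔼-∑ {m} ρ cur _) (trans (∑-cong cur (λ A → 𝔼-planted-1 {m} ρa≡1 A)) (∑-length cur))

      expand : 𝔼 ρ (λ W → (L - N W) * (L - N W)) ≡ L * L - (L + L) * c + 𝔼 ρ (λ W → N W * N W)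
      expand = trans
        (𝔼-cong {m} ρ (λ W → solve 2 (λ l n → (l :- n) :* (l :- n) := (l :* l :+ (:- (l :+ l)) :* n) :+ n :* n) refl L (N W)))
        (trans (𝔼-+ {m} ρ (λ W → L * L + (- (L + L)) * N W) (λ W → N W * N W))
          (cong (_+ 𝔼 ρ (λ W → N W * N W)) (trans (𝔼-+ {m} ρ (λ _ → L * L) (λ W → (- (L + L)) * N W))
            (cong₂ _+_ (𝔼-const {m} ρ (L * L))
              (trans (𝔼-* {m} ρ (- (L + L)) N) (trans (cong ((- (L + L)) *_) 𝔼N)
                (sym (ℚₚ.neg-distribˡ-* (L + L) c))))))))

      split : ∀ (A B : Subset m) → a ^ ∣ A ∩ B ∣ ≤ᵠ 1ℚ + shared a 1 A B
      split A B with ∣ A ∩ B ∣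
      ... | zero  = ℚₚ.≤-refl
      ... | suc s = ≤-by 1ℚ 0≤1 (solve 1 (λ x → x :+ con 1ℚ := con 1ℚ :+ con 1ℚ :* x) refl (a ^ suc s))

      𝔼N² : 𝔼 ρ (λ W → N W * N W) ≤ᵠ c * c + δ * (L * L)
      𝔼N² = ℚₚ.≤-trans (ℚₚ.≤-reflexive (trans
          (𝔼-cong {m} ρ (λ W → ∑-product cur cur (λ A → planted a A W) (λ B → planted a B W)))
          (trans (𝔼-∑ {m} ρ cur _) (∑-cong cur (λ A → trans (𝔼-∑ {m} ρ cur _)
            (∑-cong cur (λ B → 𝔼-planted² {m} ρa≡1 A B)))))))
        (ℚₚ.≤-trans (∑-mono cur (λ A → ∑-mono cur (λ B → split A B)))
          (ℚₚ.≤-trans (ℚₚ.≤-reflexive (trans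
              (∑-cong cur (λ A → trans (∑-+ cur (λ _ → 1ℚ) (shared a 1 A)) (cong (_+ ∑ cur (shared a 1 A)) (∑-length cur))))
              (trans (∑-+ cur (λ _ → c) (λ A → ∑ cur (shared a 1 A)))
                (cong (_+ ∑ cur (λ A → ∑ cur (shared a 1 A))) (∑-const cur c)))))
            (ℚₚ.+-monoʳ-≤ (c * c) (overlaps-fragments {t = 1} a≥1 δ≥0 ov cur≼E small))))

    -- In a `step`, condition on the part `V` exposed first. The fragments left by `shrink` have
    -- size at most `t`, so the induction hypothesis applies to them with the deficit enlarged by
    -- `lost V`, whose mean is at most `ε * L`. A set `W` covering one of them makes `V ∪ W` cover a
    -- member of `cur`.
    claim : ∀ {r ρ η} → Rounds r ρ η → ρ ≤ᵠ 1ℚ → Claim r ρ η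
    claim (last ρ≥0 a≥1 ρa≡1 δ≥0 ov) ρ≤1 = claim-last ρ≥0 ρ≤1 a≥1 ρa≡1 δ≥0 ov
    claim (step {r} {t} {ρ} {σ} {a} {δ} {ε} {η} ρ≥0 a≥1 ρa≡1 σ≥0 δ≥0 ε>0 δ≤ε² ov rounds) ρ+σ≤1 {cur} cur≼E small =
      ℚₚ.≤-trans (*-monoˡ L L≥0 (𝔼-union {m} ρ≥0 σ≥0 ρ+σ≤1 (avoids-antitone cur)))
        (ℚₚ.≤-trans (ℚₚ.≤-reflexive (sym (𝔼-* {m} ρ L _)))
          (ℚₚ.≤-trans (𝔼-mono {m} ρ≥0 ρ≤1 round)
            (ℚₚ.≤-trans (ℚₚ.≤-reflexive (trans (𝔼-+ {m} ρ (λ _ → κ) lost) (cong (_+ 𝔼 ρ lost) (𝔼-const {m} ρ κ))))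
              (ℚₚ.≤-trans (ℚₚ.+-monoʳ-≤ κ (𝔼-blocked a≥1 δ≥0 ov cur≼E small ρ≥0 ρ≤1 ρa≡1 ε>0 δ≤ε²))
                (ℚₚ.≤-reflexive (solve 4 (λ x h l e → (x :+ h :* l) :+ e :* l := x :+ (e :+ h) :* l) refl
                  (L - ι (length cur)) η L ε))))))
      where
      ρ≤1 = ℚₚ.≤-trans (≤-by σ σ≥0 refl) ρ+σ≤1
      σ≤1 = ℚₚ.≤-trans (≤-by ρ ρ≥0 (ℚₚ.+-comm σ ρ)) ρ+σ≤1
      κ = (L - ι (length cur)) + η * L
      lost : Subset m → ℚ
      lost V = ∑ cur (λ A → 𝟙 (blocked? cur t A (A ∪ V)))

      round : ∀ V → L * 𝔼 σ (λ W → 𝟙 (avoids? cur (V ∪ W))) ≤ᵠ κ + lost V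
      round V with shrink cur t V cur
      ... | ys , ys≼cur , good , count = ℚₚ.≤-trans
        (*-monoˡ L L≥0 (𝔼-mono {m} σ≥0 σ≤1 (λ W → 𝟙-mono (avoids? cur (V ∪ W)) (avoids? ys W)
          (λ none hit → none (lift W good hit)))))
        (ℚₚ.≤-trans (claim rounds σ≤1 (≼-trans ys≼cur cur≼E) (All.map proj₁ good))
          (ℚₚ.≤-reflexive (trans
            (solve 4 (λ l y h s → (l :- y) :+ h :* l := ((l :- (y :+ s)) :+ h :* l) :+ s) refl L (ι (length ys)) η (lost V))
            (cong (λ x → ((L - x) + η * L) + lost V) count))))
        where
        lift : ∀ W {ys} → All (λ Y → ∣ Y ∣ ≤ t × Any (λ B → B ⊆ Y ∪ V) cur) ys →
               Any (_⊆ W) ys → Any (_⊆ (V ∪ W)) cur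
        lift W ((_ , hit) ∷ _) (Any.here {Y} Y⊆W) = Any.map {P = λ B → B ⊆ Y ∪ V} {Q = _⊆ (V ∪ W)}
          (λ s x∈B → Sum.[ (λ x∈Y → x∈p∪q⁺ {p = V} (inj₂ (Y⊆W x∈Y))) , (λ x∈V → x∈p∪q⁺ (inj₁ x∈V)) ]′ (x∈p∪q⁻ Y V (s x∈B))) hit
        lift W (_ ∷ good) (Any.there h) = lift W good h

-- Falling factorials

falling : ℕ → ℕ → ℕ
falling d zero    = 1
falling d (suc s) = d ℕ.* falling (ℕ.pred d) s

falling-+ : ∀ k j s → falling k (j ℕ.+ s) ≡ falling k j ℕ.* falling (k ℕ.∸ j) s
falling-+ k       zero    s = sym (ℕₚ.+-identityʳ _)
falling-+ zero    (suc j) s = refl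
falling-+ (suc k) (suc j) s =
  trans (cong (suc k ℕ.*_) (falling-+ k j s)) (sym (ℕₚ.*-assoc (suc k) (falling k j) (falling (k ℕ.∸ j) s)))

-- Bernoulli's inequality for (k / (k + 1)) ^ h with denominators cleared
bernoulli : ∀ k h c → h ℕ.+ c ≡ suc k → suc k ℕ.^ h ℕ.* c ≤ k ℕ.^ h ℕ.* suc k
bernoulli k zero    c refl = ℕₚ.≤-refl
bernoulli k (suc h) c eq   = begin
  (suc k ℕ.* suc k ℕ.^ h) ℕ.* c   ≡⟨ solveⁿ 3 (λ k x c → ((conⁿ 1 ⊕ k) ⊗ x) ⊗ c ⊜ x ⊗ (c ⊕ k ⊗ c)) refl k (suc k ℕ.^ h) c ⟩
  suc k ℕ.^ h ℕ.* (c ℕ.+ k ℕ.* c) ≤⟨ ℕₚ.*-monoʳ-≤ (suc k ℕ.^ h) (ℕₚ.+-monoˡ-≤ (k ℕ.* c) c≤k) ⟩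
  suc k ℕ.^ h ℕ.* (k ℕ.+ k ℕ.* c) ≡⟨ solveⁿ 3 (λ k x c → x ⊗ (k ⊕ k ⊗ c) ⊜ k ⊗ (x ⊗ (conⁿ 1 ⊕ c))) refl k (suc k ℕ.^ h) c ⟩
  k ℕ.* (suc k ℕ.^ h ℕ.* suc c)   ≤⟨ ℕₚ.*-monoʳ-≤ k (bernoulli k h (suc c) (trans (ℕₚ.+-suc h c) eq)) ⟩
  k ℕ.* (k ℕ.^ h ℕ.* suc k)       ≡⟨ ℕₚ.*-assoc k (k ℕ.^ h) (suc k) ⟨
  (k ℕ.* k ℕ.^ h) ℕ.* suc k       ∎
  where
  open ℕₚ.≤-Reasoning
  c≤k : c ≤ k
  c≤k = subst (c ≤_) (ℕₚ.suc-injective eq) (ℕₚ.m≤n+m c h)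

-- For h ≤ (k + 1) / 2 the cofactor `c = suc k ∸ h` in Bernoulli's inequality is at least half of
-- `suc k`.
half-power : ∀ k h → h ℕ.+ h ≤ suc k → suc k ℕ.^ h ≤ 2 ℕ.* k ℕ.^ h
half-power k h le = ℕₚ.*-cancelʳ-≤ _ _ (suc k) (begin
  suc k ℕ.^ h ℕ.* suc k       ≤⟨ ℕₚ.*-monoʳ-≤ (suc k ℕ.^ h) 1+k≤2c ⟩
  suc k ℕ.^ h ℕ.* (c ℕ.+ c)   ≡⟨ solveⁿ 2 (λ x c → x ⊗ (c ⊕ c) ⊜ conⁿ 2 ⊗ (x ⊗ c)) refl (suc k ℕ.^ h) c ⟩
  2 ℕ.* (suc k ℕ.^ h ℕ.* c)   ≤⟨ ℕₚ.*-monoʳ-≤ 2 (bernoulli k h c h+c≡) ⟩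
  2 ℕ.* (k ℕ.^ h ℕ.* suc k)   ≡⟨ ℕₚ.*-assoc 2 (k ℕ.^ h) (suc k) ⟨
  2 ℕ.* k ℕ.^ h ℕ.* suc k     ∎)
  where
  open ℕₚ.≤-Reasoning
  c = suc k ℕ.∸ h
  h+c≡ : h ℕ.+ c ≡ suc k
  h+c≡ = ℕₚ.m+[n∸m]≡n (ℕₚ.≤-trans (ℕₚ.m≤m+n h h) le)
  1+k≤2c : suc k ≤ c ℕ.+ c
  1+k≤2c = subst (_≤ c ℕ.+ c) h+c≡
    (ℕₚ.+-monoˡ-≤ c (ℕₚ.+-cancelˡ-≤ h h c (subst (h ℕ.+ h ≤_) (sym h+c≡) le)))

-- An elementary substitute for (1 + 1 / k)^j ≤ e. Both halves of `j` are at most (k + 1) / 2, and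
-- each costs a factor 2.
suc-power : ∀ k j → j ≤ k → suc k ℕ.^ j ≤ 4 ℕ.* k ℕ.^ j
suc-power k j j≤k = begin
  suc k ℕ.^ j                                  ≡⟨ cong (suc k ℕ.^_) split ⟨
  suc k ℕ.^ (f ℕ.+ g)                          ≡⟨ ℕₚ.^-distribˡ-+-* (suc k) f g ⟩
  suc k ℕ.^ f ℕ.* suc k ℕ.^ g                  ≤⟨ ℕₚ.*-mono-≤ (half-power k f 2f≤) (half-power k g 2g≤) ⟩
  (2 ℕ.* k ℕ.^ f) ℕ.* (2 ℕ.* k ℕ.^ g)          ≡⟨ solveⁿ 2 (λ x y → (conⁿ 2 ⊗ x) ⊗ (conⁿ 2 ⊗ y) ⊜ conⁿ 4 ⊗ (x ⊗ y)) refl (k ℕ.^ f) (k ℕ.^ g) ⟩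
  4 ℕ.* (k ℕ.^ f ℕ.* k ℕ.^ g)                  ≡⟨ cong (4 ℕ.*_) (ℕₚ.^-distribˡ-+-* k f g) ⟨
  4 ℕ.* k ℕ.^ (f ℕ.+ g)                        ≡⟨ cong (λ i → 4 ℕ.* k ℕ.^ i) split ⟩
  4 ℕ.* k ℕ.^ j                                ∎
  where
  open ℕₚ.≤-Reasoning
  f = ℕ.⌊ j /2⌋
  g = ℕ.⌈ j /2⌉
  split = ℕₚ.⌊n/2⌋+⌈n/2⌉≡n j
  double : ∀ i → ℕ.⌊ i /2⌋ ℕ.+ ℕ.⌊ i /2⌋ ≤ i
  double i = ℕₚ.≤-trans (ℕₚ.+-monoʳ-≤ ℕ.⌊ i /2⌋ (ℕₚ.⌊n/2⌋≤⌈n/2⌉ i)) (ℕₚ.≤-reflexive (ℕₚ.⌊n/2⌋+⌈n/2⌉≡n i))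
  2f≤ = ℕₚ.≤-trans (double j) (ℕₚ.m≤n⇒m≤1+n j≤k)
  2g≤ = ℕₚ.≤-trans (double (suc j)) (ℕ.s≤s j≤k)

-- Each factor of the falling factorial lowers the base from `suc k` to `k` in the remaining power,
-- at the price of one factor 4.
power≤falling : ∀ k j → j ≤ k → k ℕ.^ j ≤ 4 ℕ.^ j ℕ.* falling k j
power≤falling k       zero    _           = ℕₚ.≤-refl
power≤falling (suc k) (suc j) (ℕ.s≤s j≤k) = begin
  suc k ℕ.* suc k ℕ.^ j                              ≤⟨ ℕₚ.*-monoʳ-≤ (suc k) (suc-power k j j≤k) ⟩
  suc k ℕ.* (4 ℕ.* k ℕ.^ j)                          ≤⟨ ℕₚ.*-monoʳ-≤ (suc k) (ℕₚ.*-monoʳ-≤ 4 (power≤falling k j j≤k)) ⟩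
  suc k ℕ.* (4 ℕ.* (4 ℕ.^ j ℕ.* falling k j))        ≡⟨ solveⁿ 3 (λ k x y → (conⁿ 1 ⊕ k) ⊗ (conⁿ 4 ⊗ (x ⊗ y)) ⊜ (conⁿ 4 ⊗ x) ⊗ ((conⁿ 1 ⊕ k) ⊗ y)) refl k (4 ℕ.^ j) (falling k j) ⟩
  (4 ℕ.* 4 ℕ.^ j) ℕ.* (suc k ℕ.* falling k j)        ∎
  where
  open ℕₚ.≤-Reasoning

falling-pos : ∀ k s → s ≤ k → 0 ℕ.< falling k s
falling-pos k       zero    _           = ℕ.s≤s ℕ.z≤n
falling-pos (suc k) (suc s) (ℕ.s≤s s≤k) = ℕₚ.*-mono-< {0} {suc k} {0} (ℕ.s≤s ℕ.z≤n) (falling-pos k s s≤k)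

-- Counting injective colourings

colorings : ∀ k n → List (Vec (Fin k) n)
colorings k n = allVecs (allFin k) n

∑-cartesianProductWith : ∀ {A B C : Set} (f : A → B → C) xs ys (g : C → ℚ) →
  ∑ (cartesianProductWith f xs ys) g ≡ ∑ xs (λ x → ∑ ys (λ y → g (f x y)))
∑-cartesianProductWith f []       ys g = refl
∑-cartesianProductWith f (x ∷ xs) ys g = trans (∑-++ (List.map (f x) ys) _ g)
  (cong₂ _+_ (∑-map (f x) ys g) (∑-cartesianProductWith f xs ys g))

∑-colorings : ∀ (g : Vec (Fin k) (suc n) → ℚ) →
  ∑ (colorings k (suc n)) g ≡ ∑ (allFin k) (λ c → ∑ (colorings k n) (λ cs → g (c ∷ cs)))
∑-colorings {k} {n} g = ∑-cartesianProductWith _∷_ (allFin k) (colorings k n) g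

∑-allFin-suc : ∀ (g : Fin (suc k) → ℚ) → ∑ (allFin (suc k)) g ≡ g zero + ∑ (allFin k) (g ∘ suc)
∑-allFin-suc {k} g = cong (g zero +_) (trans (cong (λ l → ∑ l g) (sym (Listₚ.map-tabulate id suc)))
  (∑-map suc (allFin k) g))

∑-allFin-const : ∀ k c → ∑ (allFin k) (λ _ → c) ≡ ι k * c
∑-allFin-const k c = trans (∑-const (allFin k) c) (cong (λ l → ι l * c) (Listₚ.length-tabulate {n = k} id))

∑-≟ : ∀ (c : Fin k) → ∑ (allFin k) (λ d → 𝟙 (d ≟ᶠ c)) ≡ 1ℚ
∑-≟ {suc k} zero = trans (∑-allFin-suc {k} (λ d → 𝟙 (d ≟ᶠ zero)))
  (cong (1ℚ +_) (trans (∑-allFin-const k 0ℚ) (ℚₚ.*-zeroʳ (ι k))))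
∑-≟ {suc k} (suc c) = trans (∑-allFin-suc {k} (λ d → 𝟙 (d ≟ᶠ suc c)))
  (trans (ℚₚ.+-identityˡ _) (trans (∑-cong (allFin k) (λ d → 𝟙-cong (suc d ≟ᶠ suc c) (d ≟ᶠ c) (λ { refl → refl }) (cong suc)))
    (∑-≟ c)))

∑-∉ : ∀ (D : Subset k) → ∑ (allFin k) (λ c → 𝟙 (¬? (c ∈? D))) ≡ ι ∣ ∁ D ∣
∑-∉ [] = refl
∑-∉ {suc k} (s ∷ D) = trans (∑-allFin-suc {k} (λ c → 𝟙 (¬? (c ∈? (s ∷ D)))))
  (trans (cong (𝟙 (¬? (zero ∈? (s ∷ D))) +_)
    (trans (∑-cong (allFin k) (λ c → 𝟙-cong (¬? (suc c ∈? (s ∷ D))) (¬? (c ∈? D))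
        (λ ∉sD ∈D → ∉sD (there ∈D)) (λ { ∉D (there ∈D) → ∉D ∈D })))
      (∑-∉ D))) (head s))
  where
  head : ∀ s → 𝟙 (¬? (zero ∈? (s ∷ D))) + ι ∣ ∁ D ∣ ≡ ι ∣ ∁ (s ∷ D) ∣
  head inside  = ℚₚ.+-identityˡ _
  head outside = refl

∣∁∣-insert : ∀ (D : Subset k) c → c ∉ D → ∣ ∁ (D ∪ ⁅ c ⁆) ∣ ≡ ℕ.pred ∣ ∁ D ∣
∣∁∣-insert (inside ∷ D)  zero    c∉D = ⊥-elim (c∉D here)
∣∁∣-insert (outside ∷ D) zero    c∉D = cong (λ p → ∣ ∁ p ∣) (∪-identityʳ D)
∣∁∣-insert (inside ∷ D)  (suc c) c∉D = ∣∁∣-insert D c (c∉D ∘ there)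
∣∁∣-insert (outside ∷ D) (suc c) c∉D =
  trans (cong suc (∣∁∣-insert D c (c∉D ∘ there))) (suc-pred (∁-nonEmpty D c (c∉D ∘ there)))
  where
  ∁-nonEmpty : ∀ {k} (D : Subset k) c → c ∉ D → 0 ℕ.< ∣ ∁ D ∣
  ∁-nonEmpty (inside ∷ D)  zero    c∉D = ⊥-elim (c∉D here)
  ∁-nonEmpty (outside ∷ D) zero    c∉D = ℕ.s≤s ℕ.z≤n
  ∁-nonEmpty (inside ∷ D)  (suc c) c∉D = ∁-nonEmpty D c (c∉D ∘ there)
  ∁-nonEmpty (outside ∷ D) (suc c) c∉D = ℕ.s≤s ℕ.z≤n
  suc-pred : ∀ {a} → 0 ℕ.< a → suc (ℕ.pred a) ≡ a
  suc-pred {suc a} _ = refl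

-- c agrees with c₀ on T and is injective on S ∖ T with values outside D; here T ⊆ S is intended.
Fits : Subset k → Subset n → Subset n → Vec (Fin k) n → Vec (Fin k) n → Set
Fits D []            []            []       []       = ⊤
Fits D (outside ∷ S) (_ ∷ T)       (_ ∷ c₀) (_ ∷ c)  = Fits D S T c₀ c
Fits D (inside ∷ S)  (inside ∷ T)  (b ∷ c₀) (a ∷ c)  = a ≡ b × Fits D S T c₀ c
Fits D (inside ∷ S)  (outside ∷ T) (_ ∷ c₀) (a ∷ c)  = a ∉ D × Fits (D ∪ ⁅ a ⁆) S T c₀ c

fits? : ∀ (D : Subset k) (S T : Subset n) c₀ c → Dec (Fits D S T c₀ c)
fits? D []            []            []       []       = yes tt
fits? D (outside ∷ S) (_ ∷ T)       (_ ∷ c₀) (_ ∷ c)  = fits? D S T c₀ c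
fits? D (inside ∷ S)  (inside ∷ T)  (b ∷ c₀) (a ∷ c)  = (a ≟ᶠ b) ×-dec fits? D S T c₀ c
fits? D (inside ∷ S)  (outside ∷ T) (_ ∷ c₀) (a ∷ c)  = ¬? (a ∈? D) ×-dec fits? (D ∪ ⁅ a ⁆) S T c₀ c

𝟙-× : ∀ {P Q : Set} (P? : Dec P) (Q? : Dec Q) → 𝟙 (P? ×-dec Q?) ≡ 𝟙 P? * 𝟙 Q?
𝟙-× (yes _) Q? = sym (ℚₚ.*-identityˡ _)
𝟙-× (no _)  Q? = sym (ℚₚ.*-zeroˡ (𝟙 Q?))

-- A vertex outside `S` is free, a vertex of `T` is forced, and every other vertex of `S` adds its
-- colour to `D`. The count depends on `D` only through the size of its complement, so it does not
-- matter which colour was chosen and the induction closes.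
count-fits : ∀ (D : Subset k) (S T : Subset n) c₀ →
  ∑ (colorings k n) (λ c → 𝟙 (fits? D S T c₀ c)) ≡ ι (falling ∣ ∁ D ∣ ∣ S ∩ ∁ T ∣) * ι k ^ ∣ ∁ S ∣
count-fits D [] [] [] = refl
count-fits {k} {suc n} D (outside ∷ S) (_ ∷ T) (b ∷ c₀) = trans (∑-colorings {k} {n} _)
  (trans (∑-allFin-const k _) (trans (cong (ι k *_) (count-fits D S T c₀))
    (solve 3 (λ k x y → k :* (x :* y) := x :* (k :* y)) refl (ι k)
      (ι (falling ∣ ∁ D ∣ ∣ S ∩ ∁ T ∣)) (ι k ^ ∣ ∁ S ∣))))
count-fits {k} {suc n} D (inside ∷ S) (inside ∷ T) (b ∷ c₀) = trans (∑-colorings {k} {n} _)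
  (trans (∑-cong (allFin k) (λ a → trans (∑-cong (colorings k n) (λ c → 𝟙-× (a ≟ᶠ b) (fits? D S T c₀ c)))
      (∑-*ˡ (colorings k n) (𝟙 (a ≟ᶠ b)) _)))
    (trans (∑-*ʳ (allFin k) _ (λ a → 𝟙 (a ≟ᶠ b))) (trans (cong (_* ∑ (colorings k n) _) (∑-≟ b))
      (trans (ℚₚ.*-identityˡ _) (count-fits D S T c₀)))))
count-fits {k} {suc n} D (inside ∷ S) (outside ∷ T) (b ∷ c₀) = trans (∑-colorings {k} {n} _)
  (trans (∑-cong (allFin k) (λ a → trans
      (∑-cong (colorings k n) (λ c → 𝟙-× (¬? (a ∈? D)) (fits? (D ∪ ⁅ a ⁆) S T c₀ c)))
      (trans (∑-*ˡ (colorings k n) (𝟙 (¬? (a ∈? D))) _) (term a (a ∈? D)))))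
    (trans (∑-*ʳ (allFin k) rest (λ a → 𝟙 (¬? (a ∈? D)))) (trans (cong (_* rest) (∑-∉ D))
      (trans (sym (ℚₚ.*-assoc (ι ∣ ∁ D ∣) _ _)) (cong (_* ι k ^ ∣ ∁ S ∣) (sym (ι-* ∣ ∁ D ∣ _)))))))
  where
  rest = ι (falling (ℕ.pred ∣ ∁ D ∣) ∣ S ∩ ∁ T ∣) * ι k ^ ∣ ∁ S ∣
  term : ∀ a (d : Dec (a ∈ D)) →
    𝟙 (¬? d) * ∑ (colorings k n) (λ c → 𝟙 (fits? (D ∪ ⁅ a ⁆) S T c₀ c)) ≡ 𝟙 (¬? d) * rest
  term a (yes _)  = trans (ℚₚ.*-zeroˡ (∑ (colorings k n) _)) (sym (ℚₚ.*-zeroˡ rest))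
  term a (no a∉D) = cong (1ℚ *_) (trans (count-fits (D ∪ ⁅ a ⁆) S T c₀)
    (cong (λ d → ι (falling d ∣ S ∩ ∁ T ∣) * ι k ^ ∣ ∁ S ∣) (∣∁∣-insert D a a∉D)))

image : Subset n → Vec (Fin k) n → Subset k
image []            []      = ⊥
image (outside ∷ T) (_ ∷ c) = image T c
image (inside ∷ T)  (b ∷ c) = image T c ∪ ⁅ b ⁆

∈-image⁻ : ∀ (T : Subset n) (c : Vec (Fin k) n) {d} → d ∈ image T c → ∃ λ x → x ∈ T × lookup c x ≡ d
∈-image⁻ []            []      d∈ = ⊥-elim (∉⊥ d∈)
∈-image⁻ (outside ∷ T) (_ ∷ c) d∈ = let x , x∈T , eq = ∈-image⁻ T c d∈ in suc x , there x∈T , eq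
∈-image⁻ (inside ∷ T)  (b ∷ c) d∈ with x∈p∪q⁻ (image T c) ⁅ b ⁆ d∈
... | inj₁ d∈T = let x , x∈T , eq = ∈-image⁻ T c d∈T in suc x , there x∈T , eq
... | inj₂ d∈b = zero , here , sym (x∈⁅y⁆⇒x≡y b d∈b)

rainbow-tail : ∀ {s b} {S : Subset n} {c : Vec (Fin k) n} → Rainbow (b ∷ c) (s ∷ S) → Rainbow c S
rainbow-tail rb x y x∈S y∈S x≢y = rb (suc x) (suc y) (there x∈S) (there y∈S) (x≢y ∘ suc-injective)

rainbow-⊆ : ∀ {S T : Subset n} {c : Vec (Fin k) n} → T ⊆ S → Rainbow c S → Rainbow c T
rainbow-⊆ T⊆S rb x y x∈T y∈T = rb x y (T⊆S x∈T) (T⊆S y∈T)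

∣∁image∣ : ∀ (T : Subset n) (c : Vec (Fin k) n) → Rainbow c T → ∣ ∁ (image T c) ∣ ≡ k ℕ.∸ ∣ T ∣
∣∁image∣ {k = k} [] [] rb = trans (∣∁p∣≡n∸∣p∣ (⊥ {k})) (cong (k ℕ.∸_) (∣⊥∣≡0 k))
∣∁image∣ (outside ∷ T) (_ ∷ c) rb = ∣∁image∣ T c (rainbow-tail rb)
∣∁image∣ {k = k} (inside ∷ T) (b ∷ c) rb = trans (∣∁∣-insert (image T c) b b∉)
  (trans (cong ℕ.pred (∣∁image∣ T c (rainbow-tail rb))) (ℕₚ.pred[m∸n]≡m∸[1+n] k ∣ T ∣))
  where
  b∉ : b ∉ image T c
  b∉ b∈ = let x , x∈T , eq = ∈-image⁻ T c b∈ in rb zero (suc x) here (there x∈T) (λ ()) (sym eq)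

Agree : Subset n → Vec (Fin k) n → Vec (Fin k) n → Set
Agree []            []       []      = ⊤
Agree (outside ∷ T) (_ ∷ c₀) (_ ∷ c) = Agree T c₀ c
Agree (inside ∷ T)  (b ∷ c₀) (a ∷ c) = a ≡ b × Agree T c₀ c

agree? : ∀ (T : Subset n) (c₀ c : Vec (Fin k) n) → Dec (Agree T c₀ c)
agree? []            []       []      = yes tt
agree? (outside ∷ T) (_ ∷ c₀) (_ ∷ c) = agree? T c₀ c
agree? (inside ∷ T)  (b ∷ c₀) (a ∷ c) = (a ≟ᶠ b) ×-dec agree? T c₀ c

agree-lookup : ∀ (T : Subset n) (c₀ c : Vec (Fin k) n) → Agree T c₀ c → ∀ {x} → x ∈ T → lookup c x ≡ lookup c₀ x
agree-lookup (outside ∷ T) (_ ∷ c₀) (_ ∷ c) ag       (there x∈T) = agree-lookup T c₀ c ag x∈T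
agree-lookup (inside ∷ T)  (_ ∷ c₀) (_ ∷ c) (eq , _) here        = eq
agree-lookup (inside ∷ T)  (_ ∷ c₀) (_ ∷ c) (_ , ag) (there x∈T) = agree-lookup T c₀ c ag x∈T

fits-intro : ∀ (D : Subset k) (S T : Subset n) (c₀ c : Vec (Fin k) n) → T ⊆ S →
  (∀ x → x ∈ S → x ∉ T → lookup c x ∉ D) → Rainbow c S → Agree T c₀ c → Fits D S T c₀ c
fits-intro D [] [] [] [] T⊆S avoid rb ag = tt
fits-intro D (outside ∷ S) (outside ∷ T) (_ ∷ c₀) (_ ∷ c) T⊆S avoid rb ag =
  fits-intro D S T c₀ c (drop-∷-⊆ T⊆S) (λ x x∈S x∉T → avoid (suc x) (there x∈S) (λ { (there x∈T) → x∉T x∈T })) (rainbow-tail rb) ag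
fits-intro D (outside ∷ S) (inside ∷ T) (_ ∷ c₀) (_ ∷ c) T⊆S avoid rb ag with () ← T⊆S here
fits-intro D (inside ∷ S) (inside ∷ T) (_ ∷ c₀) (_ ∷ c) T⊆S avoid rb (eq , ag) = eq ,
  fits-intro D S T c₀ c (drop-∷-⊆ T⊆S) (λ x x∈S x∉T → avoid (suc x) (there x∈S) (λ { (there x∈T) → x∉T x∈T })) (rainbow-tail rb) ag
fits-intro D (inside ∷ S) (outside ∷ T) (_ ∷ c₀) (a ∷ c) T⊆S avoid rb ag = avoid zero here (λ ()) ,
  fits-intro (D ∪ ⁅ a ⁆) S T c₀ c (drop-∷-⊆ T⊆S) avoid′ (rainbow-tail rb) ag
  where
  avoid′ : ∀ x → x ∈ S → x ∉ T → lookup c x ∉ D ∪ ⁅ a ⁆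
  avoid′ x x∈S x∉T cx∈ with x∈p∪q⁻ D ⁅ a ⁆ cx∈
  ... | inj₁ cx∈D = avoid (suc x) (there x∈S) (λ { (there x∈T) → x∉T x∈T }) cx∈D
  ... | inj₂ cx∈a = rb zero (suc x) here (there x∈S) (λ ()) (sym (x∈⁅y⁆⇒x≡y a cx∈a))

fits-elim : ∀ (D : Subset k) (S : Subset n) (c₀ c : Vec (Fin k) n) → Fits D S ⊥ c₀ c →
            (∀ x → x ∈ S → lookup c x ∉ D) × Rainbow c S
fits-elim D [] [] [] _ = (λ ()) , λ ()
fits-elim D (outside ∷ S) (_ ∷ c₀) (a ∷ c) fits with fits-elim D S c₀ c fits
... | avoid , rb = (λ { (suc x) (there x∈S) → avoid x x∈S }) ,
  λ { (suc x) (suc y) (there x∈S) (there y∈S) x≢y → rb x y x∈S y∈S (x≢y ∘ cong suc) }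
fits-elim D (inside ∷ S) (_ ∷ c₀) (a ∷ c) (a∉D , fits) with fits-elim (D ∪ ⁅ a ⁆) S c₀ c fits
... | avoid , rb =
  (λ { zero here → a∉D ; (suc x) (there x∈S) cx∈D → avoid x x∈S (x∈p∪q⁺ (inj₁ cx∈D)) }) ,
  λ { zero    zero    _           _           x≢x → ⊥-elim (x≢x refl)
    ; zero    (suc y) _           (there y∈S) _   → λ eq → a≢ y y∈S (sym eq)
    ; (suc x) zero    (there x∈S) _           _   → a≢ x x∈S
    ; (suc x) (suc y) (there x∈S) (there y∈S) x≢y → rb x y x∈S y∈S (x≢y ∘ cong suc) }
  where
  a≢ : ∀ x → x ∈ S → lookup c x ≢ a
  a≢ x x∈S refl = avoid x x∈S (x∈p∪q⁺ {p = D} (inj₂ (x∈⁅x⁆ a)))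

∣S∩∁⊥∣ : ∀ (S : Subset n) → ∣ S ∩ ∁ ⊥ ∣ ≡ ∣ S ∣
∣S∩∁⊥∣ []            = refl
∣S∩∁⊥∣ (outside ∷ S) = ∣S∩∁⊥∣ S
∣S∩∁⊥∣ (inside ∷ S)  = cong suc (∣S∩∁⊥∣ S)

∣T∣+∣S∩∁T∣ : ∀ (S T : Subset n) → T ⊆ S → ∣ T ∣ ℕ.+ ∣ S ∩ ∁ T ∣ ≡ ∣ S ∣
∣T∣+∣S∩∁T∣ []            []            T⊆S = refl
∣T∣+∣S∩∁T∣ (outside ∷ S) (outside ∷ T) T⊆S = ∣T∣+∣S∩∁T∣ S T (drop-∷-⊆ T⊆S)
∣T∣+∣S∩∁T∣ (outside ∷ S) (inside ∷ T)  T⊆S with () ← T⊆S here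
∣T∣+∣S∩∁T∣ (inside ∷ S)  (outside ∷ T) T⊆S =
  trans (ℕₚ.+-suc ∣ T ∣ ∣ S ∩ ∁ T ∣) (cong suc (∣T∣+∣S∩∁T∣ S T (drop-∷-⊆ T⊆S)))
∣T∣+∣S∩∁T∣ (inside ∷ S)  (inside ∷ T)  T⊆S = cong suc (∣T∣+∣S∩∁T∣ S T (drop-∷-⊆ T⊆S))

#rainbow : ℕ → ℕ → ℕ → ℚ
#rainbow k n s = ι (falling k s) * ι k ^ (n ℕ.∸ s)

count-rainbow : ∀ (S : Subset n) (c₀ : Vec (Fin k) n) →
  ∑ (colorings k n) (λ c → 𝟙 (rainbow? c S)) ≡ #rainbow k n ∣ S ∣
count-rainbow {n} {k} S c₀ = trans
  (∑-cong (colorings k n) (λ c → 𝟙-cong (rainbow? c S) (fits? ⊥ S ⊥ c₀ c)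
    (λ rb → fits-intro ⊥ S ⊥ c₀ c (⊥-elim ∘ ∉⊥) (λ _ _ _ → ∉⊥) rb (agree-⊥ c₀ c))
    (λ fits → proj₂ (fits-elim ⊥ S c₀ c fits))))
  (trans (count-fits ⊥ S ⊥ c₀)
    (cong₂ _*_ (cong₂ (λ d s → ι (falling d s)) (trans (∣∁p∣≡n∸∣p∣ (⊥ {k})) (cong (k ℕ.∸_) (∣⊥∣≡0 k))) (∣S∩∁⊥∣ S))
      (cong (ι k ^_) (∣∁p∣≡n∸∣p∣ S))))
  where
  agree-⊥ : ∀ {n} (c₀ c : Vec (Fin k) n) → Agree ⊥ c₀ c
  agree-⊥ []       []      = tt
  agree-⊥ (_ ∷ c₀) (_ ∷ c) = agree-⊥ c₀ c

-- This is the bound (4 / k)^j, j = |T|, on the probability that a random rainbow colouring of `S`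
-- extends `c₀` on `T`. The extensions are counted by forbidding from the start all colours of `T`,
-- since vertices of `T` may come after vertices of `S ∖ T`. Then (k)_j (k - j)_s = (k)_(j + s) with
-- s = |S ∖ T|.
count-agree : ∀ (S T : Subset n) (c₀ : Vec (Fin k) n) → T ⊆ S → Rainbow c₀ T → ∣ S ∣ ≤ k →
  ι k ^ ∣ T ∣ * ∑ (colorings k n) (λ c → 𝟙 (rainbow? c S) * 𝟙 (agree? T c₀ c)) ≤ᵠ
  ι 4 ^ ∣ T ∣ * #rainbow k n ∣ S ∣
count-agree {n} {k} S T c₀ T⊆S rb₀ S≤k = ℚₚ.≤-trans
  (*-monoˡ (ι k ^ j) (^-nonNeg (ι-nonNeg k) j) (ℚₚ.≤-trans
    (∑-mono (colorings k n) (λ c → subst (_≤ᵠ 𝟙 (fits? D S T c₀ c)) (𝟙-× (rainbow? c S) (agree? T c₀ c))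
      (𝟙-mono (rainbow? c S ×-dec agree? T c₀ c) (fits? D S T c₀ c) (λ (rb , ag) → fits-intro D S T c₀ c T⊆S (avoid c rb ag) rb ag))))
    (ℚₚ.≤-reflexive (trans (count-fits D S T c₀)
      (cong₂ (λ d e → ι (falling d s) * ι k ^ e) (∣∁image∣ T c₀ rb₀) (∣∁p∣≡n∸∣p∣ S))))))
  (ℚₚ.≤-trans (ℚₚ.≤-reflexive (sym (ℚₚ.*-assoc (ι k ^ j) (ι (falling (k ℕ.∸ j) s)) (ι k ^ e))))
    (ℚₚ.≤-trans (*-monoʳ (ι k ^ e) (^-nonNeg (ι-nonNeg k) e) counts)
      (ℚₚ.≤-reflexive (ℚₚ.*-assoc (ι 4 ^ j) (ι (falling k ∣ S ∣)) (ι k ^ e)))))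
  where
  D = image T c₀
  j = ∣ T ∣
  s = ∣ S ∩ ∁ T ∣
  e = n ℕ.∸ ∣ S ∣

  avoid : ∀ c → Rainbow c S → Agree T c₀ c → ∀ x → x ∈ S → x ∉ T → lookup c x ∉ D
  avoid c rb ag x x∈S x∉T cx∈D =
    let y , y∈T , eq = ∈-image⁻ T c₀ cx∈D
    in rb x y x∈S (T⊆S y∈T) (λ x≡y → x∉T (subst (_∈ T) (sym x≡y) y∈T)) (trans (sym eq) (sym (agree-lookup T c₀ c ag y∈T)))

  counts : ι k ^ j * ι (falling (k ℕ.∸ j) s) ≤ᵠ ι 4 ^ j * ι (falling k ∣ S ∣)
  counts = subst₂ _≤ᵠ_
    (trans (ι-* (k ℕ.^ j) _) (cong (_* ι (falling (k ℕ.∸ j) s)) (ι-^ k j)))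
    (trans (ι-* (4 ℕ.^ j) _) (cong₂ _*_ (ι-^ 4 j) refl))
    (ι-mono (begin
      k ℕ.^ j ℕ.* falling (k ℕ.∸ j) s
        ≤⟨ ℕₚ.*-monoˡ-≤ (falling (k ℕ.∸ j) s) (power≤falling k j (ℕₚ.≤-trans (p⊆q⇒∣p∣≤∣q∣ T⊆S) S≤k)) ⟩
      4 ℕ.^ j ℕ.* falling k j ℕ.* falling (k ℕ.∸ j) s
        ≡⟨ ℕₚ.*-assoc (4 ℕ.^ j) (falling k j) _ ⟩
      4 ℕ.^ j ℕ.* (falling k j ℕ.* falling (k ℕ.∸ j) s)
        ≡⟨ cong (4 ℕ.^ j ℕ.*_) (trans (sym (falling-+ k j s)) (cong (falling k) (∣T∣+∣S∩∁T∣ S T T⊆S))) ⟩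
      4 ℕ.^ j ℕ.* falling k ∣ S ∣ ∎))
    where open ℕₚ.≤-Reasoning

-- Exponential moments of the number of matching colours

matches : Subset n → Vec (Fin k) n → Vec (Fin k) n → ℕ
matches []            []       []      = 0
matches (outside ∷ I) (_ ∷ c₀) (_ ∷ c) = matches I c₀ c
matches (inside ∷ I)  (b ∷ c₀) (a ∷ c) = (if does (a ≟ᶠ b) then 1 else 0) ℕ.+ matches I c₀ c

subsets : Subset n → List (Subset n)
subsets []            = [] ∷ []
subsets (outside ∷ I) = List.map (outside ∷_) (subsets I)
subsets (inside ∷ I)  = List.map (outside ∷_) (subsets I) ++ List.map (inside ∷_) (subsets I)

subsets-⊆ : ∀ (I : Subset n) → All (_⊆ I) (subsets I)
subsets-⊆ []            = (λ x → x) ∷ []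
subsets-⊆ (outside ∷ I) = Allₚ.map⁺ (All.map out⊆ (subsets-⊆ I))
subsets-⊆ (inside ∷ I)  = Allₚ.++⁺ (Allₚ.map⁺ (All.map out⊆ (subsets-⊆ I))) (Allₚ.map⁺ (All.map s⊆s (subsets-⊆ I)))

∑-subsets : ∀ b (I : Subset n) → ∑ (subsets I) (λ T → b ^ ∣ T ∣) ≡ (1ℚ + b) ^ ∣ I ∣
∑-subsets b []            = refl
∑-subsets b (outside ∷ I) = trans (∑-map (outside ∷_) (subsets I) _) (∑-subsets b I)
∑-subsets b (inside ∷ I)  = trans (∑-++ (List.map (outside ∷_) (subsets I)) _ _)
  (trans (cong₂ _+_ (trans (∑-map (outside ∷_) (subsets I) _) (∑-subsets b I))
      (trans (∑-map (inside ∷_) (subsets I) _) (trans (∑-*ˡ (subsets I) b _) (cong (b *_) (∑-subsets b I)))))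
    (solve 2 (λ b x → x :+ b :* x := (con 1ℚ :+ b) :* x) refl b ((1ℚ + b) ^ ∣ I ∣)))

-- The right-hand side equals (1 + a)^`matches`, since a subset of `I` contributes exactly when all
-- its vertices match. In this form only agreement on fixed sets has to be counted.
expand-matches : ∀ {a} → 0ℚ ≤ᵠ a → ∀ (I : Subset n) (c₀ c : Vec (Fin k) n) →
  a ^ matches I c₀ c ≤ᵠ ∑ (subsets I) (λ T → a ^ ∣ T ∣ * 𝟙 (agree? T c₀ c))
expand-matches a≥0 [] [] [] = ℚₚ.≤-refl
expand-matches a≥0 (outside ∷ I) (b ∷ c₀) (d ∷ c) = ℚₚ.≤-trans (expand-matches a≥0 I c₀ c)
  (ℚₚ.≤-reflexive (sym (∑-map (outside ∷_) (subsets I) _)))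
expand-matches {a = a} a≥0 (inside ∷ I) (b ∷ c₀) (d ∷ c) = ℚₚ.≤-trans (by (d ≟ᶠ b))
  (ℚₚ.≤-reflexive (sym (trans (∑-++ (List.map (outside ∷_) (subsets I)) _ _)
    (cong₂ _+_ (∑-map (outside ∷_) (subsets I) _)
      (trans (∑-map (inside ∷_) (subsets I) _) (trans
        (∑-cong (subsets I) (λ T → trans (cong (a ^ suc ∣ T ∣ *_) (𝟙-× (d ≟ᶠ b) (agree? T c₀ c)))
          (solve 4 (λ a x y z → (a :* x) :* (y :* z) := (a :* y) :* (x :* z)) refl a (a ^ ∣ T ∣) (𝟙 (d ≟ᶠ b)) (𝟙 (agree? T c₀ c)))))
        (∑-*ˡ (subsets I) (a * 𝟙 (d ≟ᶠ b)) _)))))))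
  where
  X = ∑ (subsets I) (λ T → a ^ ∣ T ∣ * 𝟙 (agree? T c₀ c))
  X≥0 : 0ℚ ≤ᵠ X
  X≥0 = ∑-nonNeg (subsets I) (λ T → *-nonNeg (^-nonNeg a≥0 ∣ T ∣) (𝟙-nonNeg (agree? T c₀ c)))
  by : (e : Dec (d ≡ b)) → a ^ ((if does e then 1 else 0) ℕ.+ matches I c₀ c) ≤ᵠ X + a * 𝟙 e * X
  by (yes _) = ℚₚ.≤-trans (*-monoˡ a a≥0 (expand-matches a≥0 I c₀ c))
    (≤-by X X≥0 (solve 2 (λ a x → a :* x :+ x := x :+ a :* con 1ℚ :* x) refl a X))
  by (no _)  = ℚₚ.≤-trans (expand-matches a≥0 I c₀ c)
    (ℚₚ.≤-reflexive (solve 2 (λ a x → x := x :+ a :* con 0ℚ :* x) refl a X))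

-- The weight (k v)^|T| meets the agreement probability (4 / k)^|T|. The powers of k cancel, and
-- summing (4 v)^|T| over `T ⊆ I` gives the binomial (1 + 4 v)^|I|.
∑-rainbow-matches : ∀ {v} → 0ℚ ≤ᵠ v → ∀ (S I : Subset n) (c₀ : Vec (Fin k) n) → I ⊆ S → Rainbow c₀ I → ∣ S ∣ ≤ k →
  ∑ (colorings k n) (λ c → 𝟙 (rainbow? c S) * (ι k * v) ^ matches I c₀ c) ≤ᵠ
  #rainbow k n ∣ S ∣ * (1ℚ + ι 4 * v) ^ ∣ I ∣
∑-rainbow-matches {n} {k} {v} v≥0 S I c₀ I⊆S rb₀ S≤k = ℚₚ.≤-trans
  (∑-mono (colorings k n) (λ c → *-monoˡ (𝟙 (rainbow? c S)) (𝟙-nonNeg (rainbow? c S))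
    (expand-matches (*-nonNeg (ι-nonNeg k) v≥0) I c₀ c)))
  (ℚₚ.≤-trans (ℚₚ.≤-reflexive (trans
      (∑-cong (colorings k n) (λ c → sym (∑-*ˡ (subsets I) (𝟙 (rainbow? c S)) _)))
      (∑-swap (colorings k n) (subsets I) _)))
    (ℚₚ.≤-trans (∑-mono-All (subsets-⊆ I) (λ T T⊆I → per T (λ {x} → T⊆I {x})))
      (ℚₚ.≤-reflexive (trans (∑-*ˡ (subsets I) R _) (cong (R *_) (∑-subsets (ι 4 * v) I))))))
  where
  R = #rainbow k n ∣ S ∣
  per : ∀ T → T ⊆ I → ∑ (colorings k n) (λ c → 𝟙 (rainbow? c S) * ((ι k * v) ^ ∣ T ∣ * 𝟙 (agree? T c₀ c))) ≤ᵠ R * (ι 4 * v) ^ ∣ T ∣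
  per T T⊆I = ℚₚ.≤-trans
    (ℚₚ.≤-reflexive (trans
      (∑-cong (colorings k n) (λ c → trans (cong (λ z → 𝟙 (rainbow? c S) * (z * 𝟙 (agree? T c₀ c))) (^-distrib-* (ι k) v ∣ T ∣))
        (solve 4 (λ r x y z → r :* ((x :* y) :* z) := (y :* x) :* (r :* z)) refl (𝟙 (rainbow? c S)) (ι k ^ ∣ T ∣) (v ^ ∣ T ∣) (𝟙 (agree? T c₀ c)))))
      (trans (∑-*ˡ (colorings k n) (v ^ ∣ T ∣ * ι k ^ ∣ T ∣) _) (ℚₚ.*-assoc (v ^ ∣ T ∣) (ι k ^ ∣ T ∣) _))))
    (ℚₚ.≤-trans (*-monoˡ (v ^ ∣ T ∣) (^-nonNeg v≥0 ∣ T ∣)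
        (count-agree S T c₀ (λ {x} x∈T → I⊆S (T⊆I {x} x∈T)) (rainbow-⊆ {c = c₀} (λ {x} → T⊆I {x}) rb₀) S≤k))
      (ℚₚ.≤-reflexive (trans
        (solve 3 (λ v f r → v :* (f :* r) := r :* (f :* v)) refl (v ^ ∣ T ∣) (ι 4 ^ ∣ T ∣) R)
        (cong (R *_) (sym (^-distrib-* (ι 4) v ∣ T ∣))))))

-- Coloured edges

row : Side → Fin k → Subset k
row outside c = ⊥
row inside  c = ⁅ c ⁆

graph : Subset n → Vec (Fin k) n → Subset (n ℕ.* k)
graph []      []      = []
graph (s ∷ S) (c ∷ cs) = row s c ⧺ graph S cs

∣⧺∣ : ∀ (p : Subset k) (q : Subset m) → ∣ p ⧺ q ∣ ≡ ∣ p ∣ ℕ.+ ∣ q ∣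
∣⧺∣ []            q = refl
∣⧺∣ (outside ∷ p) q = ∣⧺∣ p q
∣⧺∣ (inside ∷ p)  q = cong suc (∣⧺∣ p q)

∩-⧺ : ∀ (p p′ : Subset k) (q q′ : Subset m) → (p ⧺ q) ∩ (p′ ⧺ q′) ≡ (p ∩ p′) ⧺ (q ∩ q′)
∩-⧺ []      []        q q′ = refl
∩-⧺ (x ∷ p) (x′ ∷ p′) q q′ = cong (_ ∷_) (∩-⧺ p p′ q q′)

⧺-⊆⁻ : ∀ (p p′ : Subset k) {q q′ : Subset m} → (p ⧺ q) ⊆ (p′ ⧺ q′) → p ⊆ p′ × q ⊆ q′
⧺-⊆⁻ []            []             s = (λ ()) , s
⧺-⊆⁻ (outside ∷ p) (_ ∷ p′)       s = let l , r = ⧺-⊆⁻ p p′ (drop-∷-⊆ s) in out⊆ l , r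
⧺-⊆⁻ (inside ∷ p)  (outside ∷ p′) s with () ← s here
⧺-⊆⁻ (inside ∷ p)  (inside ∷ p′)  s = let l , r = ⧺-⊆⁻ p p′ (drop-∷-⊆ s) in s⊆s l , r

⧺-⊆⁺ : ∀ (p p′ : Subset k) {q q′ : Subset m} → p ⊆ p′ → q ⊆ q′ → (p ⧺ q) ⊆ (p′ ⧺ q′)
⧺-⊆⁺ []            []             p⊆ q⊆ = q⊆
⧺-⊆⁺ (outside ∷ p) (_ ∷ p′)       p⊆ q⊆ = out⊆ (⧺-⊆⁺ p p′ (drop-∷-⊆ p⊆) q⊆)
⧺-⊆⁺ (inside ∷ p)  (outside ∷ p′) p⊆ q⊆ with () ← p⊆ here
⧺-⊆⁺ (inside ∷ p)  (inside ∷ p′)  p⊆ q⊆ = s⊆s (⧺-⊆⁺ p p′ (drop-∷-⊆ p⊆) q⊆)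

∣row∣ : ∀ s (c : Fin k) → ∣ row s c ∣ ≡ ∣ s ∷ [] ∣
∣row∣ {k} outside c = ∣⊥∣≡0 k
∣row∣ inside  c = ∣⁅x⁆∣≡1 c

∣graph∣ : ∀ (S : Subset n) (c : Vec (Fin k) n) → ∣ graph S c ∣ ≡ ∣ S ∣
∣graph∣ []            []       = refl
∣graph∣ (outside ∷ S) (c ∷ cs) = trans (∣⧺∣ (row outside c) (graph S cs)) (cong₂ ℕ._+_ (∣row∣ outside c) (∣graph∣ S cs))
∣graph∣ (inside ∷ S)  (c ∷ cs) = trans (∣⧺∣ (row inside c) (graph S cs)) (cong₂ ℕ._+_ (∣row∣ inside c) (∣graph∣ S cs))

∣⁅⁆∩⁅⁆∣ : ∀ (b a : Fin k) → ∣ ⁅ b ⁆ ∩ ⁅ a ⁆ ∣ ≡ (if does (a ≟ᶠ b) then 1 else 0)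
∣⁅⁆∩⁅⁆∣ {k} b a with a ≟ᶠ b
... | yes refl = trans (cong ∣_∣ (∩-idem ⁅ a ⁆)) (∣⁅x⁆∣≡1 a)
... | no a≢b = ℕₚ.n≤0⇒n≡0 (subst (∣ ⁅ b ⁆ ∩ ⁅ a ⁆ ∣ ≤_) (∣⊥∣≡0 k) (p⊆q⇒∣p∣≤∣q∣ {q = ⊥} (λ x∈ →
  let x∈b , x∈a = x∈p∩q⁻ ⁅ b ⁆ ⁅ a ⁆ x∈ in ⊥-elim (a≢b (trans (sym (x∈⁅y⁆⇒x≡y a x∈a)) (x∈⁅y⁆⇒x≡y b x∈b))))))

∣graph∩graph∣ : ∀ (A S : Subset n) (c₀ c : Vec (Fin k) n) → ∣ graph A c₀ ∩ graph S c ∣ ≡ matches (A ∩ S) c₀ c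
∣graph∩graph∣ [] [] [] [] = refl
∣graph∩graph∣ {k = k} (s ∷ A) (t ∷ S) (b ∷ c₀) (a ∷ c) = trans
  (cong ∣_∣ (∩-⧺ (row s b) (row t a) (graph A c₀) (graph S c)))
  (trans (∣⧺∣ (row s b ∩ row t a) (graph A c₀ ∩ graph S c)) (rows s t))
  where
  IH = ∣graph∩graph∣ A S c₀ c
  rows : ∀ s t → ∣ row s b ∩ row t a ∣ ℕ.+ ∣ graph A c₀ ∩ graph S c ∣ ≡ matches ((s ∷ A) ∩ (t ∷ S)) (b ∷ c₀) (a ∷ c)
  rows outside t       = cong₂ ℕ._+_ (trans (cong ∣_∣ (∩-zeroˡ (row t a))) (∣⊥∣≡0 k)) IH
  rows inside  outside = cong₂ ℕ._+_ (trans (cong ∣_∣ (∩-zeroʳ ⁅ b ⁆)) (∣⊥∣≡0 k)) IH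
  rows inside  inside  = cong₂ ℕ._+_ (∣⁅⁆∩⁅⁆∣ b a) IH

sub-row : ∀ s (c : Fin k) (B : Subset k) → B ⊆ row s c → ∃ λ s₀ → (∀ {n} {A S : Subset n} → A ⊆ S → (s₀ ∷ A) ⊆ (s ∷ S)) × B ≡ row s₀ c
sub-row outside c B B⊆ = outside , out⊆ , ⊆-antisym B⊆ ⊥⊆
sub-row inside  c B B⊆ with c ∈? B
... | yes c∈B = inside , s⊆s , ⊆-antisym B⊆ (λ x∈ → subst (_∈ B) (sym (x∈⁅y⁆⇒x≡y c x∈)) c∈B)
... | no  c∉B = outside , out⊆ , ⊆-antisym (λ x∈ → ⊥-elim (c∉B (subst (_∈ B) (x∈⁅y⁆⇒x≡y c (B⊆ x∈)) x∈))) ⊥⊆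

-- Fragments of coloured edges are again coloured vertex sets, so the overlap estimate also covers
-- what later rounds leave over.
sub-graph : ∀ (S : Subset n) (c : Vec (Fin k) n) (A : Subset (n ℕ.* k)) → A ⊆ graph S c →
            ∃ λ A₀ → A₀ ⊆ S × A ≡ graph A₀ c
sub-graph []      []       []  A⊆ = [] , (λ ()) , refl
sub-graph {k = k} (s ∷ S) (c ∷ cs) A A⊆ with Vec.splitAt k A
... | B , A′ , refl =
  let B⊆ , A′⊆ = ⧺-⊆⁻ B (row s c) A⊆
      s₀ , cons , eqB = sub-row s c B B⊆
      A₀ , A₀⊆ , eqA = sub-graph S cs A′ A′⊆
  in s₀ ∷ A₀ , cons A₀⊆ , cong₂ _⧺_ eqB eqA

graph-⊆⁻ : ∀ (S W : Subset n) (c′ c : Vec (Fin k) n) → graph S c′ ⊆ graph W c → S ⊆ W × Agree S c c′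
graph-⊆⁻ [] [] [] [] _ = (λ ()) , tt
graph-⊆⁻ (outside ∷ S) (w ∷ W) (a ∷ c′) (b ∷ c) g⊆ =
  let S⊆ , ag = graph-⊆⁻ S W c′ c (proj₂ (⧺-⊆⁻ (row outside a) (row w b) g⊆)) in out⊆ S⊆ , ag
graph-⊆⁻ (inside ∷ S) (outside ∷ W) (a ∷ c′) (b ∷ c) g⊆ =
  ⊥-elim (∉⊥ (proj₁ (⧺-⊆⁻ (row inside a) (row outside b) g⊆) (x∈⁅x⁆ a)))
graph-⊆⁻ (inside ∷ S) (inside ∷ W) (a ∷ c′) (b ∷ c) g⊆ =
  let a⊆ , g′⊆ = ⧺-⊆⁻ (row inside a) (row inside b) g⊆
      S⊆ , ag = graph-⊆⁻ S W c′ c g′⊆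
  in s⊆s S⊆ , x∈⁅y⁆⇒x≡y b (a⊆ (x∈⁅x⁆ a)) , ag

-- Colourings of all of X are listed, not only of `S`. A coloured edge is thus repeated once for
-- each colouring of the complement of `S`; for uniform `H` this multiplicity is the same for all
-- edges and cancels.
rainbowEdges : ∀ k → Hypergraph n → Hypergraph (n ℕ.* k)
rainbowEdges {n} k H = concatMap (λ S → List.map (graph S) (filter (λ c → rainbow? c S) (colorings k n))) H

∑-rainbowEdges : ∀ (H : Hypergraph n) (f : Subset (n ℕ.* k) → ℚ) → ∑ (rainbowEdges k H) f ≡
  ∑ H (λ S → ∑ (colorings k n) (λ c → 𝟙 (rainbow? c S) * f (graph S c)))
∑-rainbowEdges {n} {k} H f = trans (∑-concatMap _ H f) (∑-cong H (λ S →
  trans (∑-map (graph S) (filter (λ c → rainbow? c S) (colorings k n)) f)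
    (∑-filter (λ c → rainbow? c S) (colorings k n) (λ c → f (graph S c)))))

rainbowEdges⁻ : ∀ (H : Hypergraph n) {E} → E ∈ᴸ rainbowEdges k H →
  ∃ λ S → S ∈ᴸ H × ∃ λ c → Rainbow c S × E ≡ graph S c
rainbowEdges⁻ {n} {k} H E∈ =
  let S , S∈H , E∈S = find (∈-concatMap⁻ (λ S → List.map (graph S) (filter (λ c → rainbow? c S) (colorings k n))) {xs = H} E∈)
      c , c∈ , eq = ∈-map⁻ (graph S) E∈S
  in S , S∈H , c , proj₂ (∈-filter⁻ (λ c → rainbow? c S) {xs = colorings k n} c∈) , eq

∑-cong-All : ∀ {A : Set} {P : A → Set} {xs : List A} {f g : A → ℚ} → All P xs →
             (∀ x → P x → f x ≡ g x) → ∑ xs f ≡ ∑ xs g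
∑-cong-All []         eq = refl
∑-cong-All (px ∷ pxs) eq = cong₂ _+_ (eq _ px) (∑-cong-All pxs eq)

length-rainbowEdges : ∀ {r} (H : Hypergraph n) → Uniform r H → Vec (Fin k) n →
  ι (length (rainbowEdges k H)) ≡ ι (length H) * #rainbow k n r
length-rainbowEdges {n} {k} {r} H uniform c₀ = trans (sym (∑-length (rainbowEdges k H)))
  (trans (∑-rainbowEdges H (λ _ → 1ℚ)) (trans
    (∑-cong-All uniform (λ S S≡r → trans (∑-cong (colorings k n) (λ c → ℚₚ.*-identityʳ (𝟙 (rainbow? c S))))
      (trans (count-rainbow S c₀) (cong (#rainbow k n) S≡r))))
    (∑-const H (#rainbow k n r))))

∑-meetingIn : ∀ (H : Hypergraph n) A j → ∑ H (λ S → 𝟙 (∣ A ∩ S ∣ ℕ.≟ j)) ≡ ι (meetingIn H A j)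
∑-meetingIn H A j = trans (∑-cong H (λ S → sym (ℚₚ.*-identityʳ (𝟙 (∣ A ∩ S ∣ ℕ.≟ j)))))
  (trans (sym (∑-filter (λ S → ∣ A ∩ S ∣ ℕ.≟ j) H (λ _ → 1ℚ))) (∑-length (filter (λ S → ∣ A ∩ S ∣ ℕ.≟ j) H)))

-- The spread estimate for coloured edges

split-level : ∀ {β} → 0ℚ ≤ᵠ β → ∀ t v → 𝟙 (t ℕ.≤? v) * β ^ v ≤ᵠ 𝟙 (v ℕ.≟ t) * β ^ t + 𝟙 (suc t ℕ.≤? v) * β ^ v
split-level {β} β≥0 t v with ℕₚ.<-cmp v t
... | tri< v<t _ _ = subst (_≤ᵠ rhs) (sym (trans (cong (_* β ^ v) (𝟙-no (t ℕ.≤? v) (ℕₚ.<⇒≱ v<t))) (ℚₚ.*-zeroˡ (β ^ v))))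
  (+-nonNeg (*-nonNeg (𝟙-nonNeg (v ℕ.≟ t)) (^-nonNeg β≥0 t)) (*-nonNeg (𝟙-nonNeg (suc t ℕ.≤? v)) (^-nonNeg β≥0 v)))
  where rhs = 𝟙 (v ℕ.≟ t) * β ^ t + 𝟙 (suc t ℕ.≤? v) * β ^ v
... | tri≈ _ refl _ = ℚₚ.≤-trans (*-monoʳ (β ^ v) (^-nonNeg β≥0 v) (𝟙-mono (v ℕ.≤? v) (v ℕ.≟ v) (λ _ → refl)))
  (≤-by (𝟙 (suc v ℕ.≤? v) * β ^ v) (*-nonNeg (𝟙-nonNeg (suc v ℕ.≤? v)) (^-nonNeg β≥0 v)) refl)
... | tri> _ _ t<v = ℚₚ.≤-trans (*-monoʳ (β ^ v) (^-nonNeg β≥0 v) (𝟙-mono (t ℕ.≤? v) (suc t ℕ.≤? v) (λ _ → t<v)))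
  (≤-by (𝟙 (v ℕ.≟ t) * β ^ t) (*-nonNeg (𝟙-nonNeg (v ℕ.≟ t)) (^-nonNeg β≥0 t))
    (ℚₚ.+-comm (𝟙 (suc t ℕ.≤? v) * β ^ v) (𝟙 (v ℕ.≟ t) * β ^ t)))

-- Overlap exactly j contributes at most x^j L, where x = β q. As x ≤ 1/2, the geometric series from
-- t on is at most 2 x^t. The induction is on `N`, the number of levels that can still occur.
tail-sum : ∀ {β q L} → 0ℚ ≤ᵠ β → 0ℚ ≤ᵠ q → 0ℚ ≤ᵠ L → β * q + β * q ≤ᵠ 1ℚ → ∀ (H : Hypergraph n) A N t →
  (∀ j → t ≤ j → ι (meetingIn H A j) ≤ᵠ q ^ j * L) → (∀ S → ∣ A ∩ S ∣ ℕ.< t ℕ.+ N) →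
  ∑ H (shared β t A) ≤ᵠ ((β * q) ^ t + (β * q) ^ t) * L
tail-sum {β = β} {q} {L} β≥0 q≥0 L≥0 2x≤1 H A zero t spread v< = ℚₚ.≤-trans
  (ℚₚ.≤-reflexive (trans (∑-cong H (λ S → trans
      (cong (_* β ^ ∣ A ∩ S ∣) (𝟙-no (t ℕ.≤? ∣ A ∩ S ∣) (ℕₚ.<⇒≱ (subst (∣ A ∩ S ∣ ℕ.<_) (ℕₚ.+-identityʳ t) (v< S)))))
      (ℚₚ.*-zeroˡ (β ^ ∣ A ∩ S ∣)))) (trans (∑-const H 0ℚ) (ℚₚ.*-zeroʳ (ι (length H))))))
  (*-nonNeg (+-nonNeg xt≥0 xt≥0) L≥0)
  where
  xt≥0 = ^-nonNeg (*-nonNeg β≥0 q≥0) t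
tail-sum {β = β} {q} {L} β≥0 q≥0 L≥0 2x≤1 H A (suc N) t spread v< = ℚₚ.≤-trans
  (∑-mono H (λ S → split-level β≥0 t ∣ A ∩ S ∣))
  (ℚₚ.≤-trans (ℚₚ.≤-reflexive (trans (∑-+ H _ _) (cong (_+ ∑ H (shared β (suc t) A))
      (trans (∑-*ʳ H (β ^ t) _) (cong (_* β ^ t) (∑-meetingIn H A t))))))
    (ℚₚ.≤-trans (ℚₚ.+-mono-≤
        (*-monoʳ (β ^ t) (^-nonNeg β≥0 t) (spread t ℕₚ.≤-refl))
        (tail-sum β≥0 q≥0 L≥0 2x≤1 H A N (suc t) (λ j t<j → spread j (ℕₚ.<⇒≤ t<j))
          (λ S → subst (∣ A ∩ S ∣ ℕ.<_) (ℕₚ.+-suc t N) (v< S))))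
      (≤-by ((1ℚ - (x + x)) * (x ^ t * L)) (*-nonNeg (diff≥0 2x≤1) (*-nonNeg (^-nonNeg (*-nonNeg β≥0 q≥0) t) L≥0))
        (trans (cong (λ z → (z + (x * x ^ t + x * x ^ t) * L) + (1ℚ - (x + x)) * (x ^ t * L)) (trans
            (solve 3 (λ q l b → (q :* l) :* b := (b :* q) :* l) refl (q ^ t) L (β ^ t))
            (cong (_* L) (sym (^-distrib-* β q t)))))
          (solve 3 (λ x y l → (y :* l :+ (x :* y :+ x :* y) :* l) :+ (con 1ℚ :- (x :+ x)) :* (y :* l)
            := (y :+ y) :* l) refl x (x ^ t) L)))))
  where x = β * q

module _ {r : ℕ} (H : Hypergraph n) (uniform : Uniform r H) (r≤k : r ≤ k) where

  open Sparsify (rainbowEdges k H) using (Overlaps)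

  -- The fragment is the graph of some `c₀` over `A₀`, and it meets the graph of `c` over `S` in the
  -- matches on `A₀ ∩ S`. Averaging over `c` replaces the weight k v of a common point by 1 + 4 v ≤
  -- 5 v of a common vertex, using v ≥ 1. What remains is an overlap sum in `H` itself, with ratio x
  -- = 5 v q.
  rainbow-overlaps : ∀ {q v s t} → 0ℚ ≤ᵠ q → 1ℚ ≤ᵠ v → ι 5 * v * q + ι 5 * v * q ≤ᵠ 1ℚ →
    (∀ A → Any (A ⊆_) H → ∣ A ∣ ≤ s → t ≤ ∣ A ∣ → ∀ j → t ≤ j → ι (meetingIn H A j) ≤ᵠ q ^ j * ι (length H)) →
    Overlaps s (ι k * v) t ((ι 5 * v * q) ^ t + (ι 5 * v * q) ^ t)
  rainbow-overlaps {q} {v} {s} {t} q≥0 v≥1 2x≤1 spread {A} any A≤s =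
    let E , E∈ , A⊆E = find any
        S₀ , S₀∈H , c₀ , rb₀ , E≡ = rainbowEdges⁻ {k = k} H E∈
        A₀ , A₀⊆S₀ , A≡ = sub-graph S₀ c₀ A (subst (A ⊆_) E≡ (λ {x} → A⊆E {x}))
    in fromGraph c₀ A₀ (Any.map (λ { refl → λ {x} → A₀⊆S₀ {x} }) S₀∈H) (rainbow-⊆ {c = c₀} (λ {x} → A₀⊆S₀ {x}) rb₀) A≡ A≤s
    where
    β = ι 5 * v
    v≥0 = ℚₚ.≤-trans 0≤1 v≥1
    β≥0 = *-nonNeg (ι-nonNeg 5) v≥0
    R = #rainbow k n r
    R≥0 = *-nonNeg (ι-nonNeg (falling k r)) (^-nonNeg (ι-nonNeg k) (n ℕ.∸ r))
    x = β * q
    L = ι (length H)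

    1+4v≤β : 1ℚ + ι 4 * v ≤ᵠ β
    1+4v≤β = ≤-by (v - 1ℚ) (diff≥0 v≥1) (solve 1 (λ v → (con 1ℚ :+ con (ι 4) :* v) :+ (v :- con 1ℚ) := con (ι 5) :* v) refl v)

    matches≤ : ∀ {n} (I : Subset n) (c₀ c : Vec (Fin k) n) → matches I c₀ c ≤ ∣ I ∣
    matches≤ []            []       []      = ℕ.z≤n
    matches≤ (outside ∷ I) (_ ∷ c₀) (_ ∷ c) = matches≤ I c₀ c
    matches≤ (inside ∷ I)  (b ∷ c₀) (a ∷ c) with a ≟ᶠ b
    ... | yes _ = ℕ.s≤s (matches≤ I c₀ c)
    ... | no  _ = ℕₚ.m≤n⇒m≤1+n (matches≤ I c₀ c)

    module _ (c₀ : Vec (Fin k) n) (A₀ : Subset n) (A₀⊆H : Any (A₀ ⊆_) H) (rb₀ : Rainbow c₀ A₀) where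

      perEdge : ∀ S → ∣ S ∣ ≡ r →
        ∑ (colorings k n) (λ c → 𝟙 (rainbow? c S) * shared (ι k * v) t (graph A₀ c₀) (graph S c)) ≤ᵠ R * shared β t A₀ S
      perEdge S S≡r = ℚₚ.≤-trans
        (∑-mono (colorings k n) (λ c → ℚₚ.≤-trans
          (*-monoˡ (𝟙 (rainbow? c S)) (𝟙-nonNeg (rainbow? c S)) (weight c))
          (ℚₚ.≤-reflexive (solve 3 (λ x y z → x :* (y :* z) := y :* (x :* z)) refl
            (𝟙 (rainbow? c S)) θ ((ι k * v) ^ matches I c₀ c)))))
        (ℚₚ.≤-trans (ℚₚ.≤-reflexive (∑-*ˡ (colorings k n) θ _))
          (ℚₚ.≤-trans (*-monoˡ θ θ≥0 (ℚₚ.≤-trans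
              (∑-rainbow-matches v≥0 S I c₀ (p∩q⊆q A₀ S) (rainbow-⊆ {c = c₀} (p∩q⊆p A₀ S) rb₀) (subst (_≤ k) (sym S≡r) r≤k))
              (subst (λ z → #rainbow k n ∣ S ∣ * (1ℚ + ι 4 * v) ^ ∣ I ∣ ≤ᵠ #rainbow k n z * β ^ ∣ I ∣) S≡r
                (*-monoˡ (#rainbow k n ∣ S ∣) (subst (λ z → 0ℚ ≤ᵠ #rainbow k n z) (sym S≡r) R≥0)
                  (^-monoˡ (+-nonNeg 0≤1 (*-nonNeg (ι-nonNeg 4) v≥0)) 1+4v≤β ∣ I ∣)))))
            (ℚₚ.≤-reflexive (solve 3 (λ x y z → x :* (y :* z) := y :* (x :* z)) refl θ R (β ^ ∣ I ∣)))))
        where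
        I = A₀ ∩ S
        θ = 𝟙 (t ℕ.≤? ∣ I ∣)
        θ≥0 = 𝟙-nonNeg (t ℕ.≤? ∣ I ∣)
        weight : ∀ c → shared (ι k * v) t (graph A₀ c₀) (graph S c) ≤ᵠ θ * (ι k * v) ^ matches I c₀ c
        weight c = subst (λ u → 𝟙 (t ℕ.≤? u) * (ι k * v) ^ u ≤ᵠ θ * (ι k * v) ^ matches I c₀ c)
          (sym (∣graph∩graph∣ A₀ S c₀ c))
          (*-monoʳ ((ι k * v) ^ matches I c₀ c) (^-nonNeg (*-nonNeg (ι-nonNeg k) v≥0) (matches I c₀ c))
            (𝟙-mono (t ℕ.≤? matches I c₀ c) (t ℕ.≤? ∣ I ∣) (λ t≤ → ℕₚ.≤-trans t≤ (matches≤ I c₀ c))))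

      meets : ∣ A₀ ∣ ≤ s → ∑ H (shared β t A₀) ≤ᵠ (x ^ t + x ^ t) * L
      meets A₀≤s with t ℕ.≤? ∣ A₀ ∣
      ... | yes t≤A₀ = tail-sum β≥0 q≥0 (ι-nonNeg (length H)) 2x≤1 H A₀ (suc n) t
        (spread A₀ A₀⊆H A₀≤s t≤A₀)
        (λ S → ℕₚ.≤-trans (ℕ.s≤s (∣p∣≤n (A₀ ∩ S))) (ℕₚ.m≤n+m (suc n) t))
      -- A set of size below `t` has no overlap of size `t`, so spreadness is invoked only inside
      -- its size window.
      ... | no t≰A₀ = ℚₚ.≤-trans
        (ℚₚ.≤-reflexive (trans (∑-cong H (λ S → trans
            (cong (_* β ^ ∣ A₀ ∩ S ∣) (𝟙-no (t ℕ.≤? ∣ A₀ ∩ S ∣) (λ t≤ → t≰A₀ (ℕₚ.≤-trans t≤ (∣p∩q∣≤∣p∣ A₀ S)))))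
            (ℚₚ.*-zeroˡ (β ^ ∣ A₀ ∩ S ∣)))) (trans (∑-const H 0ℚ) (ℚₚ.*-zeroʳ L))))
        (*-nonNeg (+-nonNeg xt≥0 xt≥0) (ι-nonNeg (length H)))
        where xt≥0 = ^-nonNeg (*-nonNeg β≥0 q≥0) t

      fromGraph : ∀ {A} → A ≡ graph A₀ c₀ → ∣ A ∣ ≤ s → ∑ (rainbowEdges k H) (shared (ι k * v) t A) ≤ᵠ
                  (x ^ t + x ^ t) * ι (length (rainbowEdges k H))
      fromGraph refl A≤s = ℚₚ.≤-trans
        (ℚₚ.≤-reflexive (∑-rainbowEdges {k = k} H (shared (ι k * v) t (graph A₀ c₀))))
        (ℚₚ.≤-trans (∑-mono-All uniform perEdge)
          (ℚₚ.≤-trans (ℚₚ.≤-reflexive (∑-*ˡ H R (shared β t A₀)))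
            (ℚₚ.≤-trans (*-monoˡ R R≥0 (meets (subst (_≤ s) (∣graph∣ A₀ c₀) A≤s)))
              (ℚₚ.≤-reflexive (trans (solve 3 (λ r y l → r :* (y :* l) := y :* (l :* r)) refl R (x ^ t + x ^ t) L)
                (cong ((x ^ t + x ^ t) *_) (sym (length-rainbowEdges H uniform c₀))))))))

-- From independent colour sets to random colours

∈-∑≤ : ∀ {A : Set} {xs : List A} {f : A → ℚ} → (∀ x → 0ℚ ≤ᵠ f x) → ∀ {x} → x ∈ᴸ xs → f x ≤ᵠ ∑ xs f
∈-∑≤ {xs = _ ∷ xs} {f} nn {x} (Any.here refl) = ≤-by (∑ xs f) (∑-nonNeg xs nn) refl
∈-∑≤ {xs = y ∷ xs} {f} nn {x} (Any.there x∈)  = ℚₚ.≤-trans (∈-∑≤ nn x∈) (≤-by (f y) (nn y) (ℚₚ.+-comm (∑ xs f) (f y)))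

𝔼-⧺ : ∀ k {m} ρ (f : Subset (k ℕ.+ m) → ℚ) → 𝔼 {k ℕ.+ m} ρ f ≡ 𝔼 {k} ρ (λ B → 𝔼 {m} ρ (λ Y → f (B ⧺ Y)))
𝔼-⧺ zero    ρ f = refl
𝔼-⧺ (suc k) ρ f = cong₂ (λ x y → (1ℚ - ρ) * x + ρ * y)
  (𝔼-⧺ k ρ (λ Z → f (outside ∷ Z))) (𝔼-⧺ k ρ (λ Z → f (inside ∷ Z)))

𝔼-∈ : ∀ ρ (c : Fin k) → 𝔼 {k} ρ (λ B → 𝟙 (c ∈? B)) ≡ ρ
𝔼-∈ {suc k} ρ zero = trans (cong₂ (λ x y → (1ℚ - ρ) * x + ρ * y) (𝔼-const {k} ρ 0ℚ) (𝔼-const {k} ρ 1ℚ))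
  (solve 1 (λ r → (con 1ℚ :- r) :* con 0ℚ :+ r :* con 1ℚ := r) refl ρ)
𝔼-∈ {suc k} ρ (suc c) = trans (cong₂ (λ x y → (1ℚ - ρ) * x + ρ * y) (tail outside) (tail inside)) (convex-same ρ ρ)
  where
  tail : ∀ s → 𝔼 {k} ρ (λ B → 𝟙 (suc c ∈? (s ∷ B))) ≡ ρ
  tail s = trans (𝔼-cong {k} ρ (λ B → 𝟙-cong (suc c ∈? (s ∷ B)) (c ∈? B) (λ { (there c∈) → c∈ }) there)) (𝔼-∈ ρ c)

-- Rows are ∅ with probability 1 - p and ⁅ c ⁆ with probability p κ for each colour c.
𝔼₁ : ∀ {k n} → ℚ → ℚ → (Subset (n ℕ.* k) → ℚ) → ℚ
𝔼₁ {k} {zero}  p κ f = f []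
𝔼₁ {k} {suc n} p κ f = (1ℚ - p) * 𝔼₁ {k} {n} p κ (λ Y → f (⊥ {k} ⧺ Y)) +
                       p * κ * ∑ (allFin k) (λ c → 𝔼₁ {k} {n} p κ (λ Y → f (⁅ c ⁆ ⧺ Y)))

module _ {k : ℕ} {p κ : ℚ} where

  𝔼₁-+ : ∀ {n} (f g : Subset (n ℕ.* k) → ℚ) → 𝔼₁ {k} {n} p κ (λ Y → f Y + g Y) ≡ 𝔼₁ {k} {n} p κ f + 𝔼₁ {k} {n} p κ g
  𝔼₁-+ {zero}  f g = refl
  𝔼₁-+ {suc n} f g = trans
    (cong₂ (λ x y → (1ℚ - p) * x + p * κ * y) (𝔼₁-+ {n} (λ Y → f (⊥ {k} ⧺ Y)) (λ Y → g (⊥ {k} ⧺ Y)))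
      (trans (∑-cong (allFin k) (λ c → 𝔼₁-+ {n} (λ Y → f (⁅ c ⁆ ⧺ Y)) (λ Y → g (⁅ c ⁆ ⧺ Y)))) (∑-+ (allFin k) _ _)))
    (solve 6 (λ s r a b c d → s :* (a :+ b) :+ r :* (c :+ d) := (s :* a :+ r :* c) :+ (s :* b :+ r :* d) ) refl
      (1ℚ - p) (p * κ) _ _ _ _)

  𝔼₁-* : ∀ {n} a (f : Subset (n ℕ.* k) → ℚ) → 𝔼₁ {k} {n} p κ (λ Y → a * f Y) ≡ a * 𝔼₁ {k} {n} p κ f
  𝔼₁-* {zero}  a f = refl
  𝔼₁-* {suc n} a f = trans
    (cong₂ (λ x y → (1ℚ - p) * x + p * κ * y) (𝔼₁-* {n} a (λ Y → f (⊥ {k} ⧺ Y)))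
      (trans (∑-cong (allFin k) (λ c → 𝔼₁-* {n} a (λ Y → f (⁅ c ⁆ ⧺ Y)))) (∑-*ˡ (allFin k) a _)))
    (solve 5 (λ s r a x y → s :* (a :* x) :+ r :* (a :* y) := a :* (s :* x :+ r :* y)) refl (1ℚ - p) (p * κ) a _ _)

  𝔼₁-∑ : ∀ {n} {A : Set} (xs : List A) (f : A → Subset (n ℕ.* k) → ℚ) →
         𝔼₁ {k} {n} p κ (λ Y → ∑ xs (λ x → f x Y)) ≡ ∑ xs (λ x → 𝔼₁ {k} {n} p κ (f x))
  𝔼₁-∑ {n} []       f = trans (𝔼₁-* {n} 0ℚ (λ _ → 0ℚ)) (ℚₚ.*-zeroˡ (𝔼₁ {k} {n} p κ (λ _ → 0ℚ)))
  𝔼₁-∑ {n} (x ∷ xs) f = trans (𝔼₁-+ {n} (f x) _) (cong (𝔼₁ {k} {n} p κ (f x) +_) (𝔼₁-∑ {n} xs f))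

  module _ (p≥0 : 0ℚ ≤ᵠ p) (p≤1 : p ≤ᵠ 1ℚ) (κ≥0 : 0ℚ ≤ᵠ κ) where

    𝔼₁-mono : ∀ {n} {f g : Subset (n ℕ.* k) → ℚ} → (∀ Y → f Y ≤ᵠ g Y) → 𝔼₁ {k} {n} p κ f ≤ᵠ 𝔼₁ {k} {n} p κ g
    𝔼₁-mono {zero}  le = le []
    𝔼₁-mono {suc n} le = ℚₚ.+-mono-≤
      (*-monoˡ (1ℚ - p) (diff≥0 p≤1) (𝔼₁-mono {n} (λ Y → le (⊥ {k} ⧺ Y))))
      (*-monoˡ (p * κ) (*-nonNeg p≥0 κ≥0) (∑-mono (allFin k) (λ c → 𝔼₁-mono {n} (λ Y → le (⁅ c ⁆ ⧺ Y)))))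

    module _ (kκ≡1 : ι k * κ ≡ 1ℚ) (ρ≤1 : p * κ ≤ᵠ 1ℚ) where

      private
        ρ = p * κ
        ρ≥0 = *-nonNeg p≥0 κ≥0

      -- McDiarmid's comparison, one row at a time: an edge meets a row in at most one colour, so
      -- the chance that a random row B completes an edge is subadditive in the colours of B.
      compare-rows : ∀ {n} (Good : Subset (n ℕ.* k) → Set) (good? : Decidable Good) →
        (∀ {Y Z} → Y ⊆ Z → Good Y → Good Z) →
        (∀ Y → Good Y → ∃ λ S → ∃ λ c → graph {n} {k} S c ⊆ Y × Good (graph S c)) →
        𝔼 {n ℕ.* k} ρ (λ Y → 𝟙 (good? Y)) ≤ᵠ 𝔼₁ {k} {n} p κ (λ Y → 𝟙 (good? Y))
      compare-rows {zero}  Good good? up wit = ℚₚ.≤-refl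
      compare-rows {suc n} Good good? up wit = ℚₚ.≤-trans (ℚₚ.≤-reflexive (𝔼-⧺ k ρ _))
        (ℚₚ.≤-trans (𝔼-mono {k} ρ≥0 ρ≤1 (λ B → ℚₚ.≤-trans (tail-rows B)
            (ℚₚ.≤-trans (𝔼₁-mono {n} (pointwise B)) (ℚₚ.≤-reflexive (linear B)))))
          (ℚₚ.≤-reflexive (trans average regroup)))
        where
        g : Subset k → Subset (n ℕ.* k) → ℚ
        g B Y = 𝟙 (good? (B ⧺ Y))

        h : Subset k → ℚ
        h B = 𝔼₁ {k} {n} p κ (g B)

        tail-rows : ∀ B → 𝔼 {n ℕ.* k} ρ (g B) ≤ᵠ h B
        tail-rows B = compare-rows {n} (λ Y → Good (B ⧺ Y)) (λ Y → good? (B ⧺ Y))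
          (λ s → up (⧺-⊆⁺ B B (λ x → x) s)) witness
          where
          witness : ∀ Y → Good (B ⧺ Y) → ∃ λ S → ∃ λ c → graph {n} {k} S c ⊆ Y × Good (B ⧺ graph S c)
          witness Y gd with wit (B ⧺ Y) gd
          ... | s ∷ S , c ∷ cs , ⊆BY , gd′ = let ⊆B , ⊆Y = ⧺-⊆⁻ (row s c) B ⊆BY in
            S , cs , ⊆Y , up (⧺-⊆⁺ (row s c) B ⊆B (λ x → x)) gd′

        -- This is affine in the indicators of `c ∈ B`, so only their means ρ enter. It is exact
        -- when `B` is empty or a single colour.
        bound : Subset k → Subset (n ℕ.* k) → ℚ
        bound B Y = g ⊥ Y + ∑ (allFin k) (λ c → 𝟙 (c ∈? B) * (g ⁅ c ⁆ Y - g ⊥ Y))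

        gain≥0 : ∀ Y c → 0ℚ ≤ᵠ g ⁅ c ⁆ Y - g ⊥ Y
        gain≥0 Y c = diff≥0 (𝟙-mono (good? (⊥ ⧺ Y)) (good? (⁅ c ⁆ ⧺ Y)) (up (⧺-⊆⁺ ⊥ ⁅ c ⁆ ⊥⊆ (λ x → x))))

        terms≥0 : ∀ B Y c → 0ℚ ≤ᵠ 𝟙 (c ∈? B) * (g ⁅ c ⁆ Y - g ⊥ Y)
        terms≥0 B Y c = *-nonNeg (𝟙-nonNeg (c ∈? B)) (gain≥0 Y c)

        pointwise : ∀ B Y → g B Y ≤ᵠ bound B Y
        pointwise B Y with good? (B ⧺ Y)
        ... | no _ = +-nonNeg (𝟙-nonNeg (good? (⊥ ⧺ Y))) (∑-nonNeg (allFin k) (terms≥0 B Y))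
        ... | yes gd with wit (B ⧺ Y) gd
        ...   | outside ∷ S , c ∷ cs , ⊆BY , gd′ =
          ≤-by (∑ (allFin k) (λ c → 𝟙 (c ∈? B) * (g ⁅ c ⁆ Y - g ⊥ Y))) (∑-nonNeg (allFin k) (terms≥0 B Y))
            (cong (_+ ∑ (allFin k) (λ c → 𝟙 (c ∈? B) * (g ⁅ c ⁆ Y - g ⊥ Y)))
              (sym (𝟙-yes (good? (⊥ ⧺ Y)) (up (⧺-⊆⁺ ⊥ ⊥ (λ x → x) (proj₂ (⧺-⊆⁻ (row outside c) B ⊆BY))) gd′))))
        ...   | inside ∷ S , c ∷ cs , ⊆BY , gd′ = ℚₚ.≤-trans
          (ℚₚ.≤-reflexive (trans (solve 1 (λ x → con 1ℚ := x :+ con 1ℚ :* (con 1ℚ :- x)) refl (g ⊥ Y))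
            (cong₂ (λ y z → g ⊥ Y + y * (z - g ⊥ Y)) (sym (𝟙-yes (c ∈? B) (proj₁ split (x∈⁅x⁆ c))))
              (sym (𝟙-yes (good? (⁅ c ⁆ ⧺ Y)) (up (⧺-⊆⁺ ⁅ c ⁆ ⁅ c ⁆ (λ x → x) (proj₂ split)) gd′))))))
          (ℚₚ.+-monoʳ-≤ (g ⊥ Y) (∈-∑≤ (terms≥0 B Y) (∈-allFin c)))
          where split = ⧺-⊆⁻ (row inside c) B ⊆BY

        linear : ∀ B → 𝔼₁ {k} {n} p κ (bound B) ≡ h ⊥ + ∑ (allFin k) (λ c → 𝟙 (c ∈? B) * (h ⁅ c ⁆ - h ⊥))
        linear B = trans (𝔼₁-+ {n} (g ⊥) _) (cong (h ⊥ +_) (trans (𝔼₁-∑ {n} (allFin k) _)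
          (∑-cong (allFin k) (λ c → trans (𝔼₁-* {n} (𝟙 (c ∈? B)) (λ Y → g ⁅ c ⁆ Y - g ⊥ Y)) (cong (𝟙 (c ∈? B) *_)
            (trans (𝔼₁-+ {n} (g ⁅ c ⁆) (λ Y → - g ⊥ Y)) (cong (h ⁅ c ⁆ +_) neg)))))))
          where
          neg : 𝔼₁ {k} {n} p κ (λ Y → - g ⊥ Y) ≡ - h ⊥
          neg = trans (𝔼₁-cong {n} (λ Y → solve 1 (λ x → :- x := con (- 1ℚ) :* x) refl (g ⊥ Y)))
            (trans (𝔼₁-* {n} (- 1ℚ) (g ⊥)) (solve 1 (λ x → con (- 1ℚ) :* x := :- x) refl (h ⊥)))
            where
            𝔼₁-cong : ∀ {n} {f g : Subset (n ℕ.* k) → ℚ} → (∀ Y → f Y ≡ g Y) → 𝔼₁ {k} {n} p κ f ≡ 𝔼₁ {k} {n} p κ g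
            𝔼₁-cong {n} eq = ℚₚ.≤-antisym (𝔼₁-mono {n} (λ Y → ℚₚ.≤-reflexive (eq Y))) (𝔼₁-mono {n} (λ Y → ℚₚ.≤-reflexive (sym (eq Y))))

        average : 𝔼 {k} ρ (λ B → h ⊥ + ∑ (allFin k) (λ c → 𝟙 (c ∈? B) * (h ⁅ c ⁆ - h ⊥))) ≡
                  h ⊥ + ∑ (allFin k) (λ c → ρ * (h ⁅ c ⁆ - h ⊥))
        average = trans (𝔼-+ {k} ρ (λ _ → h ⊥) _) (cong₂ _+_ (𝔼-const {k} ρ (h ⊥)) (trans (𝔼-∑ {k} ρ (allFin k) _)
          (∑-cong (allFin k) (λ c → trans (𝔼-cong {k} ρ (λ B → ℚₚ.*-comm (𝟙 (c ∈? B)) (h ⁅ c ⁆ - h ⊥)))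
            (trans (𝔼-* {k} ρ (h ⁅ c ⁆ - h ⊥) _) (trans (cong ((h ⁅ c ⁆ - h ⊥) *_) (𝔼-∈ ρ c)) (ℚₚ.*-comm (h ⁅ c ⁆ - h ⊥) ρ)))))))

        -- Since k ρ = p, the empty row gets weight 1 - p and each single colour ρ, as in the
        -- recursion of `𝔼₁`.
        regroup : h ⊥ + ∑ (allFin k) (λ c → ρ * (h ⁅ c ⁆ - h ⊥)) ≡ (1ℚ - p) * h ⊥ + ρ * ∑ (allFin k) (λ c → h ⁅ c ⁆)
        regroup = trans (cong (h ⊥ +_) (trans (∑-*ˡ (allFin k) ρ _) (cong (ρ *_)
            (trans (∑-+ (allFin k) (λ c → h ⁅ c ⁆) (λ _ → - h ⊥)) (cong (∑ (allFin k) (λ c → h ⁅ c ⁆) +_) (∑-allFin-const k (- h ⊥)))))))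
          (trans (solve 5 (λ z p κ s k → z :+ (p :* κ) :* (s :+ k :* (:- z)) := (con 1ℚ :- p :* (k :* κ)) :* z :+ (p :* κ) :* s) refl
              (h ⊥) p κ (∑ (allFin k) (λ c → h ⁅ c ⁆)) (ι k))
            (cong (λ w → w * h ⊥ + ρ * ∑ (allFin k) (λ c → h ⁅ c ⁆)) (trans (cong (λ w → 1ℚ - p * w) kκ≡1) (cong (λ w → 1ℚ - w) (ℚₚ.*-identityʳ p)))))

-- The probability space of the theorem

bernoulli-mass : ℚ → Side → ℚ
bernoulli-mass p inside  = p
bernoulli-mass p outside = 1ℚ - p

product-mass : ∀ {A : Set} {n} → (A → ℚ) → Vec A n → ℚ
product-mass w v = Vec.foldr _ (λ a m → w a * m) 1ℚ v

outcome-mass : ∀ {k n} → ℚ → ℚ → Outcome k n → ℚ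
outcome-mass p κ (W , c) = product-mass (bernoulli-mass p) W * product-mass (λ _ → κ) c

sides : List Side
sides = outside ∷ inside ∷ []

-- The colour of a vertex outside `W` leaves no trace in the graph. Summing over it gives the factor
-- k κ = 1, which is why `𝔼₁` has a single term for the empty row.
𝔼₁-outcomes : ∀ {k n} p κ → ι k * κ ≡ 1ℚ → (f : Subset (n ℕ.* k) → ℚ) →
  𝔼₁ {k} {n} p κ f ≡ ∑ (allVecs sides n) (λ W → ∑ (colorings k n) (λ c → outcome-mass p κ (W , c) * f (graph W c)))
𝔼₁-outcomes {k} {zero} p κ kκ≡1 f = solve 1 (λ x → x := (con 1ℚ :* con 1ℚ :* x :+ con 0ℚ) :+ con 0ℚ) refl (f [])
𝔼₁-outcomes {k} {suc n} p κ kκ≡1 f = sym (trans (∑-cartesianProductWith _∷_ sides (allVecs sides n) _)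
  (trans (cong₂ (λ x y → x + (y + 0ℚ)) (side outside) (side inside))
    (trans (cong (λ x → (1ℚ - p) * κ * x + (p * κ * Σ₁ + 0ℚ)) (∑-allFin-const k (𝔼₁ {k} {n} p κ (λ Y → f (⊥ {k} ⧺ Y)))))
      (trans (solve 5 (λ p κ k x s → ((con 1ℚ :- p) :* κ) :* (k :* x) :+ (p :* κ :* s :+ con 0ℚ) := (con 1ℚ :- p) :* (k :* κ) :* x :+ p :* κ :* s)
          refl p κ (ι k) _ Σ₁)
        (cong (λ w → w * 𝔼₁ {k} {n} p κ (λ Y → f (⊥ {k} ⧺ Y)) + p * κ * Σ₁)
          (trans (cong ((1ℚ - p) *_) kκ≡1) (ℚₚ.*-identityʳ (1ℚ - p))))))))
  where
  Σ₁ = ∑ (allFin k) (λ a → 𝔼₁ {k} {n} p κ (λ Y → f (⁅ a ⁆ ⧺ Y)))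
  side : ∀ s → ∑ (allVecs sides n) (λ W → ∑ (colorings k (suc n)) (λ c → outcome-mass p κ (s ∷ W , c) * f (graph (s ∷ W) c))) ≡
         bernoulli-mass p s * κ * ∑ (allFin k) (λ a → 𝔼₁ {k} {n} p κ (λ Y → f (row s a ⧺ Y)))
  side s = trans (∑-cong (allVecs sides n) (λ W → trans (∑-colorings {k} {n} _)
      (∑-cong (allFin k) (λ a → trans (∑-cong (colorings k n) (λ c →
          solve 5 (λ s m κ l x → ((s :* m) :* (κ :* l)) :* x := (s :* κ) :* ((m :* l) :* x)) refl
            (bernoulli-mass p s) (product-mass (bernoulli-mass p) W) κ (product-mass (λ _ → κ) c) (f (row s a ⧺ graph W c))))
        (∑-*ˡ (colorings k n) (bernoulli-mass p s * κ) _)))))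
    (trans (∑-swap (allVecs sides n) (allFin k) _)
      (trans (∑-cong (allFin k) (λ a → trans (∑-*ˡ (allVecs sides n) (bernoulli-mass p s * κ) _)
          (cong (bernoulli-mass p s * κ *_) (sym (𝔼₁-outcomes {k} {n} p κ kκ≡1 (λ Y → f (row s a ⧺ Y)))))))
        (∑-*ˡ (allFin k) (bernoulli-mass p s * κ) _)))

Pr-rainbow : ∀ {n} k → ℚ → ℚ → Hypergraph n → ℚ
Pr-rainbow {n} k p κ H = ∑ (outcomes k n) (λ o → 𝟙 (containsRainbowEdge? H o) * outcome-mass p κ o)

product-mass-nonNeg : ∀ {A : Set} {n} {w : A → ℚ} → (∀ a → 0ℚ ≤ᵠ w a) → (v : Vec A n) → 0ℚ ≤ᵠ product-mass w v
product-mass-nonNeg w≥0 []      = 0≤1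
product-mass-nonNeg w≥0 (a ∷ v) = *-nonNeg (w≥0 a) (product-mass-nonNeg w≥0 v)

Covers : List (Subset m) → Subset m → Set
Covers E Y = Any (_⊆ Y) E

covers? : (E : List (Subset m)) → Decidable (Covers E)
covers? E Y = any? (_⊆? Y) E

module _ {n r k : ℕ} (H : Hypergraph n) (uniform : Uniform r H) {p κ : ℚ}
         (p≥0 : 0ℚ ≤ᵠ p) (p≤1 : p ≤ᵠ 1ℚ) (κ≥0 : 0ℚ ≤ᵠ κ) (κ≤1 : κ ≤ᵠ 1ℚ) (kκ≡1 : ι k * κ ≡ 1ℚ) where

  private
    E = rainbowEdges k H
    ρ≥0 = *-nonNeg p≥0 κ≥0
    ρ≤1 : p * κ ≤ᵠ 1ℚ
    ρ≤1 = *-mono-≤-nonNeg 0≤1 κ≥0 p≤1 κ≤1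

  open Sparsify E using (Rounds; claim; L)

  covers-graph : ∀ W c → Covers E (graph W c) → ContainsRainbowEdge H (W , c)
  covers-graph W c cov =
    let F , F∈E , F⊆ = find cov
        S , S∈H , c′ , rb , F≡ = rainbowEdges⁻ {k = k} H F∈E
        S⊆W , ag = graph-⊆⁻ S W c′ c (subst (_⊆ graph W c) F≡ (λ {x} → F⊆ {x}))
        rb′ : Rainbow c S
        rb′ x y x∈ y∈ x≢y eq = rb x y x∈ y∈ x≢y (trans (agree-lookup S c c′ ag x∈) (trans eq (sym (agree-lookup S c c′ ag y∈))))
    in Any.map (λ { refl → (λ {x} → S⊆W {x}) , rb′ }) S∈H

  𝔼-covers≤Pr : 𝔼 {n ℕ.* k} (p * κ) (λ Y → 𝟙 (covers? E Y)) ≤ᵠ Pr-rainbow k p κ H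
  𝔼-covers≤Pr = ℚₚ.≤-trans
    (compare-rows {k} {p} {κ} p≥0 p≤1 κ≥0 kκ≡1 ρ≤1 {n} (Covers E) (covers? E) up wit)
    (ℚₚ.≤-trans (ℚₚ.≤-reflexive (𝔼₁-outcomes {k} {n} p κ kκ≡1 _))
      (ℚₚ.≤-trans (∑-mono (allVecs sides n) (λ W → ∑-mono (colorings k n) (λ c →
          subst (outcome-mass p κ (W , c) * 𝟙 (covers? E (graph W c)) ≤ᵠ_) (ℚₚ.*-comm (outcome-mass p κ (W , c)) (𝟙 (containsRainbowEdge? H (W , c))))
            (*-monoˡ (outcome-mass p κ (W , c)) (mass≥0 W c)
              (𝟙-mono (covers? E (graph W c)) (containsRainbowEdge? H (W , c)) (covers-graph W c))))))
        (ℚₚ.≤-reflexive (sym (∑-cartesianProductWith _,_ (allVecs sides n) (colorings k n) _)))))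
    where
    up : ∀ {Y Z} → Y ⊆ Z → Covers E Y → Covers E Z
    up {Y} {Z} Y⊆Z = Any.map {P = _⊆ Y} {Q = _⊆ Z} (λ s x∈ → Y⊆Z (s x∈))

    wit : ∀ Y → Covers E Y → ∃ λ S → ∃ λ c → graph {n} {k} S c ⊆ Y × Covers E (graph S c)
    wit Y cov =
      let F , F∈E , F⊆Y = find cov
          S , S∈H , c , rb , F≡ = rainbowEdges⁻ {k = k} H F∈E
      in S , c , subst (_⊆ Y) F≡ (λ {x} → F⊆Y {x}) , Any.map {P = F ≡_} {Q = _⊆ graph S c} (λ { refl {x} x∈ → subst (x ∈_) F≡ x∈ }) F∈E

    mass≥0 : ∀ W c → 0ℚ ≤ᵠ outcome-mass p κ (W , c)
    mass≥0 W c = *-nonNeg (product-mass-nonNeg {w = bernoulli-mass p} (λ { inside → p≥0 ; outside → diff≥0 p≤1 }) W)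
      (product-mass-nonNeg (λ _ → κ≥0) c)

  -- With `cur = E` there is no initial deficit, so `claim` bounds the failure probability by η.
  -- Raising the density from ρ to p κ only lowers it.
  rounds-Pr : ∀ {ρ η} → 0ℚ <ᵠ L → 0ℚ ≤ᵠ ρ → ρ ≤ᵠ p * κ → Rounds r ρ η → 1ℚ - η ≤ᵠ Pr-rainbow k p κ H
  rounds-Pr {ρ} {η} L>0 ρ′≥0 ρ≤pκ rounds = ℚₚ.≤-trans 1-η≤ 𝔼-covers≤Pr
    where
    avoids = λ Y → 𝟙 (avoids? E Y)
    covers = λ Y → 𝟙 (covers? E Y)

    small : All (λ F → ∣ F ∣ ≤ r) E
    small = All.tabulate (λ F∈E →
      let S , S∈H , c , _ , F≡ = rainbowEdges⁻ {k = k} H F∈E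
      in ℕₚ.≤-reflexive (trans (cong ∣_∣ F≡) (trans (∣graph∣ S c) (All.lookup uniform S∈H))))

    fail≤ : 𝔼 (p * κ) avoids ≤ᵠ η
    fail≤ = ℚₚ.≤-trans (𝔼-antitone-density {n ℕ.* k} ρ′≥0 ρ≤pκ ρ≤1 (avoids-antitone E))
      (*-cancelˡ L L>0 (ℚₚ.≤-trans (claim L>0 rounds (ℚₚ.≤-trans ρ≤pκ ρ≤1) (≼-refl E) small)
        (ℚₚ.≤-reflexive (solve 2 (λ l h → (l :- l) :+ h :* l := l :* h) refl L η))))

    total : 𝔼 (p * κ) avoids + 𝔼 (p * κ) covers ≡ 1ℚ
    total = trans (sym (𝔼-+ {n ℕ.* k} (p * κ) avoids covers))
      (trans (𝔼-cong {n ℕ.* k} (p * κ) (λ Y → one (covers? E Y))) (𝔼-const {n ℕ.* k} (p * κ) 1ℚ))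
      where
      one : ∀ {P : Set} (d : Dec P) → 𝟙 (¬? d) + 𝟙 d ≡ 1ℚ
      one (yes _) = refl
      one (no _)  = refl

    1-η≤ : 1ℚ - η ≤ᵠ 𝔼 (p * κ) covers
    1-η≤ = ≤-by (η - 𝔼 (p * κ) avoids) (diff≥0 fail≤)
      (trans (cong (λ z → (z - η) + (η - 𝔼 (p * κ) avoids)) (sym total))
        (solve 3 (λ a c h → ((a :+ c) :- h) :+ (h :- a) := c) refl (𝔼 (p * κ) avoids) (𝔼 (p * κ) covers) η))

-- Choice of the rounds. The round leading from r i to r (suc i) ≥ M, where M counts the remaining
-- levels, has vertex density (C q / 6) (1 + Λ 2 ^ (2 - M)): these densities sum to O(C q Λ), and
-- the corresponding losses 2 (30 / C) 2 ^ (2 - M) / Λ sum to O(1 / (C Λ)).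

1/6 : ℚ
1/6 = ℤ.+ 1 ℚ./ 6

module _ {n k s : ℕ} (H : Hypergraph n) (uniform : Uniform s H) (s≤k : s ≤ k)
         {κ : ℚ} (κ≥0 : 0ℚ ≤ᵠ κ) (kκ≡1 : ι k * κ ≡ 1ℚ) (k≥1 : 1ℚ ≤ᵠ ι k)
         {q iq C iC Λ iΛ : ℚ} (q≥0 : 0ℚ ≤ᵠ q) (q-inv : q * iq ≡ 1ℚ) (iq≥0 : 0ℚ ≤ᵠ iq)
         (C≥0 : 0ℚ ≤ᵠ C) (C-inv : C * iC ≡ 1ℚ) (iC>0 : 0ℚ <ᵠ iC) (iC≤ : iC ≤ᵠ ℤ.+ 1 ℚ./ 480)
         (Λ≥1 : 1ℚ ≤ᵠ Λ) (Λ-inv : Λ * iΛ ≡ 1ℚ) (iΛ>0 : 0ℚ <ᵠ iΛ) (CqΛ≤1 : C * q * Λ ≤ᵠ 1ℚ) where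

  open Sparsify (rainbowEdges k H) using (Rounds; last; step; Overlaps)

  SpreadAt : ℕ → ℕ → Set
  SpreadAt u t = ∀ A → Any (A ⊆_) H → ∣ A ∣ ≤ u → t ≤ ∣ A ∣ → ∀ j → t ≤ j → ι (meetingIn H A j) ≤ᵠ q ^ j * ι (length H)

  private
    iC≥0 = ℚₚ.<⇒≤ iC>0
    iΛ≥0 = ℚₚ.<⇒≤ iΛ>0
    Λ≥0 = ℚₚ.≤-trans 0≤1 Λ≥1
    Cq≥0 = *-nonNeg C≥0 q≥0

    iΛ≤1 : iΛ ≤ᵠ 1ℚ
    iΛ≤1 = ≤-by ((Λ - 1ℚ) * iΛ) (*-nonNeg (diff≥0 Λ≥1) iΛ≥0)
      (trans (solve 2 (λ l i → i :+ (l :- con 1ℚ) :* i := l :* i) refl Λ iΛ) Λ-inv)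

    -- A round of vertex density P = 1 / v
    module Round (P v : ℚ) (P≥0 : 0ℚ ≤ᵠ P) (P≤1 : P ≤ᵠ 1ℚ) (Pv≡1 : P * v ≡ 1ℚ) (v≥0 : 0ℚ ≤ᵠ v) where

      v≥1 : 1ℚ ≤ᵠ v
      v≥1 = ≤-by (v * (1ℚ - P)) (*-nonNeg v≥0 (diff≥0 P≤1))
        (trans (cong (_+ v * (1ℚ - P)) (sym Pv≡1)) (solve 2 (λ p v → p :* v :+ v :* (con 1ℚ :- p) := v) refl P v))

      a≥1 : 1ℚ ≤ᵠ ι k * v
      a≥1 = *-mono-≤-nonNeg (ι-nonNeg k) 0≤1 k≥1 v≥1

      ρ≥0 : 0ℚ ≤ᵠ P * κ
      ρ≥0 = *-nonNeg P≥0 κ≥0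

      ρa≡1 : P * κ * (ι k * v) ≡ 1ℚ
      ρa≡1 = trans (solve 4 (λ p κ k v → (p :* κ) :* (k :* v) := (p :* v) :* (k :* κ)) refl P κ (ι k) v)
        (cong₂ _*_ Pv≡1 kκ≡1)

  -- Half of the density is reserved for level 1. Then v = 2 / (C q Λ) and x = 5 v q = 10 / (C Λ),
  -- and the Chebyshev loss is 2 x.
  last-round : ∀ u → SpreadAt u 1 → ∃ λ η → Rounds u (½ * (C * q * Λ) * κ) η × η ≤ᵠ ι 20 * (iC * iΛ)
  last-round u spread = x ^ 1 + x ^ 1 , last ρ≥0 a≥1 ρa≡1 (+-nonNeg x^≥0 x^≥0) (rainbow-overlaps H uniform s≤k q≥0 v≥1 2x≤1 spread) ,
    ℚₚ.≤-reflexive 2x≡′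
    where
    P = ½ * (C * q * Λ)
    v = ι 2 * (iq * iC * iΛ)
    x = ι 5 * v * q
    P≥0 : 0ℚ ≤ᵠ P
    P≥0 = *-nonNeg (ℚₚ.nonNegative⁻¹ ½) (*-nonNeg Cq≥0 Λ≥0)
    P≤1 : P ≤ᵠ 1ℚ
    P≤1 = *-mono-≤-nonNeg 0≤1 (*-nonNeg Cq≥0 Λ≥0) (ℚₚ.≤ᵇ⇒≤ {½} {1ℚ} tt) CqΛ≤1
    v≥0 : 0ℚ ≤ᵠ v
    v≥0 = *-nonNeg (ι-nonNeg 2) (*-nonNeg (*-nonNeg iq≥0 iC≥0) iΛ≥0)
    Pv≡1 : P * v ≡ 1ℚ
    Pv≡1 = trans (solve 6 (λ C q l iC iq il → con ½ :* (C :* q :* l) :* (con (ι 2) :* (iq :* iC :* il)) := (C :* iC) :* (q :* iq) :* (l :* il))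
        refl C q Λ iC iq iΛ)
      (cong₂ _*_ (cong₂ _*_ C-inv q-inv) Λ-inv)
    open Round P v P≥0 P≤1 Pv≡1 v≥0
    x≡ : x ≡ ι 10 * (iC * iΛ)
    x≡ = trans (solve 4 (λ q iq iC il → con (ι 5) :* (con (ι 2) :* (iq :* iC :* il)) :* q := con (ι 10) :* (iC :* il) :* (q :* iq)) refl q iq iC iΛ)
      (trans (cong (ι 10 * (iC * iΛ) *_) q-inv) (ℚₚ.*-identityʳ _))
    x≥0 : 0ℚ ≤ᵠ x
    x≥0 = subst (0ℚ ≤ᵠ_) (sym x≡) (*-nonNeg (ι-nonNeg 10) (*-nonNeg iC≥0 iΛ≥0))
    x^≥0 = ^-nonNeg x≥0 1
    2x≡ : x + x ≡ ι 20 * (iC * iΛ)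
    2x≡ = trans (cong₂ _+_ x≡ x≡) (solve 1 (λ y → con (ι 10) :* y :+ con (ι 10) :* y := con (ι 20) :* y) refl (iC * iΛ))
    2x≡′ : x ^ 1 + x ^ 1 ≡ ι 20 * (iC * iΛ)
    2x≡′ = trans (cong₂ _+_ (ℚₚ.*-identityʳ x) (ℚₚ.*-identityʳ x)) 2x≡
    2x≤1 : x + x ≤ᵠ 1ℚ
    2x≤1 = subst (_≤ᵠ 1ℚ) (sym 2x≡) (ℚₚ.≤-trans
      (*-monoˡ (ι 20) (ι-nonNeg 20) (*-mono-≤-nonNeg (ℚₚ.nonNegative⁻¹ (ℤ.+ 1 ℚ./ 480)) iΛ≥0 iC≤ iΛ≤1))
      (ℚₚ.≤ᵇ⇒≤ tt))

  -- The loss of a round is of order x^(t / 2). With the flat share C q / 6 alone, x is 30 / C, so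
  -- for small `t` the loss could be of order 1 / C instead of 1 / (C Λ). The extra density Λ / 2^m
  -- cures this where few levels remain; with many levels left, `t ≥ m + 2` makes the power itself
  -- small.
  earlier-round : ∀ m u t {σ η} → suc (suc m) ≤ t → SpreadAt u t → 0ℚ ≤ᵠ σ → Rounds t σ η →
    Rounds u (1/6 * (C * q) * (1ℚ + Λ * ½ ^ m) * κ + σ) (ι 60 * (iC * iΛ) * ½ ^ m + η)
  earlier-round m u t m+2≤t spread σ≥0 rounds =
    step ρ≥0 a≥1 ρa≡1 σ≥0 (+-nonNeg (^-nonNeg x≥0 t) (^-nonNeg x≥0 t)) ε>0 δ≤ε² (rainbow-overlaps H uniform s≤k q≥0 v≥1 2x≤1 spread) rounds
    where
    h = ½ ^ m
    ½≥0 = ℚₚ.nonNegative⁻¹ ½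
    h>0 : ∀ m → 0ℚ <ᵠ ½ ^ m
    h>0 zero    = ℚₚ.positive⁻¹ 1ℚ
    h>0 (suc m) = *-pos (ℚₚ.positive⁻¹ ½) (h>0 m)
    h≥0 = ^-nonNeg ½≥0 m
    h≤1 : h ≤ᵠ 1ℚ
    h≤1 = ^-antitoneʳ {½} ½≥0 (ℚₚ.≤ᵇ⇒≤ tt) {0} {m} ℕ.z≤n
    g = 1ℚ + Λ * h
    Λh≥0 = *-nonNeg Λ≥0 h≥0
    g>0 : 0ℚ <ᵠ g
    g>0 = ℚₚ.+-mono-<-≤ (ℚₚ.positive⁻¹ 1ℚ) Λh≥0
    w = recip g g>0
    w≥0 = ℚₚ.<⇒≤ (recip-pos g g>0)
    gw≡1 = recip-inverse g g>0
    w≤1 : w ≤ᵠ 1ℚ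
    w≤1 = ≤-by (Λ * h * w) (*-nonNeg Λh≥0 w≥0) (trans (solve 2 (λ y w → w :+ y :* w := (con 1ℚ :+ y) :* w) refl (Λ * h) w) gw≡1)
    P = 1/6 * (C * q) * g
    v = ι 6 * (iq * iC * w)
    x = ι 5 * v * q
    P≥0 : 0ℚ ≤ᵠ P
    P≥0 = *-nonNeg (*-nonNeg (ℚₚ.nonNegative⁻¹ 1/6) Cq≥0) (ℚₚ.<⇒≤ g>0)
    g≤2Λ : g ≤ᵠ Λ + Λ
    g≤2Λ = ℚₚ.+-mono-≤ Λ≥1 (subst (Λ * h ≤ᵠ_) (ℚₚ.*-identityʳ Λ) (*-monoˡ Λ Λ≥0 h≤1))
    P≤1 : P ≤ᵠ 1ℚ
    P≤1 = ℚₚ.≤-trans (*-monoˡ (1/6 * (C * q)) (*-nonNeg (ℚₚ.nonNegative⁻¹ 1/6) Cq≥0) g≤2Λ)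
      (ℚₚ.≤-trans (ℚₚ.≤-reflexive (solve 2 (λ y l → con 1/6 :* y :* (l :+ l) := con (ℤ.+ 1 ℚ./ 3) :* (y :* l)) refl (C * q) Λ))
        (*-mono-≤-nonNeg 0≤1 (*-nonNeg Cq≥0 Λ≥0) (ℚₚ.≤ᵇ⇒≤ {ℤ.+ 1 ℚ./ 3} {1ℚ} tt) CqΛ≤1))
    v≥0 : 0ℚ ≤ᵠ v
    v≥0 = *-nonNeg (ι-nonNeg 6) (*-nonNeg (*-nonNeg iq≥0 iC≥0) w≥0)
    Pv≡1 : P * v ≡ 1ℚ
    Pv≡1 = trans (solve 6 (λ C q g iC iq w → con 1/6 :* (C :* q) :* g :* (con (ι 6) :* (iq :* iC :* w)) := (C :* iC) :* (q :* iq) :* (g :* w))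
        refl C q g iC iq w)
      (cong₂ _*_ (cong₂ _*_ C-inv q-inv) gw≡1)
    open Round P v P≥0 P≤1 Pv≡1 v≥0
    x≡ : x ≡ ι 30 * (iC * w)
    x≡ = trans (solve 4 (λ q iq iC w → con (ι 5) :* (con (ι 6) :* (iq :* iC :* w)) :* q := con (ι 30) :* (iC :* w) :* (q :* iq)) refl q iq iC w)
      (trans (cong (ι 30 * (iC * w) *_) q-inv) (ℚₚ.*-identityʳ _))
    x≥0 : 0ℚ ≤ᵠ x
    x≥0 = subst (0ℚ ≤ᵠ_) (sym x≡) (*-nonNeg (ι-nonNeg 30) (*-nonNeg iC≥0 w≥0))
    -- From C ≥ 480 and x ≤ 30 / C. The value is a fourth power, so that x^m ≤ h⁴ with h = 2^(-m).
    1/16 = ½ * ½ * (½ * ½)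
    x≤1/16 : x ≤ᵠ 1/16
    x≤1/16 = subst (_≤ᵠ 1/16) (sym x≡) (ℚₚ.≤-trans
      (*-monoˡ (ι 30) (ι-nonNeg 30) (*-mono-≤-nonNeg (ℚₚ.nonNegative⁻¹ (ℤ.+ 1 ℚ./ 480)) w≥0 iC≤ w≤1))
      (ℚₚ.≤ᵇ⇒≤ tt))
    2x≤1 : x + x ≤ᵠ 1ℚ
    2x≤1 = ℚₚ.≤-trans (ℚₚ.+-mono-≤ x≤1/16 x≤1/16) (ℚₚ.≤ᵇ⇒≤ tt)
    y = ι 30 * (iC * iΛ)
    y≥0 : 0ℚ ≤ᵠ y
    y≥0 = *-nonNeg (ι-nonNeg 30) (*-nonNeg iC≥0 iΛ≥0)
    ε = ι 60 * (iC * iΛ) * h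
    ε>0 : 0ℚ <ᵠ ε
    ε>0 = *-pos (*-pos (ℚₚ.positive⁻¹ (ι 60)) (*-pos iC>0 iΛ>0)) (h>0 m)
    wh≤iΛ : w * h ≤ᵠ iΛ
    wh≤iΛ = ≤-by (iΛ * w) (*-nonNeg iΛ≥0 w≥0) (trans
      (cong (_+ iΛ * w) (trans (sym (ℚₚ.*-identityˡ (w * h))) (cong (_* (w * h)) (sym Λ-inv))))
      (trans (solve 4 (λ l i w h → (l :* i) :* (w :* h) :+ i :* w := i :* ((con 1ℚ :+ l :* h) :* w)) refl Λ iΛ w h)
        (trans (cong (iΛ *_) gw≡1) (ℚₚ.*-identityʳ iΛ))) )
    xh≤y : x * h ≤ᵠ y
    xh≤y = ℚₚ.≤-trans (ℚₚ.≤-reflexive (trans (cong (_* h) x≡) (solve 3 (λ c w h → con (ι 30) :* (c :* w) :* h := con (ι 30) :* (c :* (w :* h))) refl iC w h)))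
      (*-monoˡ (ι 30) (ι-nonNeg 30) (*-monoˡ iC iC≥0 wh≤iΛ))
    -- Of the four factors h in x² h⁴, two turn x² into y² by x h ≤ y, which rests on g ≥ Λ h. The
    -- other two give the geometric decay in m.
    x^t≤ : x ^ t ≤ᵠ (y * h) * (y * h)
    x^t≤ = ℚₚ.≤-trans (^-antitoneʳ x≥0 (ℚₚ.≤-trans x≤1/16 (ℚₚ.≤ᵇ⇒≤ tt)) m+2≤t)
      (ℚₚ.≤-trans (*-monoˡ x x≥0 (*-monoˡ x x≥0 (ℚₚ.≤-trans (^-monoˡ x≥0 x≤1/16 m)
          (ℚₚ.≤-reflexive (trans (^-distrib-* (½ * ½) (½ * ½) m) (cong₂ _*_ (^-distrib-* ½ ½ m) (^-distrib-* ½ ½ m)))))))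
        (ℚₚ.≤-trans (ℚₚ.≤-reflexive (solve 2 (λ x h → x :* (x :* (h :* h :* (h :* h))) := (x :* h :* h) :* (x :* h :* h)) refl x h))
          (*-mono-≤-nonNeg (*-nonNeg y≥0 h≥0) (*-nonNeg (*-nonNeg x≥0 h≥0) h≥0)
            (*-monoʳ h h≥0 xh≤y) (*-monoʳ h h≥0 xh≤y))))
    δ≤ε² : x ^ t + x ^ t ≤ᵠ ε * ε
    δ≤ε² = ℚₚ.≤-trans (ℚₚ.+-mono-≤ x^t≤ x^t≤)
      (≤-by ((y * h) * (y * h) + (y * h) * (y * h)) (+-nonNeg yh²≥0 yh²≥0)
        (solve 2 (λ z h → ((con (ι 30) :* z :* h) :* (con (ι 30) :* z :* h) :+ (con (ι 30) :* z :* h) :* (con (ι 30) :* z :* h))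
            :+ ((con (ι 30) :* z :* h) :* (con (ι 30) :* z :* h) :+ (con (ι 30) :* z :* h) :* (con (ι 30) :* z :* h))
            := (con (ι 60) :* z :* h) :* (con (ι 60) :* z :* h)) refl (iC * iΛ) h))
      where yh²≥0 = square-nonNeg (y * h)

  -- The expression 2 - 2 · 2^(-m) is the geometric sum of 2^(-i) over i < m. Strict decrease down
  -- to 1 forces the first of m + 2 levels to be at least m + 2 (`long`), which supplies the
  -- exponent needed by `earlier-round`.
  rounds : ∀ m (r : Fin (suc (suc m)) → ℕ) → (∀ i → r (suc i) ℕ.< r (inject₁ i)) → r (lastFin (suc m)) ≡ 1 →
    (∀ i → SpreadAt (r (inject₁ i)) (r (suc i))) →
    ∃ λ ρ → ∃ λ η → Rounds (r zero) ρ η × 0ℚ ≤ᵠ ρ ×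
      ρ ≤ᵠ (½ * (C * q * Λ) + 1/6 * (C * q) * (ι m + Λ * (ι 2 - ι 2 * ½ ^ m))) * κ ×
      η ≤ᵠ ι 20 * (iC * iΛ) + ι 60 * (iC * iΛ) * (ι 2 - ι 2 * ½ ^ m)
  rounds zero r dec last≡1 spread =
    let η , R , η≤ = last-round (r zero) (subst (SpreadAt (r zero)) last≡1 (spread zero))
    in ½ * (C * q * Λ) * κ , η , R , *-nonNeg (*-nonNeg (ℚₚ.nonNegative⁻¹ ½) (*-nonNeg Cq≥0 Λ≥0)) κ≥0 ,
      ℚₚ.≤-reflexive (solve 3 (λ y l κ → con ½ :* (y :* l) :* κ
        := (con ½ :* (y :* l) :+ con 1/6 :* y :* (con 0ℚ :+ l :* (con (ι 2) :- con (ι 2) :* con 1ℚ))) :* κ) refl (C * q) Λ κ) ,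
      ℚₚ.≤-trans η≤ (ℚₚ.≤-reflexive (solve 1 (λ z → con (ι 20) :* z
        := con (ι 20) :* z :+ con (ι 60) :* z :* (con (ι 2) :- con (ι 2) :* con 1ℚ)) refl (iC * iΛ)))
  rounds (suc m) r dec last≡1 spread =
    let ρ , η , R , ρ≥0 , ρ≤ , η≤ = rounds m (r ∘ suc) (dec ∘ suc) last≡1 (spread ∘ suc)
    in _ , _ , earlier-round m (r zero) (r (suc zero)) (long m (r ∘ suc) (dec ∘ suc) last≡1) (spread zero) ρ≥0 R ,
      +-nonNeg (*-nonNeg (*-nonNeg (*-nonNeg (ℚₚ.nonNegative⁻¹ 1/6) Cq≥0) (+-nonNeg 0≤1 (*-nonNeg Λ≥0 (^-nonNeg (ℚₚ.nonNegative⁻¹ ½) m)))) κ≥0) ρ≥0 ,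
      ℚₚ.≤-trans (ℚₚ.+-monoʳ-≤ (1/6 * (C * q) * (1ℚ + Λ * ½ ^ m) * κ) ρ≤) (ℚₚ.≤-reflexive (solve 5 (λ y l κ m h →
          con 1/6 :* y :* (con 1ℚ :+ l :* h) :* κ :+ (con ½ :* (y :* l) :+ con 1/6 :* y :* (m :+ l :* (con (ι 2) :- con (ι 2) :* h))) :* κ
          := (con ½ :* (y :* l) :+ con 1/6 :* y :* ((con 1ℚ :+ m) :+ l :* (con (ι 2) :- con (ι 2) :* (con ½ :* h)))) :* κ)
        refl (C * q) Λ κ (ι m) (½ ^ m))) ,
      ℚₚ.≤-trans (ℚₚ.+-monoʳ-≤ (ι 60 * (iC * iΛ) * ½ ^ m) η≤) (ℚₚ.≤-reflexive (solve 2 (λ z h →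
          con (ι 60) :* z :* h :+ (con (ι 20) :* z :+ con (ι 60) :* z :* (con (ι 2) :- con (ι 2) :* h))
          := con (ι 20) :* z :+ con (ι 60) :* z :* (con (ι 2) :- con (ι 2) :* (con ½ :* h))) refl (iC * iΛ) (½ ^ m)))
    where
    long : ∀ m (r : Fin (suc (suc m)) → ℕ) → (∀ i → r (suc i) ℕ.< r (inject₁ i)) → r (lastFin (suc m)) ≡ 1 → suc (suc m) ≤ r zero
    long zero    r dec eq = subst (ℕ._< r zero) eq (dec zero)
    long (suc m) r dec eq = ℕₚ.≤-trans (ℕ.s≤s (long m (r ∘ suc) (dec ∘ suc) eq)) (dec zero)

rational-theorem : ∀ {n m k} (H : Hypergraph n) (r : Fin (suc (suc m)) → ℕ) {p κ q iq C iC iΛ : ℚ} →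
  Uniform (r zero) H → 0 ℕ.< length H → (∀ i → r (suc i) ℕ.< r (inject₁ i)) → r (lastFin (suc m)) ≡ 1 →
  (∀ i A → Any (A ⊆_) H → ∣ A ∣ ≤ r (inject₁ i) → r (suc i) ≤ ∣ A ∣ → ∀ j → r (suc i) ≤ j →
    ι (meetingIn H A j) ≤ᵠ q ^ j * ι (length H)) →
  r zero ≤ suc k → p ≤ᵠ 1ℚ → 0ℚ ≤ᵠ κ → ι (suc k) * κ ≡ 1ℚ → 0ℚ ≤ᵠ q → q * iq ≡ 1ℚ → 0ℚ ≤ᵠ iq →
  0ℚ ≤ᵠ C → C * iC ≡ 1ℚ → 0ℚ <ᵠ iC → iC ≤ᵠ ℤ.+ 1 ℚ./ 480 →
  ι (suc (suc m)) * iΛ ≡ 1ℚ → 0ℚ <ᵠ iΛ → C * q * ι (suc (suc m)) ≤ᵠ p →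
  1ℚ - (ℤ.+ 140 ℚ./ 1) * (iC * iΛ) ≤ᵠ Pr-rainbow (suc k) p κ H
rational-theorem {n} {m} {k} H r {p} {κ} {q} {iq} {C} {iC} {iΛ} uniform H>0 dec last≡1 spread r≤k p≤1 κ≥0 kκ≡1
  q≥0 q-inv iq≥0 C≥0 C-inv iC>0 iC≤ Λ-inv iΛ>0 CqΛ≤p =
  let ρ , η , R , ρ≥0 , ρ≤ , η≤ = rounds H uniform r≤k κ≥0 kκ≡1 k≥1 q≥0 q-inv iq≥0 C≥0 C-inv iC>0 iC≤ Λ≥1 Λ-inv iΛ>0
        (ℚₚ.≤-trans CqΛ≤p p≤1) m r dec last≡1 spread
  in ℚₚ.≤-trans (ℚₚ.+-monoʳ-≤ 1ℚ (ℚₚ.neg-antimono-≤ (ℚₚ.≤-trans η≤ η-total)))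
       (rounds-Pr H uniform p≥0 p≤1 κ≥0 κ≤1 kκ≡1 L>0 ρ≥0 (ℚₚ.≤-trans ρ≤ (*-monoʳ κ κ≥0 (ℚₚ.≤-trans ρ-total CqΛ≤p))) R)
  where
  Λ = ι (suc (suc m))
  k≥1 : 1ℚ ≤ᵠ ι (suc k)
  k≥1 = ≤-by (ι k) (ι-nonNeg k) refl
  Λ≥1 : 1ℚ ≤ᵠ Λ
  Λ≥1 = ≤-by (ι (suc m)) (ι-nonNeg (suc m)) refl
  Λ≥0 = ι-nonNeg (suc (suc m))
  Cq≥0 = *-nonNeg C≥0 q≥0
  p≥0 : 0ℚ ≤ᵠ p
  p≥0 = ℚₚ.≤-trans (*-nonNeg Cq≥0 Λ≥0) CqΛ≤p
  κ≤1 : κ ≤ᵠ 1ℚ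
  κ≤1 = ≤-by (ι k * κ) (*-nonNeg (ι-nonNeg k) κ≥0)
    (trans (solve 2 (λ κ k → κ :+ k :* κ := (con 1ℚ :+ k) :* κ) refl κ (ι k)) kκ≡1)
  h≥0 = ^-nonNeg (ℚₚ.nonNegative⁻¹ ½) m
  Z≥0 = *-nonNeg (ℚₚ.<⇒≤ iC>0) (ℚₚ.<⇒≤ iΛ>0)

  -- 140 = 20 + 2 · 60: the last round plus the full geometric series.
  η-total : ι 20 * (iC * iΛ) + ι 60 * (iC * iΛ) * (ι 2 - ι 2 * ½ ^ m) ≤ᵠ (ℤ.+ 140 ℚ./ 1) * (iC * iΛ)
  η-total = ≤-by (ι 120 * (iC * iΛ) * ½ ^ m) (*-nonNeg (*-nonNeg (ι-nonNeg 120) Z≥0) h≥0)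
    (solve 2 (λ z h → (con (ι 20) :* z :+ con (ι 60) :* z :* (con (ι 2) :- con (ι 2) :* h)) :+ con (ι 120) :* z :* h
      := con (ℤ.+ 140 ℚ./ 1) :* z) refl (iC * iΛ) (½ ^ m))

  -- The weights ½ and 1/6 are chosen so that 1/2 + 1/6 + 2/6 = 1: the last round, the flat shares
  -- and the geometric shares.
  ρ-total : ½ * (C * q * Λ) + 1/6 * (C * q) * (ι m + Λ * (ι 2 - ι 2 * ½ ^ m)) ≤ᵠ C * q * Λ
  ρ-total = ≤-by (1/6 * (C * q) * (ι 2 + Λ * (ι 2 * ½ ^ m)))
    (*-nonNeg (*-nonNeg (ℚₚ.nonNegative⁻¹ 1/6) Cq≥0) (+-nonNeg (ι-nonNeg 2) (*-nonNeg Λ≥0 (*-nonNeg (ι-nonNeg 2) h≥0))))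
    (solve 3 (λ y m h → (con ½ :* (y :* (con 1ℚ :+ (con 1ℚ :+ m))) :+ con 1/6 :* y :* (m :+ (con 1ℚ :+ (con 1ℚ :+ m)) :* (con (ι 2) :- con (ι 2) :* h)))
        :+ con 1/6 :* y :* (con (ι 2) :+ (con 1ℚ :+ (con 1ℚ :+ m)) :* (con (ι 2) :* h))
        := y :* (con 1ℚ :+ (con 1ℚ :+ m))) refl (C * q) (ι m) (½ ^ m))

  ι^-pos : ∀ e → 0ℚ <ᵠ ι (suc k) ^ e
  ι^-pos zero    = ℚₚ.positive⁻¹ 1ℚ
  ι^-pos (suc e) = *-pos (ι-pos {suc k} (ℕ.s≤s ℕ.z≤n)) (ι^-pos e)

  L>0 : 0ℚ <ᵠ ι (length (rainbowEdges (suc k) H))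
  L>0 = subst (0ℚ <ᵠ_) (sym (length-rainbowEdges {k = suc k} H uniform (Vec.replicate n zero)))
    (*-pos (ι-pos H>0) (*-pos (ι-pos (falling-pos (suc k) (r zero) r≤k)) (ι^-pos (n ℕ.∸ r zero))))

-- Continuity at p = 1

-- The estimate is one-sided and restricted to [1, 2]: only terms exceeding 1 need correction, and x
-- - 1 ≤ 1 lets the quadratic term of a product be absorbed into the linear one.
record Lipschitz (F : ℚ → ℚ) : Set where
  field
    rate        : ℚ
    rate-nonNeg : 0ℚ ≤ᵠ rate
    close       : ∀ x → 1ℚ ≤ᵠ x → x - 1ℚ ≤ᵠ 1ℚ → ℚ.∣ F x - F 1ℚ ∣ ≤ᵠ rate * (x - 1ℚ)

open Lipschitz

lipschitz-const : ∀ a → Lipschitz (λ _ → a)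
lipschitz-const a = record
  { rate        = 0ℚ
  ; rate-nonNeg = ℚₚ.≤-refl
  ; close       = λ x _ _ → ℚₚ.≤-reflexive (trans (cong ℚ.∣_∣ (ℚₚ.+-inverseʳ a)) (sym (ℚₚ.*-zeroˡ (x - 1ℚ))))
  }

lipschitz-+ : ∀ {F G} → Lipschitz F → Lipschitz G → Lipschitz (λ x → F x + G x)
lipschitz-+ {F} {G} lF lG = record
  { rate        = rate lF + rate lG
  ; rate-nonNeg = +-nonNeg (rate-nonNeg lF) (rate-nonNeg lG)
  ; close       = λ x x≥1 x≤2 → subst₂ _≤ᵠ_
      (cong ℚ.∣_∣ (solve 4 (λ a b c d → (a :- c) :+ (b :- d) := (a :+ b) :- (c :+ d)) refl (F x) (G x) (F 1ℚ) (G 1ℚ)))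
      (sym (ℚₚ.*-distribʳ-+ (x - 1ℚ) (rate lF) (rate lG)))
      (ℚₚ.≤-trans (ℚₚ.∣p+q∣≤∣p∣+∣q∣ (F x - F 1ℚ) (G x - G 1ℚ))
        (ℚₚ.+-mono-≤ (close lF x x≥1 x≤2) (close lG x x≥1 x≤2)))
  }

lipschitz-* : ∀ {F G} → Lipschitz F → Lipschitz G → Lipschitz (λ x → F x * G x)
lipschitz-* {F} {G} lF lG = record
  { rate        = rate lF * rate lG + (rate lF * g + f * rate lG)
  ; rate-nonNeg = +-nonNeg (*-nonNeg (rate-nonNeg lF) (rate-nonNeg lG))
      (+-nonNeg (*-nonNeg (rate-nonNeg lF) (abs-nonNeg (G 1ℚ))) (*-nonNeg (abs-nonNeg (F 1ℚ)) (rate-nonNeg lG)))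
  ; close       = λ x x≥1 x≤2 →
      let y    = x - 1ℚ
          y≥0  = diff≥0 x≥1
          dF   = F x - F 1ℚ
          dG   = G x - G 1ℚ
          dF≤  = close lF x x≥1 x≤2
          dG≤  = close lG x x≥1 x≤2
          Fy≥0 = *-nonNeg (rate-nonNeg lF) y≥0
          Gy≥0 = *-nonNeg (rate-nonNeg lG) y≥0
          abs* = ℚₚ.∣p*q∣≡∣p∣*∣q∣
      in ℚₚ.≤-trans
        (ℚₚ.≤-reflexive (cong ℚ.∣_∣ (solve 4 (λ a b c d → a :* b :- c :* d
          := (a :- c) :* (b :- d) :+ ((a :- c) :* d :+ c :* (b :- d))) refl (F x) (G x) (F 1ℚ) (G 1ℚ))))
        (ℚₚ.≤-trans (ℚₚ.∣p+q∣≤∣p∣+∣q∣ (dF * dG) (dF * G 1ℚ + F 1ℚ * dG))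
          (ℚₚ.≤-trans (ℚₚ.+-mono-≤
              (ℚₚ.≤-trans (ℚₚ.≤-reflexive (abs* dF dG)) (ℚₚ.≤-trans
                (*-mono-≤-nonNeg Fy≥0 (abs-nonNeg dG) dF≤ dG≤)
                (≤-by (rate lF * rate lG * y * (1ℚ - y))
                  (*-nonNeg (*-nonNeg (*-nonNeg (rate-nonNeg lF) (rate-nonNeg lG)) y≥0) (diff≥0 x≤2))
                  (solve 3 (λ a b y → a :* y :* (b :* y) :+ a :* b :* y :* (con 1ℚ :- y) := a :* b :* y) refl (rate lF) (rate lG) y))))
              (ℚₚ.≤-trans (ℚₚ.∣p+q∣≤∣p∣+∣q∣ (dF * G 1ℚ) (F 1ℚ * dG)) (ℚₚ.+-mono-≤
                (ℚₚ.≤-trans (ℚₚ.≤-reflexive (abs* dF (G 1ℚ))) (*-monoʳ g (abs-nonNeg (G 1ℚ)) dF≤))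
                (ℚₚ.≤-trans (ℚₚ.≤-reflexive (abs* (F 1ℚ) dG)) (*-monoˡ f (abs-nonNeg (F 1ℚ)) dG≤)))))
            (ℚₚ.≤-reflexive (solve 5 (λ a b f g y → a :* b :* y :+ (a :* y :* g :+ f :* (b :* y))
              := (a :* b :+ (a :* g :+ f :* b)) :* y) refl (rate lF) (rate lG) f g y))))
  }
  where
  f = ℚ.∣ F 1ℚ ∣
  g = ℚ.∣ G 1ℚ ∣

lipschitz-bernoulli : ∀ s → Lipschitz (λ p → bernoulli-mass p s)
lipschitz-bernoulli inside = record
  { rate = 1ℚ ; rate-nonNeg = 0≤1
  ; close = λ x x≥1 _ → ℚₚ.≤-reflexive (trans (ℚₚ.0≤p⇒∣p∣≡p (diff≥0 x≥1)) (sym (ℚₚ.*-identityˡ (x - 1ℚ)))) }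
lipschitz-bernoulli outside = record
  { rate = 1ℚ ; rate-nonNeg = 0≤1
  ; close = λ x x≥1 _ → ℚₚ.≤-reflexive (trans (cong ℚ.∣_∣ (solve 1 (λ x → (con 1ℚ :- x) :- (con 1ℚ :- con 1ℚ) := :- (x :- con 1ℚ)) refl x))
      (trans (ℚₚ.∣-p∣≡∣p∣ (x - 1ℚ)) (trans (ℚₚ.0≤p⇒∣p∣≡p (diff≥0 x≥1)) (sym (ℚₚ.*-identityˡ (x - 1ℚ)))))) }

lipschitz-product : ∀ {n} (W : Subset n) → Lipschitz (λ p → product-mass (bernoulli-mass p) W)
lipschitz-product []      = lipschitz-const 1ℚ
lipschitz-product (s ∷ W) = lipschitz-* (lipschitz-bernoulli s) (lipschitz-product W)

lipschitz-∑ : ∀ {A : Set} (xs : List A) {F : A → ℚ → ℚ} → (∀ x → Lipschitz (F x)) → Lipschitz (λ p → ∑ xs (λ x → F x p))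
lipschitz-∑ []       l = lipschitz-const 0ℚ
lipschitz-∑ (x ∷ xs) l = lipschitz-+ (l x) (lipschitz-∑ xs l)

lipschitz-Pr : ∀ {n} k κ (H : Hypergraph n) → Lipschitz (λ p → Pr-rainbow k p κ H)
lipschitz-Pr {n} k κ H = lipschitz-∑ (outcomes k n) (λ (W , c) →
  lipschitz-* (lipschitz-const (𝟙 (containsRainbowEdge? H (W , c))))
    (lipschitz-* (lipschitz-product W) (lipschitz-const (product-mass (λ _ → κ) c))))

-- Passage to the reals

seq-^ : ∀ x j i → seq (x ^ℝ j) i ≡ seq x i ^ j
seq-^ x zero    i = refl
seq-^ x (suc j) i = cong (seq x i *_) (seq-^ x j i)

seq-∑ : ∀ {A : Set} (f : A → ℝ) xs i → seq (sumℝ (List.map f xs)) i ≡ ∑ xs (λ x → seq (f x) i)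
seq-∑ f []       i = refl
seq-∑ f (x ∷ xs) i = cong (seq (f x) i +_) (seq-∑ f xs i)

seq-bernoulli : ∀ p {n} (W : Subset n) i →
  seq (productMass (bernoulliMass p) W) i ≡ product-mass (bernoulli-mass (seq p i)) W
seq-bernoulli p []            i = refl
seq-bernoulli p (inside ∷ W)  i = cong (seq p i *_) (seq-bernoulli p W i)
seq-bernoulli p (outside ∷ W) i = cong ((1ℚ - seq p i) *_) (seq-bernoulli p W i)

-- The sequence of 1 / k is constant, so its term at 0 represents it at every index.
colorMass : ℕ → ℚ
colorMass k = seq (inv (fromℕ (suc k)) (fromℕ-pos (suc k))) 0

seq-uniform : ∀ {k n} (c : Vec (Fin (suc k)) n) i →
  seq (productMass (uniformMass (suc k)) c) i ≡ product-mass (λ _ → colorMass k) c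
seq-uniform         []      i = refl
seq-uniform {k = k} (a ∷ c) i = cong (colorMass k *_) (seq-uniform c i)

seq-Pr : ∀ {k n} p (H : Hypergraph n) i →
  seq (Pr {suc k} p (containsRainbowEdge? H)) i ≡ Pr-rainbow (suc k) (seq p i) (colorMass k) H
seq-Pr {k} {n} p H i = trans (seq-∑ (mass p) (filter (containsRainbowEdge? H) (outcomes (suc k) n)) i)
  (trans (∑-filter (containsRainbowEdge? H) (outcomes (suc k) n) _)
    (∑-cong (outcomes (suc k) n) (λ (W , c) → cong (𝟙 (containsRainbowEdge? H (W , c)) *_)
      (cong₂ _*_ (seq-bernoulli p W i) (seq-uniform c i)))))

inv-inverse : ∀ x (x>0 : 0ℝ <ℝ x) → ∃ λ N → ∀ i → N ≤ i → seq x i * seq (inv x x>0) i ≡ 1ℚ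
inv-inverse x (mk< c c>0 (N , c≤x)) = N , λ i i≥N →
  subst (λ z → z * recip (c ℚ.⊔ seq x i) (<-⊔ (seq x i) c>0) ≡ 1ℚ)
    (ℚₚ.p≤q⇒p⊔q≡q (subst (_≤ᵠ seq x i) (ℚₚ.+-identityˡ c) (c≤x i i≥N)))
    (recip-inverse (c ℚ.⊔ seq x i) (<-⊔ (seq x i) c>0))

inv-pos : ∀ x (x>0 : 0ℝ <ℝ x) i → 0ℚ <ᵠ seq (inv x x>0) i
inv-pos x (mk< c c>0 _) i = recip-pos (c ℚ.⊔ seq x i) (<-⊔ (seq x i) c>0)

colorMass-inverse : ∀ k → ι (suc k) * colorMass k ≡ 1ℚ
colorMass-inverse k = trans (cong (_* colorMass k) (ι≡/1 (suc k)))
  (proj₂ (inv-inverse (fromℕ (suc k)) (fromℕ-pos (suc k))) 0 ℕ.z≤n)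

colorMass-nonNeg : ∀ k → 0ℚ ≤ᵠ colorMass k
colorMass-nonNeg k = ℚₚ.<⇒≤ (inv-pos (fromℕ (suc k)) (fromℕ-pos (suc k)) 0)

≤-+ε : ∀ {x y} → (∀ ε → 0ℚ <ᵠ ε → x ≤ᵠ y + ε) → x ≤ᵠ y
≤-+ε {x} {y} le with x ℚₚ.≤? y
... | yes x≤y = x≤y
... | no  x≰y = ⊥-elim (ℚₚ.<-irrefl refl (ℚₚ.≤-<-trans (le ε ε>0) mid<x))
  where
  d>0 : 0ℚ <ᵠ x - y
  d>0 = subst (_<ᵠ x - y) (ℚₚ.+-inverseʳ y) (ℚₚ.+-monoˡ-< (- y) (ℚₚ.≰⇒> x≰y))
  ε = ½ * (x - y)
  ε>0 = half-pos d>0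
  mid<x : y + ε <ᵠ x
  mid<x = subst (y + ε <ᵠ_) (solve 2 (λ x y → (y :+ con ½ :* (x :- y)) :+ con ½ :* (x :- y) := x) refl x y)
    (subst (_<ᵠ y + ε + ε) (ℚₚ.+-identityʳ (y + ε)) (ℚₚ.+-monoʳ-< (y + ε) ε>0))

p≤∣p∣ : ∀ a → a ≤ᵠ ℚ.∣ a ∣
p≤∣p∣ a with ℚₚ.≤-total 0ℚ a
... | inj₁ a≥0 = ℚₚ.≤-reflexive (sym (ℚₚ.0≤p⇒∣p∣≡p a≥0))
... | inj₂ a≤0 = ℚₚ.≤-trans a≤0 (abs-nonNeg a)

max≤⇒All≤ : ∀ Ns {i} → List.foldr ℕ._⊔_ 0 Ns ≤ i → All (_≤ i) Ns
max≤⇒All≤ []       _  = []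
max≤⇒All≤ (N ∷ Ns) le = ℕₚ.m⊔n≤o⇒m≤o N _ le ∷ max≤⇒All≤ Ns (ℕₚ.m⊔n≤o⇒n≤o N _ le)

-- The terms pᵢ of a real p ≤ 1 may exceed 1; then the goal at p′ = 1 is transferred to pᵢ by continuity.
clamp : ∀ {ε x pᵢ} {F : ℚ → ℚ} → 0ℚ <ᵠ ε → (lip : Lipschitz F) (D>0 : 0ℚ <ᵠ 1ℚ + rate lip) →
  pᵢ ≤ᵠ 1ℚ + 1ℚ → pᵢ ≤ᵠ 1ℚ + ε * recip (1ℚ + rate lip) D>0 →
  (∀ p′ → p′ ≤ᵠ 1ℚ → pᵢ ≤ᵠ p′ ⊎ 1ℚ ≤ᵠ p′ → x ≤ᵠ F p′) → x ≤ᵠ F pᵢ + ε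
clamp {ε} {x} {pᵢ} {F} ε>0 lip D>0 p≤2 p≤1+ε′ goal with ℚₚ.≤-total pᵢ 1ℚ
... | inj₁ pᵢ≤1 = ℚₚ.≤-trans (goal pᵢ pᵢ≤1 (inj₁ ℚₚ.≤-refl)) (≤-by ε (ℚₚ.<⇒≤ ε>0) refl)
... | inj₂ 1≤pᵢ = ℚₚ.≤-trans (goal 1ℚ ℚₚ.≤-refl (inj₂ ℚₚ.≤-refl))
  (≤-by (ε - ℚ.∣ F pᵢ - F 1ℚ ∣ + (ℚ.∣ F pᵢ - F 1ℚ ∣ - (- (F pᵢ - F 1ℚ)))) (+-nonNeg (diff≥0 close≤ε)
      (diff≥0 (subst (- (F pᵢ - F 1ℚ) ≤ᵠ_) (ℚₚ.∣-p∣≡∣p∣ (F pᵢ - F 1ℚ)) (p≤∣p∣ (- (F pᵢ - F 1ℚ))))))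
    (solve 4 (λ e a f g → g :+ (e :- a :+ (a :- (:- (f :- g)))) := f :+ e) refl ε ℚ.∣ F pᵢ - F 1ℚ ∣ (F pᵢ) (F 1ℚ)))
  where
  R = recip (1ℚ + rate lip) D>0
  sub1 : ∀ {z} → pᵢ ≤ᵠ 1ℚ + z → pᵢ - 1ℚ ≤ᵠ z
  sub1 {z} le = ≤-by (1ℚ + z - pᵢ) (diff≥0 le) (solve 2 (λ p z → (p :- con 1ℚ) :+ (con 1ℚ :+ z :- p) := z) refl pᵢ z)
  close≤ε : ℚ.∣ F pᵢ - F 1ℚ ∣ ≤ᵠ ε
  close≤ε = ℚₚ.≤-trans (close lip pᵢ 1≤pᵢ (sub1 p≤2))
    (ℚₚ.≤-trans (*-monoˡ (rate lip) (rate-nonNeg lip) (sub1 p≤1+ε′))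
      (≤-by (ε * R) (*-nonNeg (ℚₚ.<⇒≤ ε>0) (ℚₚ.<⇒≤ (recip-pos (1ℚ + rate lip) D>0)))
        (trans (solve 3 (λ d e r → d :* (e :* r) :+ e :* r := e :* ((con 1ℚ :+ d) :* r)) refl (rate lip) ε R)
          (trans (cong (ε *_) (recip-inverse (1ℚ + rate lip) D>0)) (ℚₚ.*-identityʳ ε)))))

-- A loss of one unit in the limit must leave `K₀ - 1ℚ` at least 3840 = 8 · 480, for the rounds run
-- with an eighth of C. Their loss 140 becomes 8 · 140 = 1120, also below `K₀`.
K₀ 1/8 1/480 : ℚ
K₀ = ℤ.+ 4000 ℚ./ 1
1/8 = ℤ.+ 1 ℚ./ 8
1/480 = ℤ.+ 1 ℚ./ 480

module _ {n m k : ℕ} (H : Hypergraph n) (r : Fin (suc (suc m)) → ℕ) (κ : ℝ) (κ>0 : 0ℝ <ℝ κ)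
         (uniform : Uniform (r zero) H) (sp : Spread (inv κ κ>0) r H) (last≡1 : r (lastFin (suc m)) ≡ 1)
         (r≤k : r zero ≤ suc k) where

  open Spread sp

  private
    q = inv κ κ>0
    Λ = ι (suc (suc m))

    Λ≡ : Λ ≡ ℤ.+ suc (suc m) ℚ./ 1
    Λ≡ = ι≡/1 (suc (suc m))

    Λ≥1 : 1ℚ ≤ᵠ Λ
    Λ≥1 = ≤-by (ι (suc m)) (ι-nonNeg (suc m)) refl

    Λ>0 : 0ℚ <ᵠ Λ
    Λ>0 = ℚₚ.<-≤-trans (ℚₚ.positive⁻¹ 1ℚ) Λ≥1

  -- A real inequality holds at each late index only up to ε, while the left-hand count is constant.
  -- A single rational `Q` above all late terms of q removes the dependence on the index, and ε can
  -- then tend to 0.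
  rational-spread : ∀ {Q} N → (∀ b → N ≤ b → seq q b ≤ᵠ Q) →
    ∀ i A → Any (A ⊆_) H → ∣ A ∣ ≤ r (inject₁ i) → r (suc i) ≤ ∣ A ∣ → ∀ j → r (suc i) ≤ j →
    ι (meetingIn H A j) ≤ᵠ Q ^ j * ι (length H)
  rational-spread {Q} N q≤Q i A A⊆ ≤A A≤ j j≥ = ≤-+ε (λ ε ε>0 →
    let M , le = eventually-≤ (spread i A (Listₚ.filter-some (A ⊆?_) A⊆) ≤A A≤ j j≥) ε ε>0
        b = M ℕ.⊔ N
    in ℚₚ.≤-trans (subst₂ _≤ᵠ_ (sym (ι≡/1 (meetingIn H A j)))
          (cong (_+ ε) (cong₂ _*_ (seq-^ q j b) (sym (ι≡/1 (length H))))) (le b (ℕₚ.m≤m⊔n M N)))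
        (ℚₚ.+-monoˡ-≤ ε (*-monoʳ (ι (length H)) (ι-nonNeg (length H))
          (^-monoˡ (ℚₚ.<⇒≤ (inv-pos κ κ>0 b)) (q≤Q b (ℕₚ.m≤n⊔m M N)) j))))

  -- The theorem at one index, where qᵢ, Cᵢ, pᵢ and J are the terms of q, C, p and 1 / (C Λ).
  at-index : ∀ {q₀ qᵢ Cᵢ pᵢ J} N → 0ℚ <ᵠ q₀ → q₀ ≤ᵠ qᵢ → (∀ b → N ≤ b → seq q b ≤ᵠ qᵢ + qᵢ) →
    K₀ ≤ᵠ Cᵢ + 1ℚ → Cᵢ * Λ * qᵢ ≤ᵠ pᵢ + ½ * q₀ → pᵢ ≤ᵠ 1ℚ + 1ℚ → Cᵢ * Λ * J ≡ 1ℚ → 0ℚ <ᵠ J →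
    ∀ p′ → p′ ≤ᵠ 1ℚ → pᵢ ≤ᵠ p′ ⊎ 1ℚ ≤ᵠ p′ → 1ℚ - K₀ * J ≤ᵠ Pr-rainbow (suc k) p′ (colorMass k) H
  at-index {q₀} {qᵢ} {Cᵢ} {pᵢ} {J} N q₀>0 q₀≤q q≤Q K≤C CΛq≤p p≤2 CΛJ≡1 J>0 p′ p′≤1 p≤p′ =
    ℚₚ.≤-trans (≤-by ((K₀ - (ℤ.+ 1120 ℚ./ 1)) * J) (*-nonNeg (diff≥0 (ℚₚ.≤ᵇ⇒≤ {ℤ.+ 1120 ℚ./ 1} {K₀} tt)) J≥0)
        (trans (solve 2 (λ k j → (con 1ℚ :- k :* j) :+ (k :- con (ℤ.+ 1120 ℚ./ 1)) :* j := con 1ℚ :- con (ℤ.+ 1120 ℚ./ 1) :* j) refl K₀ J)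
          (cong (λ z → 1ℚ - z) (sym loss))))
      (rational-theorem H r uniform nonEmpty r-decreasing last≡1 (rational-spread N q≤Q) r≤k p′≤1
        (colorMass-nonNeg k) (colorMass-inverse k) (ℚₚ.<⇒≤ Q>0) (recip-inverse Q Q>0) (ℚₚ.<⇒≤ (recip-pos Q Q>0))
        C≥0 C-inv iC>0 iC≤ (recip-inverse Λ Λ>0) (recip-pos Λ Λ>0) (CQΛ≤ p≤p′))
    where
    J≥0 = ℚₚ.<⇒≤ J>0
    Λ≥0 = ℚₚ.<⇒≤ Λ>0
    q>0 : 0ℚ <ᵠ qᵢ
    q>0 = ℚₚ.<-≤-trans q₀>0 q₀≤q
    -- Twice the current term dominates all later terms of q, as `rational-spread` requires.
    Q = qᵢ + qᵢ
    Q>0 : 0ℚ <ᵠ Q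
    Q>0 = ℚₚ.+-mono-< q>0 q>0
    C≥3840 : (ℤ.+ 3840 ℚ./ 1) ≤ᵠ Cᵢ
    C≥3840 = ℚₚ.≤-trans (ℚₚ.≤ᵇ⇒≤ {ℤ.+ 3840 ℚ./ 1} {K₀ - 1ℚ} tt)
      (ℚₚ.≤-trans (ℚₚ.+-monoˡ-≤ (- 1ℚ) K≤C) (ℚₚ.≤-reflexive (solve 1 (λ c → (c :+ con 1ℚ) :- con 1ℚ := c) refl Cᵢ)))
    -- One factor 2 compensates for `Q`; the remaining 4 absorbs the approximation errors and the
    -- case where p′ is 1.
    C = Cᵢ * 1/8
    C≥480 : (ℤ.+ 480 ℚ./ 1) ≤ᵠ C
    C≥480 = *-monoʳ 1/8 (ℚₚ.nonNegative⁻¹ 1/8) C≥3840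
    C≥0 : 0ℚ ≤ᵠ C
    C≥0 = ℚₚ.≤-trans (ℚₚ.nonNegative⁻¹ (ℤ.+ 480 ℚ./ 1)) C≥480
    iC = ι 8 * (Λ * J)
    iC>0 : 0ℚ <ᵠ iC
    iC>0 = *-pos (ℚₚ.positive⁻¹ (ι 8)) (*-pos Λ>0 J>0)
    C-inv : C * iC ≡ 1ℚ
    C-inv = trans (solve 3 (λ c l j → (c :* con 1/8) :* (con (ι 8) :* (l :* j)) := c :* l :* j) refl Cᵢ Λ J) CΛJ≡1
    iC≤ : iC ≤ᵠ 1/480
    iC≤ = ≤-by ((C - (ℤ.+ 480 ℚ./ 1)) * 1/480 * iC) (*-nonNeg (*-nonNeg (diff≥0 C≥480) (ℚₚ.nonNegative⁻¹ 1/480)) (ℚₚ.<⇒≤ iC>0))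
      (trans (solve 2 (λ c i → i :+ (c :- con (ℤ.+ 480 ℚ./ 1)) :* con 1/480 :* i := con 1/480 :* (c :* i)) refl C iC)
        (trans (cong (1/480 *_) C-inv) (ℚₚ.*-identityʳ 1/480)))
    loss : (ℤ.+ 140 ℚ./ 1) * (iC * recip Λ Λ>0) ≡ (ℤ.+ 1120 ℚ./ 1) * J
    loss = trans (solve 3 (λ l j i → con (ℤ.+ 140 ℚ./ 1) :* ((con (ι 8) :* (l :* j)) :* i) := con (ℤ.+ 1120 ℚ./ 1) :* j :* (l :* i)) refl Λ J (recip Λ Λ>0))
      (trans (cong ((ℤ.+ 1120 ℚ./ 1) * J *_) (recip-inverse Λ Λ>0)) (ℚₚ.*-identityʳ ((ℤ.+ 1120 ℚ./ 1) * J)))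
    X = Cᵢ * Λ * qᵢ
    q₀≤X : q₀ ≤ᵠ X
    q₀≤X = ℚₚ.≤-trans q₀≤q (subst (_≤ᵠ X) (ℚₚ.*-identityˡ qᵢ) (*-monoʳ qᵢ (ℚₚ.<⇒≤ q>0)
      (*-mono-≤-nonNeg {1ℚ} {Cᵢ} {1ℚ} {Λ} (ℚₚ.≤-trans (ℚₚ.nonNegative⁻¹ (ℤ.+ 3840 ℚ./ 1)) C≥3840) 0≤1 (ℚₚ.≤-trans (ℚₚ.≤ᵇ⇒≤ {1ℚ} {ℤ.+ 3840 ℚ./ 1} tt) C≥3840) Λ≥1)))
    X≥0 = ℚₚ.≤-trans (ℚₚ.<⇒≤ q₀>0) q₀≤X
    ½≥0 = ℚₚ.nonNegative⁻¹ ½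
    -- The left-hand side is X / 4. From X ≤ pᵢ + q₀ / 2 and q₀ ≤ X it follows that X / 2 ≤ pᵢ,
    -- which settles the first case; in the second, pᵢ ≤ 2 gives X / 4 ≤ 1.
    CQΛ≤ : pᵢ ≤ᵠ p′ ⊎ 1ℚ ≤ᵠ p′ → C * Q * Λ ≤ᵠ p′
    CQΛ≤ (inj₁ pᵢ≤p′) = ℚₚ.≤-trans (≤-by ((pᵢ + ½ * q₀ - X) + (½ * (X - q₀) + ½ * ½ * X))
        (+-nonNeg (diff≥0 CΛq≤p) (+-nonNeg (*-nonNeg ½≥0 (diff≥0 q₀≤X)) (*-nonNeg (ℚₚ.nonNegative⁻¹ (½ * ½)) X≥0)))
        (solve 5 (λ c l q p z → (c :* con 1/8) :* (q :+ q) :* l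
            :+ ((p :+ con ½ :* z :- c :* l :* q) :+ (con ½ :* (c :* l :* q :- z) :+ con (½ * ½) :* (c :* l :* q)))
          := p) refl Cᵢ Λ qᵢ pᵢ q₀))
      pᵢ≤p′
    CQΛ≤ (inj₂ 1≤p′) = ℚₚ.≤-trans (≤-by (½ * (pᵢ + ½ * q₀ - X) + (½ * ½ * (X - q₀) + ½ * (1ℚ + 1ℚ - pᵢ)))
        (+-nonNeg (*-nonNeg ½≥0 (diff≥0 CΛq≤p)) (+-nonNeg (*-nonNeg (ℚₚ.nonNegative⁻¹ (½ * ½)) (diff≥0 q₀≤X)) (*-nonNeg ½≥0 (diff≥0 p≤2))))
        (solve 5 (λ c l q p z → (c :* con 1/8) :* (q :+ q) :* l
            :+ (con ½ :* (p :+ con ½ :* z :- c :* l :* q) :+ (con (½ * ½) :* (c :* l :* q :- z) :+ con ½ :* (con (1ℚ + 1ℚ) :- p)))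
          := con 1ℚ) refl Cᵢ Λ qᵢ pᵢ q₀))
      1≤p′

  private
    lip : Lipschitz (λ p → Pr-rainbow (suc k) p (colorMass k) H)
    lip = lipschitz-Pr (suc k) (colorMass k) H

    D>0 : 0ℚ <ᵠ 1ℚ + rate lip
    D>0 = ℚₚ.+-mono-<-≤ (ℚₚ.positive⁻¹ 1ℚ) (rate-nonNeg lip)

    β : ℚ
    β = proj₁ (eventually-bounded κ)

    β>0 : 0ℚ <ᵠ β
    β>0 = proj₁ (proj₂ (eventually-bounded κ))

    -- A positive lower bound for the late terms of q, available because κ is bounded. Additive
    -- errors of order `q₀` can thus be absorbed multiplicatively.
    q₀ : ℚ
    q₀ = recip β β>0

    q₀>0 : 0ℚ <ᵠ q₀
    q₀>0 = recip-pos β β>0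

    q₀≤q : ∀ i → seq κ i * seq q i ≡ 1ℚ → ℚ.∣ seq κ i ∣ ≤ᵠ β → q₀ ≤ᵠ seq q i
    q₀≤q i κq≡1 κ≤β = ≤-by ((β - seq κ i) * seq q i * q₀)
      (*-nonNeg (*-nonNeg (diff≥0 (ℚₚ.≤-trans (p≤∣p∣ (seq κ i)) κ≤β)) (ℚₚ.<⇒≤ (inv-pos κ κ>0 i))) (ℚₚ.<⇒≤ q₀>0))
      (trans (solve 4 (λ z b c q → z :+ (b :- c) :* q :* z := z :+ (b :* z) :* q :- (c :* q) :* z) refl q₀ β (seq κ i) (seq q i))
        (trans (cong₂ (λ u w → q₀ + u * seq q i - w * q₀) (recip-inverse β β>0) κq≡1)
          (solve 2 (λ z q → z :+ con 1ℚ :* q :- con 1ℚ :* z := q) refl q₀ (seq q i))))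

    q≤2q : ∀ b i → ℚ.∣ seq q b - seq q i ∣ ≤ᵠ q₀ → q₀ ≤ᵠ seq q i → seq q b ≤ᵠ seq q i + seq q i
    q≤2q b i close q₀≤ = ℚₚ.≤-trans
      (≤-by (q₀ - (seq q b - seq q i)) (diff≥0 (ℚₚ.≤-trans (p≤∣p∣ (seq q b - seq q i)) close))
        (solve 3 (λ b q z → b :+ (z :- (b :- q)) := q :+ z) refl (seq q b) (seq q i) q₀))
      (ℚₚ.+-monoʳ-≤ (seq q i) q₀≤)

  module _ (p C : ℝ) (p≤1 : p ≤ℝ 1ℝ) (K≤C : fromℚ K₀ ≤ℝ C) (CΛq≤p : C *ℝ fromℕ (suc (suc m)) *ℝ q ≤ℝ p)
           (CΛ>0 : 0ℝ <ℝ C *ℝ fromℕ (suc (suc m))) where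

    private
      J : ℕ → ℚ
      J = seq (inv (C *ℝ fromℕ (suc (suc m))) CΛ>0)

    Pr-bound : 1ℝ -ℝ fromℚ K₀ *ℝ inv (C *ℝ fromℕ (suc (suc m))) CΛ>0 ≤ℝ Pr {suc k} p (containsRainbowEdge? H)
    -- Only the last approximation to p depends on ε, divided by 1 + `rate` so that the Lipschitz
    -- error at 1 stays below ε. All other accuracies are fixed in advance.
    Pr-bound = mk≤ (λ ε ε>0 → combine ε>0 (inv-inverse κ κ>0) (proj₂ (proj₂ (eventually-bounded κ))) (cauchy q q₀ q₀>0)
      (eventually-≤ K≤C 1ℚ (ℚₚ.positive⁻¹ 1ℚ)) (eventually-≤ CΛq≤p (½ * q₀) (half-pos q₀>0))
      (eventually-≤ p≤1 1ℚ (ℚₚ.positive⁻¹ 1ℚ))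
      (eventually-≤ p≤1 (ε * recip (1ℚ + rate lip) D>0) (*-pos ε>0 (recip-pos (1ℚ + rate lip) D>0)))
      (inv-inverse (C *ℝ fromℕ (suc (suc m))) CΛ>0))
      where
      Bound : ℚ → ℕ → Set
      Bound ε i = 1ℚ - K₀ * J i ≤ᵠ seq (Pr {suc k} p (containsRainbowEdge? H)) i + ε

      Eventually : (ℕ → Set) → Set
      Eventually P = ∃ λ N → ∀ i → N ≤ i → P i

      combine : ∀ {ε} → 0ℚ <ᵠ ε →
        Eventually (λ i → seq κ i * seq q i ≡ 1ℚ) →
        Eventually (λ i → ℚ.∣ seq κ i ∣ ≤ᵠ β) →
        (∃ λ N → ∀ b i → N ≤ b → N ≤ i → ℚ.∣ seq q b - seq q i ∣ ≤ᵠ q₀) →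
        Eventually (λ i → K₀ ≤ᵠ seq C i + 1ℚ) →
        Eventually (λ i → seq C i * (ℤ.+ suc (suc m) ℚ./ 1) * seq q i ≤ᵠ seq p i + ½ * q₀) →
        Eventually (λ i → seq p i ≤ᵠ 1ℚ + 1ℚ) →
        Eventually (λ i → seq p i ≤ᵠ 1ℚ + ε * recip (1ℚ + rate lip) D>0) →
        Eventually (λ i → seq C i * (ℤ.+ suc (suc m) ℚ./ 1) * J i ≡ 1ℚ) →
        Eventually (Bound ε)
      combine {ε} ε>0 (N₁ , κq≡1) (N₂ , κ≤β) (N₃ , q-close) (N₄ , K≤Cᵢ) (N₅ , CΛq≤pᵢ) (N₆ , pᵢ≤2) (N₇ , pᵢ≤1+ε′) (N₈ , CΛJ≡1) =
        List.foldr ℕ._⊔_ 0 Ns , λ i i≥ → at i (max≤⇒All≤ Ns i≥)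
        where
        Ns = N₁ ∷ N₂ ∷ N₃ ∷ N₄ ∷ N₅ ∷ N₆ ∷ N₇ ∷ N₈ ∷ []
        at : ∀ i → All (_≤ i) Ns → Bound ε i
        at i (i₁ ∷ i₂ ∷ i₃ ∷ i₄ ∷ i₅ ∷ i₆ ∷ i₇ ∷ i₈ ∷ []) =
          subst (λ z → 1ℚ - K₀ * J i ≤ᵠ z + ε) (sym (seq-Pr {k} p H i))
            (clamp {F = λ p → Pr-rainbow (suc k) p (colorMass k) H} ε>0 lip D>0 (pᵢ≤2 i i₆) (pᵢ≤1+ε′ i i₇)
              (at-index {q₀} {seq q i} {seq C i} {seq p i} {J i} N₃ q₀>0 q₀≤ (λ b b≥ → q≤2q b i (q-close b i b≥ i₃) q₀≤)
                (K≤Cᵢ i i₄)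
                (subst (λ l → seq C i * l * seq q i ≤ᵠ seq p i + ½ * q₀) (sym Λ≡) (CΛq≤pᵢ i i₅)) (pᵢ≤2 i i₆)
                (subst (λ l → seq C i * l * J i ≡ 1ℚ) (sym Λ≡) (CΛJ≡1 i i₈))
                (inv-pos (C *ℝ fromℕ (suc (suc m))) CΛ>0 i)))
          where
          q₀≤ : q₀ ≤ᵠ seq q i
          q₀≤ = q₀≤q i (κq≡1 i i₁) (κ≤β i i₂)

theorem5 : Σ ℝ λ K → Σ (0ℝ <ℝ K) λ K>0 →
    ∀ (n ℓ : ℕ) (H : Hypergraph n) (r : Fin (suc ℓ) → ℕ) (κ : ℝ) (κ>0 : 0ℝ <ℝ κ) →
    2 ≤ suc ℓ →
    Uniform (r zero) H →
    Spread (inv κ κ>0) r H →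
    r (lastFin ℓ) ≡ 1 →
    ∀ (k : ℕ) .{{_ : NonZero k}} → r zero ≤ k →
    ∀ (p C : ℝ) → p ≤ℝ 1ℝ → (K≤C : K ≤ℝ C) →
    C *ℝ fromℕ (suc ℓ) *ℝ inv κ κ>0 ≤ℝ p →
    1ℝ -ℝ K *ℝ inv (C *ℝ fromℕ (suc ℓ)) (*ℝ-pos (<-≤ℝ-trans K>0 K≤C) (fromℕ-pos (suc ℓ)))
      ≤ℝ Pr {k} p (containsRainbowEdge? H)
theorem5 = fromℚ K₀ , mk< K₀ (ℚₚ.positive⁻¹ K₀) (0 , λ _ _ → ℚₚ.≤-reflexive (ℚₚ.+-identityˡ K₀)) , proof
  where
  proof : ∀ n ℓ (H : Hypergraph n) (r : Fin (suc ℓ) → ℕ) κ κ>0 → _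
  proof n zero    H r κ κ>0 (ℕ.s≤s ())
  proof n (suc m) H r κ κ>0 _ uniform sp last≡1 zero    r≤k = ⊥-elim (ℕₚ.<⇒≱ (Spread.r-positive sp zero) r≤k)
  proof n (suc m) H r κ κ>0 _ uniform sp last≡1 (suc k) r≤k p C p≤1 K≤C CΛq≤p =
    Pr-bound H r κ κ>0 uniform sp last≡1 r≤k p C p≤1 K≤C CΛq≤p _
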